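{- Let $\mathsf{R}$ be a principal ideal domain, let $\varphi_1:\mathbb{HA}_{\mathsf{R}}\to\mathbb{IH}_{\mathsf{R}}$ and $\varphi_2:\mathbb{HA}_{\mathsf{R}}^{op}\to\mathbb{IH}_{\mathsf{R}}$ be the PROP morphisms obtained by composing the coproduct injections into $\mathbb{HA}_{\mathsf{R}}+\mathbb{HA}_{\mathsf{R}}^{op}$ with the quotient map to $\mathbb{IH}_{\mathsf{R}}$, and let $c\in\mathbb{IH}_{\mathsf{R}}[n,m]$ be any arrow. Then: (i) there exist $c_1$ in $\mathbb{HA}_{\mathsf{R}}^{op}$ and $c_2$ in $\mathbb{HA}_{\mathsf{R}}$ such that $c=\varphi_2(c_1);\varphi_1(c_2)$; (ii) there exist $c_3$ in $\mathbb{HA}_{\mathsf{R}}$ and $c_4$ in $\mathbb{HA}_{\mathsf{R}}^{op}$ such that $c=\varphi_1(c_3);\varphi_2(c_4)$.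
   Context: A PROP is a strict symmetric monoidal category whose objects are the natural numbers and whose monoidal product $\oplus$ on objects is addition. Morphisms of PROPs are identity-on-objects strict symmetric monoidal functors. Composition is written in diagrammatic order $f;g$. The PROP presented by generators $\Sigma$ and equations $E$ has as arrows the terms built from $\Sigma$, $\mathrm{id}_1$ and the symmetry $\sigma:=\sigma_{1,1}$ using $;$ and $\oplus$, modulo the laws of symmetric monoidal categories and the smallest congruence containing $E$. The PROP $\mathbb{HA}_{\mathsf{R}}$ has generators $\Delta_\bullet:1\to2$, $\varepsilon_\bullet:1\to0$, $\mu_\circ:2\to1$, $\eta_\circ:0\to1$ and $s_k:1\to1$ for each $k\in\mathsf{R}$, and equations (for all $k,k_1,k_2\in\mathsf{R}$): (A1) $(\eta_\circ\oplus\mathrm{id}_1);\mu_\circ=\mathrm{id}_1$; (A2) $\sigma;\mu_\circ=\mu_\circ$; (A3) $(\mu_\circ\oplus\mathrm{id}_1);\mu_\circ=(\mathrm{id}_1\oplus\mu_\circ);\mu_\circ$; (A4) $\Delta_\bullet;(\varepsilon_\bullet\oplus\mathrm{id}_1)=\mathrm{id}_1$; (A5) $\Delta_\bullet;\sigma=\Delta_\bullet$; (A6) $\Delta_\bullet;(\Delta_\bullet\oplus\mathrm{id}_1)=\Delta_\bullet;(\mathrm{id}_1\oplus\Delta_\bullet)$; (A7) $\mu_\circ;\varepsilon_\bullet=\varepsilon_\bullet\oplus\varepsilon_\bullet$; (A8) $\mu_\circ;\Delta_\bullet=(\Delta_\bullet\oplus\Delta_\bullet);(\mathrm{id}_1\oplus\sigma\oplus\mathrm{id}_1);(\mu_\circ\oplus\mu_\circ)$;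 (A9) $\eta_\circ;\Delta_\bullet=\eta_\circ\oplus\eta_\circ$; (A10) $\eta_\circ;\varepsilon_\bullet=\mathrm{id}_0$; (A11) $s_1=\mathrm{id}_1$; (A12) $s_{k_1};s_{k_2}=s_{k_1k_2}$; (A13) $\mu_\circ;s_k=(s_k\oplus s_k);\mu_\circ$; (A14) $\eta_\circ;s_k=\eta_\circ$; (A15) $s_k;\Delta_\bullet=\Delta_\bullet;(s_k\oplus s_k)$; (A16) $s_k;\varepsilon_\bullet=\varepsilon_\bullet$; (A17) $s_0=\varepsilon_\bullet;\eta_\circ$; (A18) $\Delta_\bullet;(s_{k_1}\oplus s_{k_2});\mu_\circ=s_{k_1+k_2}$. The opposite PROP $\mathbb{HA}_{\mathsf{R}}^{op}$ is presented by generators $\mu_\bullet:2\to1$, $\eta_\bullet:0\to1$, $\Delta_\circ:1\to2$, $\varepsilon_\circ:1\to0$, $\bar s_k:1\to1$ ($k\in\mathsf{R}$), the opposites of $\Delta_\bullet,\varepsilon_\bullet,\mu_\circ,\eta_\circ,s_k$ respectively, and the reversed equations (A1)$^{op}$–(A18)$^{op}$. The coproduct $\mathbb{HA}_{\mathsf{R}}+\mathbb{HA}_{\mathsf{R}}^{op}$ is presented by the disjoint union of the generators and of the equations. $\mathbb{IH}_{\mathsf{R}}$ is the quotient of $\mathbb{HA}_{\mathsf{R}}+\mathbb{HA}_{\mathsf{R}}^{op}$ by the following equations, for all non-zero $l\in\mathsf{R}$: (I1) $s_l;\bar s_l=\mathrm{id}_1$; (I2) $\bar s_l;s_l=\mathrm{id}_1$;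 (I3) $(\Delta_\circ\oplus\mathrm{id}_1);(\mathrm{id}_1\oplus\mu_\circ)=\mu_\circ;\Delta_\circ=(\mathrm{id}_1\oplus\Delta_\circ);(\mu_\circ\oplus\mathrm{id}_1)$; (I4) $(\Delta_\bullet\oplus\mathrm{id}_1);(\mathrm{id}_1\oplus\mu_\bullet)=\mu_\bullet;\Delta_\bullet=(\mathrm{id}_1\oplus\Delta_\bullet);(\mu_\bullet\oplus\mathrm{id}_1)$; (I5) $\eta_\circ;\Delta_\circ=\eta_\bullet;\Delta_\bullet;(\mathrm{id}_1\oplus s_{ -1})$; (I6) $\mu_\circ;\varepsilon_\circ=(\mathrm{id}_1\oplus s_{ -1});\mu_\bullet;\varepsilon_\bullet$; (I7) $\Delta_\circ;\mu_\circ=\mathrm{id}_1$; (I8) $\Delta_\bullet;\mu_\bullet=\mathrm{id}_1$. -}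

module Defs where

open import Algebra.Bundles using (CommutativeRing)
open import Data.Nat.Base using (ℕ; zero; suc; _+_)
open import Data.Nat.Properties using (+-assoc; +-identityʳ)
open import Data.Product.Base using (∃-syntax)
open import Data.Sum.Base using (_⊎_; inj₁; inj₂)
open import Function.Base using (_∘_)
open import Function.Bundles using (_⇔_)
open import Level using (Level; _⊔_) renaming (suc to lsuc)
open import Relation.Binary.PropositionalEquality
  using (_≡_; refl; sym; trans; cong; cong₂; subst₂)
open import Relation.Binary.Structures using (IsEquivalence)
open import Relation.Nullary.Negation.Core using (¬_)

private
  variable
    a e a₁ e₁ a₂ e₂ a₃ e₃ : Level
    k l m n m′ n′ k′ l′ : ℕ

module _ {c ℓ} (R : CommutativeRing c ℓ) where
  private module R = CommutativeRing R
  open R using (Carrier; _≈_; 0#; 1#)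

  -- Subsets of the ring are predicates at level c ⊔ ℓ, the level of the
  -- divisibility predicate λ x → ∃[ r ] x ≈ r * g.
  record Ideal : Set (lsuc (c ⊔ ℓ)) where
    field
      _∈I      : Carrier → Set (c ⊔ ℓ)
      resp     : ∀ {x y} → x ≈ y → x ∈I → y ∈I
      0-closed : 0# ∈I
      +-closed : ∀ {x y} → x ∈I → y ∈I → (x R.+ y) ∈I
      *-closed : ∀ r {x} → x ∈I → (r R.* x) ∈I

  Principal : Ideal → Set (c ⊔ ℓ)
  Principal I = ∃[ g ] (∀ x → (x ∈I) ⇔ (∃[ r ] x ≈ (r R.* g)))
    where open Ideal I

  -- Since ideals are arbitrary predicates, principality of the ideals
  -- { x ∣ x ≈ 0 or P } entails excluded middle for P at level c ⊔ ℓ.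
  record IsPrincipalIdealDomain : Set (lsuc (c ⊔ ℓ)) where
    field
      1≉0            : ¬ (1# ≈ 0#)
      noZeroDivisors : ∀ x y → (x R.* y) ≈ 0# → x ≈ 0# ⊎ y ≈ 0#
      principal      : ∀ I → Principal I

-- The hom-sets are setoids.  The strictness laws of ⊕ relate arrows whose
-- types agree only up to a propositional equality between natural numbers,
-- along which one side is transported.
record PROP a e : Set (lsuc (a ⊔ e)) where
  infix  4 _≈_
  infixl 6 _⨾_
  infixr 7 _⊕_
  field
    Hom : ℕ → ℕ → Set a
    _≈_ : Hom m n → Hom m n → Set e
    id  : ∀ n → Hom n n
    _⨾_ : Hom m n → Hom n k → Hom m k
    _⊕_ : Hom m n → Hom m′ n′ → Hom (m + m′) (n + n′)
    σ   : ∀ m n → Hom (m + n) (n + m)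

    isEquivalence : IsEquivalence (_≈_ {m} {n})
    ⨾-cong : {f f′ : Hom m n} {g g′ : Hom n k} →
             f ≈ f′ → g ≈ g′ → f ⨾ g ≈ f′ ⨾ g′
    ⊕-cong : {f f′ : Hom m n} {g g′ : Hom m′ n′} →
             f ≈ f′ → g ≈ g′ → f ⊕ g ≈ f′ ⊕ g′

    ⨾-assoc     : (f : Hom m n) (g : Hom n k) (h : Hom k l) →
                  (f ⨾ g) ⨾ h ≈ f ⨾ (g ⨾ h)
    ⨾-identityˡ : (f : Hom m n) → id m ⨾ f ≈ f
    ⨾-identityʳ : (f : Hom m n) → f ⨾ id n ≈ f

    ⊕-id        : ∀ m n → id m ⊕ id n ≈ id (m + n)
    ⊕-⨾         : (f : Hom m n) (g : Hom n k) (f′ : Hom m′ n′) (g′ : Hom n′ k′) →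
                  (f ⨾ g) ⊕ (f′ ⨾ g′) ≈ (f ⊕ f′) ⨾ (g ⊕ g′)
    ⊕-assoc     : (f : Hom m m′) (g : Hom n n′) (h : Hom k k′) →
                  subst₂ Hom (+-assoc m n k) (+-assoc m′ n′ k′) ((f ⊕ g) ⊕ h)
                    ≈ f ⊕ (g ⊕ h)
    ⊕-identityˡ : (f : Hom m n) → id 0 ⊕ f ≈ f
    ⊕-identityʳ : (f : Hom m n) →
                  subst₂ Hom (+-identityʳ m) (+-identityʳ n) (f ⊕ id 0) ≈ f

    σ-natural    : (f : Hom m m′) (g : Hom n n′) →
                   (f ⊕ g) ⨾ σ m′ n′ ≈ σ m n ⨾ (g ⊕ f)
    σ-involutive : ∀ m n → σ m n ⨾ σ n m ≈ id (m + n)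
    σ-hexagon    : ∀ m n k →
                   subst₂ Hom (+-assoc m n k) (+-assoc n m k) (σ m n ⊕ id k)
                     ⨾ subst₂ Hom refl (sym (+-assoc n k m)) (id n ⊕ σ m k)
                   ≈ σ m (n + k)

record PROPMorphism (P : PROP a₁ e₁) (Q : PROP a₂ e₂)
                    : Set (a₁ ⊔ e₁ ⊔ a₂ ⊔ e₂) where
  private
    module P = PROP P
    module Q = PROP Q
  field
    ⟦_⟧    : P.Hom m n → Q.Hom m n
    ⟦⟧-cong : {f g : P.Hom m n} → f P.≈ g → ⟦ f ⟧ Q.≈ ⟦ g ⟧
    ⟦⟧-id   : ∀ n → ⟦ P.id n ⟧ Q.≈ Q.id n
    ⟦⟧-⨾    : (f : P.Hom m n) (g : P.Hom n k) →
              ⟦ f P.⨾ g ⟧ Q.≈ ⟦ f ⟧ Q.⨾ ⟦ g ⟧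
    ⟦⟧-⊕    : (f : P.Hom m n) (g : P.Hom m′ n′) →
              ⟦ f P.⊕ g ⟧ Q.≈ ⟦ f ⟧ Q.⊕ ⟦ g ⟧
    ⟦⟧-σ    : ∀ m n → ⟦ P.σ m n ⟧ Q.≈ Q.σ m n

infixl 9 _⟫_

_⟫_ : {P : PROP a₁ e₁} {Q : PROP a₂ e₂} {S : PROP a₃ e₃} →
      PROPMorphism P Q → PROPMorphism Q S → PROPMorphism P S
_⟫_ {S = S} F G = record
  { ⟦_⟧     = G.⟦_⟧ ∘ F.⟦_⟧
  ; ⟦⟧-cong = G.⟦⟧-cong ∘ F.⟦⟧-cong
  ; ⟦⟧-id   = λ n → S-trans (G.⟦⟧-cong (F.⟦⟧-id n)) (G.⟦⟧-id n)
  ; ⟦⟧-⨾    = λ f g → S-trans (G.⟦⟧-cong (F.⟦⟧-⨾ f g)) (G.⟦⟧-⨾ F.⟦ f ⟧ F.⟦ g ⟧)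
  ; ⟦⟧-⊕    = λ f g → S-trans (G.⟦⟧-cong (F.⟦⟧-⊕ f g)) (G.⟦⟧-⊕ F.⟦ f ⟧ F.⟦ g ⟧)
  ; ⟦⟧-σ    = λ m n → S-trans (G.⟦⟧-cong (F.⟦⟧-σ m n)) (G.⟦⟧-σ m n)
  }
  where
  module F = PROPMorphism F
  module G = PROPMorphism G
  S-trans : ∀ {m n} {f g h : PROP.Hom S m n} →
            PROP._≈_ S f g → PROP._≈_ S g h → PROP._≈_ S f h
  S-trans = IsEquivalence.trans (PROP.isEquivalence S)

Signature : ∀ a → Set (lsuc a)
Signature a = ℕ → ℕ → Set a

infixl 6 _⨾_
infixr 7 _⊕_

data Term {a} (G : Signature a) : ℕ → ℕ → Set a where
  gen : G m n → Term G m n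
  id₀ : Term G 0 0
  id₁ : Term G 1 1
  σ₁₁ : Term G 2 2
  _⨾_ : Term G m n → Term G n k → Term G m k
  _⊕_ : Term G m n → Term G m′ n′ → Term G (m + m′) (n + n′)

Equations : Signature a → ∀ e → Set (a ⊔ lsuc e)
Equations G e = ∀ {m n} → Term G m n → Term G m n → Set e

module _ {G : Signature a} where

  id : ∀ n → Term G n n
  id zero    = id₀
  id (suc n) = id₁ ⊕ id n

  -- Moves the first wire past the n wires below it.
  σ₁ : ∀ n → Term G (1 + n) (n + 1)
  σ₁ zero    = id₁
  σ₁ (suc n) = (σ₁₁ ⊕ id n) ⨾ (id₁ ⊕ σ₁ n)

  σ : ∀ m n → Term G (m + n) (n + m)
  σ zero    n = subst₂ (Term G) refl (sym (+-identityʳ n)) (id n)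
  σ (suc m) n = (id₁ ⊕ σ m n) ⨾ subst₂ (Term G) refl (+-assoc n 1 m) (σ₁ n ⊕ id m)

infix 4 _⊢_≈_

-- The smallest congruence containing E and the laws of strict symmetric
-- monoidal categories.
data _⊢_≈_ {a e} {G : Signature a} (E : Equations G e) :
           Term G m n → Term G m n → Set (a ⊔ e) where
  axiom : {t u : Term G m n} → E t u → E ⊢ t ≈ u

  ≈-refl  : {t : Term G m n} → E ⊢ t ≈ t
  ≈-sym   : {t u : Term G m n} → E ⊢ t ≈ u → E ⊢ u ≈ t
  ≈-trans : {t u v : Term G m n} → E ⊢ t ≈ u → E ⊢ u ≈ v → E ⊢ t ≈ v
  ⨾-cong  : {t t′ : Term G m n} {u u′ : Term G n k} →
            E ⊢ t ≈ t′ → E ⊢ u ≈ u′ → E ⊢ t ⨾ u ≈ t′ ⨾ u′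
  ⊕-cong  : {t t′ : Term G m n} {u u′ : Term G m′ n′} →
            E ⊢ t ≈ t′ → E ⊢ u ≈ u′ → E ⊢ t ⊕ u ≈ t′ ⊕ u′

  ⨾-assoc     : (t : Term G m n) (u : Term G n k) (v : Term G k l) →
                E ⊢ (t ⨾ u) ⨾ v ≈ t ⨾ (u ⨾ v)
  ⨾-identityˡ : (t : Term G m n) → E ⊢ id m ⨾ t ≈ t
  ⨾-identityʳ : (t : Term G m n) → E ⊢ t ⨾ id n ≈ t

  ⊕-id        : ∀ m n → E ⊢ id m ⊕ id n ≈ id (m + n)
  ⊕-⨾         : (t : Term G m n) (u : Term G n k)
                (t′ : Term G m′ n′) (u′ : Term G n′ k′) →
                E ⊢ (t ⨾ u) ⊕ (t′ ⨾ u′) ≈ (t ⊕ t′) ⨾ (u ⊕ u′)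
  ⊕-assoc     : (t : Term G m m′) (u : Term G n n′) (v : Term G k k′) →
                E ⊢ subst₂ (Term G) (+-assoc m n k) (+-assoc m′ n′ k′) ((t ⊕ u) ⊕ v)
                    ≈ t ⊕ (u ⊕ v)
  ⊕-identityˡ : (t : Term G m n) → E ⊢ id 0 ⊕ t ≈ t
  ⊕-identityʳ : (t : Term G m n) →
                E ⊢ subst₂ (Term G) (+-identityʳ m) (+-identityʳ n) (t ⊕ id 0) ≈ t

  σ-natural    : (t : Term G m m′) (u : Term G n n′) →
                 E ⊢ (t ⊕ u) ⨾ σ m′ n′ ≈ σ m n ⨾ (u ⊕ t)
  σ-involutive : ∀ m n → E ⊢ σ m n ⨾ σ n m ≈ id (m + n)
  σ-hexagon    : ∀ m n k →
                 E ⊢ subst₂ (Term G) (+-assoc m n k) (+-assoc n m k) (σ m n ⊕ id k)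
                       ⨾ subst₂ (Term G) refl (sym (+-assoc n k m)) (id n ⊕ σ m k)
                     ≈ σ m (n + k)

⟨_∣_⟩ : (G : Signature a) → Equations G e → PROP a (a ⊔ e)
⟨ G ∣ E ⟩ = record
  { Hom           = Term G
  ; _≈_           = E ⊢_≈_
  ; id            = id
  ; _⨾_           = _⨾_
  ; _⊕_           = _⊕_
  ; σ             = σ
  ; isEquivalence = record { refl = ≈-refl ; sym = ≈-sym ; trans = ≈-trans }
  ; ⨾-cong        = ⨾-cong
  ; ⊕-cong        = ⊕-cong
  ; ⨾-assoc       = ⨾-assoc
  ; ⨾-identityˡ   = ⨾-identityˡ
  ; ⨾-identityʳ   = ⨾-identityʳ
  ; ⊕-id          = ⊕-id
  ; ⊕-⨾           = ⊕-⨾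
  ; ⊕-assoc       = ⊕-assoc
  ; ⊕-identityˡ   = ⊕-identityˡ
  ; ⊕-identityʳ   = ⊕-identityʳ
  ; σ-natural     = σ-natural
  ; σ-involutive  = σ-involutive
  ; σ-hexagon     = σ-hexagon
  }

module _ {G : Signature a₁} {H : Signature a₂} (f : ∀ {m n} → G m n → H m n) where

  mapTerm : Term G m n → Term H m n
  mapTerm (gen g) = gen (f g)
  mapTerm id₀     = id₀
  mapTerm id₁     = id₁
  mapTerm σ₁₁     = σ₁₁
  mapTerm (t ⨾ u) = mapTerm t ⨾ mapTerm u
  mapTerm (t ⊕ u) = mapTerm t ⊕ mapTerm u

  mapTerm-subst₂ : (p : m ≡ m′) (q : n ≡ n′) (t : Term G m n) →
                   mapTerm (subst₂ (Term G) p q t) ≡ subst₂ (Term H) p q (mapTerm t)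
  mapTerm-subst₂ refl refl t = refl

  mapTerm-id : ∀ n → mapTerm (id n) ≡ id n
  mapTerm-id zero    = refl
  mapTerm-id (suc n) = cong (id₁ ⊕_) (mapTerm-id n)

  mapTerm-σ₁ : ∀ n → mapTerm (σ₁ n) ≡ σ₁ n
  mapTerm-σ₁ zero    = refl
  mapTerm-σ₁ (suc n) =
    cong₂ (λ t u → (σ₁₁ ⊕ t) ⨾ (id₁ ⊕ u)) (mapTerm-id n) (mapTerm-σ₁ n)

  mapTerm-σ : ∀ m n → mapTerm (σ m n) ≡ σ m n
  mapTerm-σ zero    n =
    trans (mapTerm-subst₂ refl (sym (+-identityʳ n)) (id n))
          (cong (subst₂ (Term H) refl (sym (+-identityʳ n))) (mapTerm-id n))
  mapTerm-σ (suc m) n = cong₂ (λ t u → (id₁ ⊕ t) ⨾ u) (mapTerm-σ m n)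
    (trans (mapTerm-subst₂ refl (+-assoc n 1 m) (σ₁ n ⊕ id m))
           (cong (subst₂ (Term H) refl (+-assoc n 1 m))
                 (cong₂ _⊕_ (mapTerm-σ₁ n) (mapTerm-id m))))

  module _ {E : Equations G e₁} {F : Equations H e₂}
           (f-resp : ∀ {m n} {t u : Term G m n} → E t u → F ⊢ mapTerm t ≈ mapTerm u)
           where

    private
      reflexive : {t u : Term H m n} → t ≡ u → F ⊢ t ≈ u
      reflexive refl = ≈-refl

    mapTerm-resp : {t u : Term G m n} → E ⊢ t ≈ u → F ⊢ mapTerm t ≈ mapTerm u
    mapTerm-resp (axiom x)       = f-resp x
    mapTerm-resp ≈-refl          = ≈-refl
    mapTerm-resp (≈-sym p)       = ≈-sym (mapTerm-resp p)
    mapTerm-resp (≈-trans p q)   = ≈-trans (mapTerm-resp p) (mapTerm-resp q)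
    mapTerm-resp (⨾-cong p q)    = ⨾-cong (mapTerm-resp p) (mapTerm-resp q)
    mapTerm-resp (⊕-cong p q)    = ⊕-cong (mapTerm-resp p) (mapTerm-resp q)
    mapTerm-resp (⨾-assoc t u v) = ⨾-assoc (mapTerm t) (mapTerm u) (mapTerm v)
    mapTerm-resp (⨾-identityˡ {m = m} t) =
      ≈-trans (⨾-cong (reflexive (mapTerm-id m)) ≈-refl) (⨾-identityˡ (mapTerm t))
    mapTerm-resp (⨾-identityʳ {n = n} t) =
      ≈-trans (⨾-cong ≈-refl (reflexive (mapTerm-id n))) (⨾-identityʳ (mapTerm t))
    mapTerm-resp (⊕-id m n) =
      ≈-trans (reflexive (cong₂ _⊕_ (mapTerm-id m) (mapTerm-id n)))
      (≈-trans (⊕-id m n) (reflexive (sym (mapTerm-id (m + n)))))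
    mapTerm-resp (⊕-⨾ t u t′ u′) =
      ⊕-⨾ (mapTerm t) (mapTerm u) (mapTerm t′) (mapTerm u′)
    mapTerm-resp (⊕-assoc {m = m} {m′} {n} {n′} {k} {k′} t u v) =
      ≈-trans
        (reflexive (mapTerm-subst₂ (+-assoc m n k) (+-assoc m′ n′ k′) ((t ⊕ u) ⊕ v)))
        (⊕-assoc (mapTerm t) (mapTerm u) (mapTerm v))
    mapTerm-resp (⊕-identityˡ t) = ⊕-identityˡ (mapTerm t)
    mapTerm-resp (⊕-identityʳ {m = m} {n} t) =
      ≈-trans (reflexive (mapTerm-subst₂ (+-identityʳ m) (+-identityʳ n) (t ⊕ id 0)))
              (⊕-identityʳ (mapTerm t))
    mapTerm-resp (σ-natural {m = m} {m′} {n} {n′} t u) =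
      ≈-trans (⨾-cong ≈-refl (reflexive (mapTerm-σ m′ n′)))
      (≈-trans (σ-natural (mapTerm t) (mapTerm u))
               (⨾-cong (reflexive (sym (mapTerm-σ m n))) ≈-refl))
    mapTerm-resp (σ-involutive m n) =
      ≈-trans (reflexive (cong₂ _⨾_ (mapTerm-σ m n) (mapTerm-σ n m)))
      (≈-trans (σ-involutive m n) (reflexive (sym (mapTerm-id (m + n)))))
    mapTerm-resp (σ-hexagon m n k) =
      ≈-trans (reflexive (cong₂ _⨾_
        (trans (mapTerm-subst₂ (+-assoc m n k) (+-assoc n m k) (σ m n ⊕ id k))
               (cong (subst₂ (Term H) (+-assoc m n k) (+-assoc n m k))
                     (cong₂ _⊕_ (mapTerm-σ m n) (mapTerm-id k))))
        (trans (mapTerm-subst₂ refl (sym (+-assoc n k m)) (id n ⊕ σ m k))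
               (cong (subst₂ (Term H) refl (sym (+-assoc n k m)))
                     (cong₂ _⊕_ (mapTerm-id n) (mapTerm-σ m k))))))
      (≈-trans (σ-hexagon m n k) (reflexive (sym (mapTerm-σ m (n + k)))))

    induced : PROPMorphism ⟨ G ∣ E ⟩ ⟨ H ∣ F ⟩
    induced = record
      { ⟦_⟧     = mapTerm
      ; ⟦⟧-cong = mapTerm-resp
      ; ⟦⟧-id   = λ n → reflexive (mapTerm-id n)
      ; ⟦⟧-⨾    = λ _ _ → ≈-refl
      ; ⟦⟧-⊕    = λ _ _ → ≈-refl
      ; ⟦⟧-σ    = λ m n → reflexive (mapTerm-σ m n)
      }

module _ (G : Signature a) where

  infix 8 _ᵒᵖ

  _ᵒᵖ : Signature a
  _ᵒᵖ m n = G n m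

module _ {G : Signature a} where

  opTerm : Term G m n → Term (G ᵒᵖ) n m
  opTerm (gen g) = gen g
  opTerm id₀     = id₀
  opTerm id₁     = id₁
  opTerm σ₁₁     = σ₁₁
  opTerm (t ⨾ u) = opTerm u ⨾ opTerm t
  opTerm (t ⊕ u) = opTerm t ⊕ opTerm u

  infix 8 _ᵒᵖᴱ

  data _ᵒᵖᴱ (E : Equations G e) : Term (G ᵒᵖ) m n → Term (G ᵒᵖ) m n → Set (a ⊔ e) where
    op : {t u : Term G m n} → E t u → (E ᵒᵖᴱ) (opTerm t) (opTerm u)

infixr 5 _+ˢ_ _+ᴱ_ _∪ᴱ_

_+ˢ_ : Signature a₁ → Signature a₂ → Signature (a₁ ⊔ a₂)
(G +ˢ H) m n = G m n ⊎ H m n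

data _+ᴱ_ {G : Signature a₁} {H : Signature a₂} (E : Equations G e₁) (F : Equations H e₂) :
          Term (G +ˢ H) m n → Term (G +ˢ H) m n → Set (a₁ ⊔ a₂ ⊔ e₁ ⊔ e₂) where
  inˡ : {t u : Term G m n} → E t u → (E +ᴱ F) (mapTerm inj₁ t) (mapTerm inj₁ u)
  inʳ : {t u : Term H m n} → F t u → (E +ᴱ F) (mapTerm inj₂ t) (mapTerm inj₂ u)

_∪ᴱ_ : {G : Signature a} → Equations G e₁ → Equations G e₂ → Equations G (e₁ ⊔ e₂)
(E ∪ᴱ F) t u = E t u ⊎ F t u

module _ {G : Signature a₁} {H : Signature a₂} (E : Equations G e₁) (F : Equations H e₂) where

  injection₁ : PROPMorphism ⟨ G ∣ E ⟩ ⟨ G +ˢ H ∣ E +ᴱ F ⟩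
  injection₁ = induced inj₁ (λ x → axiom (inˡ x))

  injection₂ : PROPMorphism ⟨ H ∣ F ⟩ ⟨ G +ˢ H ∣ E +ᴱ F ⟩
  injection₂ = induced inj₂ (λ x → axiom (inʳ x))

module _ {G : Signature a} (E : Equations G e₁) (F : Equations G e₂) where

  private
    mapTerm-identity : (t : Term G m n) → mapTerm (λ g → g) t ≡ t
    mapTerm-identity (gen g) = refl
    mapTerm-identity id₀     = refl
    mapTerm-identity id₁     = refl
    mapTerm-identity σ₁₁     = refl
    mapTerm-identity (t ⨾ u) = cong₂ _⨾_ (mapTerm-identity t) (mapTerm-identity u)
    mapTerm-identity (t ⊕ u) = cong₂ _⊕_ (mapTerm-identity t) (mapTerm-identity u)

  quotient : PROPMorphism ⟨ G ∣ E ⟩ ⟨ G ∣ E ∪ᴱ F ⟩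
  quotient = induced (λ g → g) λ {_} {_} {t} {u} x →
    axiom (subst₂ (E ∪ᴱ F) (sym (mapTerm-identity t)) (sym (mapTerm-identity u)) (inj₁ x))

module _ {c ℓ} (R : CommutativeRing c ℓ) where
  private module R = CommutativeRing R
  open R using (Carrier; 0#; 1#)

  data HAGen : Signature c where
    Δ• : HAGen 1 2
    ε• : HAGen 1 0
    μ∘ : HAGen 2 1
    η∘ : HAGen 0 1
    s  : Carrier → HAGen 1 1

  module HATerms where
    Δ : Term HAGen 1 2
    Δ = gen Δ•
    ε : Term HAGen 1 0
    ε = gen ε•
    μ : Term HAGen 2 1
    μ = gen μ∘
    η : Term HAGen 0 1
    η = gen η∘
    S : Carrier → Term HAGen 1 1
    S k = gen (s k)

  -- s-cong makes the family s depend only on ring elements up to the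
  -- equality of the ring, which is a setoid equality.
  data HAEq : Equations HAGen (c ⊔ ℓ) where
    s-cong : ∀ {k l} → k R.≈ l → HAEq (HATerms.S k) (HATerms.S l)

    A1  : let open HATerms in HAEq ((η ⊕ id₁) ⨾ μ) id₁
    A2  : let open HATerms in HAEq (σ₁₁ ⨾ μ) μ
    A3  : let open HATerms in HAEq ((μ ⊕ id₁) ⨾ μ) ((id₁ ⊕ μ) ⨾ μ)
    A4  : let open HATerms in HAEq (Δ ⨾ (ε ⊕ id₁)) id₁
    A5  : let open HATerms in HAEq (Δ ⨾ σ₁₁) Δ
    A6  : let open HATerms in HAEq (Δ ⨾ (Δ ⊕ id₁)) (Δ ⨾ (id₁ ⊕ Δ))
    A7  : let open HATerms in HAEq (μ ⨾ ε) (ε ⊕ ε)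
    A8  : let open HATerms in
          HAEq (μ ⨾ Δ) ((Δ ⊕ Δ) ⨾ (id₁ ⊕ σ₁₁ ⊕ id₁) ⨾ (μ ⊕ μ))
    A9  : let open HATerms in HAEq (η ⨾ Δ) (η ⊕ η)
    A10 : let open HATerms in HAEq (η ⨾ ε) id₀
    A11 : let open HATerms in HAEq (S 1#) id₁
    A12 : let open HATerms in ∀ k l → HAEq (S k ⨾ S l) (S (k R.* l))
    A13 : let open HATerms in ∀ k → HAEq (μ ⨾ S k) ((S k ⊕ S k) ⨾ μ)
    A14 : let open HATerms in ∀ k → HAEq (η ⨾ S k) η
    A15 : let open HATerms in ∀ k → HAEq (S k ⨾ Δ) (Δ ⨾ (S k ⊕ S k))
    A16 : let open HATerms in ∀ k → HAEq (S k ⨾ ε) ε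
    A17 : let open HATerms in HAEq (S 0#) (ε ⨾ η)
    A18 : let open HATerms in ∀ k l → HAEq (Δ ⨾ (S k ⊕ S l) ⨾ μ) (S (k R.+ l))

  IHGen : Signature c
  IHGen = HAGen +ˢ HAGen ᵒᵖ

  -- The generators of the second summand are the opposites of those of the
  -- first, so their colours are kept while their arities are swapped: the
  -- opposite of Δ• is μ•, that of μ∘ is Δ∘, and so on.  The superscripts ᵇ
  -- and ʷ stand for the black • and the white ∘.
  module IHTerms where
    Δᵇ : Term IHGen 1 2
    Δᵇ = gen (inj₁ Δ•)
    εᵇ : Term IHGen 1 0
    εᵇ = gen (inj₁ ε•)
    μʷ : Term IHGen 2 1
    μʷ = gen (inj₁ μ∘)
    ηʷ : Term IHGen 0 1
    ηʷ = gen (inj₁ η∘)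
    S : Carrier → Term IHGen 1 1
    S k = gen (inj₁ (s k))

    μᵇ : Term IHGen 2 1
    μᵇ = gen (inj₂ Δ•)
    ηᵇ : Term IHGen 0 1
    ηᵇ = gen (inj₂ ε•)
    Δʷ : Term IHGen 1 2
    Δʷ = gen (inj₂ μ∘)
    εʷ : Term IHGen 1 0
    εʷ = gen (inj₂ η∘)
    S̄ : Carrier → Term IHGen 1 1
    S̄ k = gen (inj₂ (s k))

  data IEq : Equations IHGen (c ⊔ ℓ) where
    I1  : let open IHTerms in ∀ l → ¬ (l R.≈ 0#) → IEq (S l ⨾ S̄ l) id₁
    I2  : let open IHTerms in ∀ l → ¬ (l R.≈ 0#) → IEq (S̄ l ⨾ S l) id₁
    I3ˡ : let open IHTerms in IEq ((Δʷ ⊕ id₁) ⨾ (id₁ ⊕ μʷ)) (μʷ ⨾ Δʷ)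
    I3ʳ : let open IHTerms in IEq (μʷ ⨾ Δʷ) ((id₁ ⊕ Δʷ) ⨾ (μʷ ⊕ id₁))
    I4ˡ : let open IHTerms in IEq ((Δᵇ ⊕ id₁) ⨾ (id₁ ⊕ μᵇ)) (μᵇ ⨾ Δᵇ)
    I4ʳ : let open IHTerms in IEq (μᵇ ⨾ Δᵇ) ((id₁ ⊕ Δᵇ) ⨾ (μᵇ ⊕ id₁))
    I5  : let open IHTerms in IEq (ηʷ ⨾ Δʷ) (ηᵇ ⨾ Δᵇ ⨾ (id₁ ⊕ S (R.- 1#)))
    I6  : let open IHTerms in IEq (μʷ ⨾ εʷ) ((id₁ ⊕ S (R.- 1#)) ⨾ μᵇ ⨾ εᵇ)
    I7  : let open IHTerms in IEq (Δʷ ⨾ μʷ) id₁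
    I8  : let open IHTerms in IEq (Δᵇ ⨾ μᵇ) id₁

  HA : PROP c (c ⊔ ℓ)
  HA = ⟨ HAGen ∣ HAEq ⟩

  HAᵒᵖ : PROP c (c ⊔ ℓ)
  HAᵒᵖ = ⟨ HAGen ᵒᵖ ∣ HAEq ᵒᵖᴱ ⟩

  HA+HAᵒᵖ : PROP c (c ⊔ ℓ)
  HA+HAᵒᵖ = ⟨ IHGen ∣ HAEq +ᴱ HAEq ᵒᵖᴱ ⟩

  IH : PROP c (c ⊔ ℓ)
  IH = ⟨ IHGen ∣ (HAEq +ᴱ HAEq ᵒᵖᴱ) ∪ᴱ IEq ⟩

  φ₁ : PROPMorphism HA IH
  φ₁ = injection₁ HAEq (HAEq ᵒᵖᴱ) ⟫ quotient (HAEq +ᴱ HAEq ᵒᵖᴱ) IEq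

  φ₂ : PROPMorphism HAᵒᵖ IH
  φ₂ = injection₂ HAEq (HAEq ᵒᵖᴱ) ⟫ quotient (HAEq +ᴱ HAEq ᵒᵖᴱ) IEq

{-# OPTIONS --safe #-}

-- An arrow f of HA amounts to a matrix, dual (ι f) is its converse relation,
-- and (i) says that every arrow is a span of matrices.  Every generator of the
-- opposite summand is built from HA, η• and ε∘, so spans need only be closed
-- under post-composition with η•, which slides past everything, and with ε∘,
-- which imposes a linear equation on the apex.  HA is cartesian, so an arrow
-- into 1 + l splits into its first row and the rest.  Bézout reduces the row
-- to (g , 0 , … , 0) by an invertible U with inverse V, and then ε∘ either
-- disappears (g = 0) or sets the first variable to 0 (g ≠ 0).  This needs
-- ι U = dual (ι V), hence that V is surjective; for 2 × 2 matrices of non-zero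
-- determinant, surjectivity follows by elimination, the scalings being
-- surjective by I2.  Exchanging the two colours turns (i) into (ii).
module Submission where

open import Algebra.Bundles using (CommutativeRing)
import Algebra.Properties.Ring as RingProperties
import Algebra.Solver.Ring.NaturalCoefficients.Default as SemiringSolver
open import Data.Nat.Base using (ℕ; zero; suc; _+_)
open import Data.Nat.Properties using (+-assoc; +-identityʳ; ≡-irrelevant)
open import Data.Product.Base using (_×_; _,_; proj₂; ∃₂; Σ-syntax; ∃-syntax)
open import Data.Sum.Base using (_⊎_; inj₁; inj₂)
open import Data.Vec.Base using (Vec; []; _∷_; _++_; take; drop; replicate)
open import Data.Vec.Properties using (take++drop≡id)
open import Data.Vec.Relation.Binary.Pointwise.Inductive using (Pointwise; []; _∷_)
open import Defs hiding (_⨾_)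
open import Function.Bundles using (Equivalence)
open import Level using (Level; _⊔_; Lift; lift; lower)
open import Relation.Binary.PropositionalEquality
  using (_≡_; refl; sym; trans; cong; cong₂; subst₂)
open import Relation.Nullary.Negation.Core using (¬_; contradiction)

-- The reading as relations is only a guide: every step is derived from the equations. Three
-- obstacles shape the proof. Composing two arbitrary spans would require the pullback of two
-- matrices; instead a term is processed generator by generator behind a matrix (`Good`), so that
-- the only pullbacks computed are those along `ηᵇ` and `εʷ`. Next, `I1` and `I2` make single
-- non-zero scalars invertible by their opposites but say nothing of matrices; that the inverse of a
-- matrix agrees with its converse has to be built up from shears and scalings. Finally, the
-- argument splits on whether a scalar is zero, although equality in the ring comes with no decision
-- procedure; the principality of a suitable ideal supplies one. Identities between 2 × 2 matrices
-- are not derived diagrammatically: linear forms separate the arrows of HA (`faithful`), so they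
-- reduce to identities in the ring.

-- Calculus of strict symmetric monoidal terms, and the coherence of block permutations.

module StrictMonoidal {a e : Level} {G : Signature a} (E : Equations G e) where

  open Defs using (_⨾_)

  private
    variable
      k l m n k′ l′ m′ n′ : ℕ
    T : ℕ → ℕ → Set a
    T = Term G

  infix 4 _≈_ _≋_

  _≈_ : T m n → T m n → Set (a ⊔ e)
  t ≈ u = E ⊢ t ≈ u

  -- Equality of arrows whose types agree only propositionally; it replaces
  -- the transports in the strictness laws.
  record _≋_ {m n m′ n′ : ℕ} (t : T m n) (u : T m′ n′) : Set (a ⊔ e) where
    constructor het
    field
      dom≡ : m ≡ m′
      cod≡ : n ≡ n′
      eq   : subst₂ T dom≡ cod≡ t ≈ u

  open _≋_ public

  ≈⇒≋ : {t u : T m n} → t ≈ u → t ≋ u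
  ≈⇒≋ = het refl refl

  ≋-refl : {t : T m n} → t ≋ t
  ≋-refl = ≈⇒≋ ≈-refl

  ≋-sym : {t : T m n} {u : T m′ n′} → t ≋ u → u ≋ t
  ≋-sym (het refl refl p) = ≈⇒≋ (≈-sym p)

  ≋-trans : {t : T m n} {u : T m′ n′} {v : T k l} → t ≋ u → u ≋ v → t ≋ v
  ≋-trans (het refl refl p) (het refl refl q) = ≈⇒≋ (≈-trans p q)

  -- Equality proofs between natural numbers are unique, so the two stored proofs are `refl` and the
  -- transport disappears. This is what lets a chain of `≋` steps wander through differently
  -- bracketed types and still end in an ordinary equation.
  ≋⇒≈ : {t u : T m n} → t ≋ u → t ≈ u
  ≋⇒≈ (het p q r) with refl ← ≡-irrelevant p refl | refl ← ≡-irrelevant q refl = r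

  ≋-⨾ : {t : T m n} {t′ : T m′ n′} {u : T n k} {u′ : T n′ k′} →
        t ≋ t′ → u ≋ u′ → t ⨾ u ≋ t′ ⨾ u′
  ≋-⨾ (het refl refl p) (het r refl q) with refl ← ≡-irrelevant r refl = ≈⇒≋ (⨾-cong p q)

  ≋-⊕ : {t : T m n} {t′ : T m′ n′} {u : T k l} {u′ : T k′ l′} →
        t ≋ t′ → u ≋ u′ → t ⊕ u ≋ t′ ⊕ u′
  ≋-⊕ (het refl refl p) (het refl refl q) = ≈⇒≋ (⊕-cong p q)

  ≋-subst₂ : (r : m ≡ m′) (s : n ≡ n′) (t : T m n) → subst₂ T r s t ≋ t
  ≋-subst₂ refl refl t = ≋-refl

  infix  1 begin_
  infixr 2 _≋⟨_⟩_ _≈⟨_⟩_ _≈⟨_⟨_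
  infix  3 _∎

  begin_ : {t u : T m n} → t ≋ u → t ≈ u
  begin_ = ≋⇒≈

  _≋⟨_⟩_ : (t : T m n) {u : T m′ n′} {v : T k l} → t ≋ u → u ≋ v → t ≋ v
  _ ≋⟨ p ⟩ q = ≋-trans p q

  _≈⟨_⟩_ : (t : T m n) {u : T m n} {v : T k l} → t ≈ u → u ≋ v → t ≋ v
  _ ≈⟨ p ⟩ q = ≋-trans (≈⇒≋ p) q

  _≈⟨_⟨_ : (t : T m n) {u : T m n} {v : T k l} → u ≈ t → u ≋ v → t ≋ v
  _ ≈⟨ p ⟨ q = ≋-trans (≈⇒≋ (≈-sym p)) q

  _∎ : (t : T m n) → t ≋ t
  _ ∎ = ≋-refl

  ≡⇒≈ : {t u : T m n} → t ≡ u → t ≈ u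
  ≡⇒≈ refl = ≈-refl

  ⨾-congˡ : {t : T m n} {u u′ : T n k} → u ≈ u′ → t ⨾ u ≈ t ⨾ u′
  ⨾-congˡ = ⨾-cong ≈-refl

  ⨾-congʳ : {t t′ : T m n} {u : T n k} → t ≈ t′ → t ⨾ u ≈ t′ ⨾ u
  ⨾-congʳ p = ⨾-cong p ≈-refl

  ⊕-congˡ : {t : T m n} {u u′ : T k l} → u ≈ u′ → t ⊕ u ≈ t ⊕ u′
  ⊕-congˡ = ⊕-cong ≈-refl

  ⊕-congʳ : {t t′ : T m n} {u : T k l} → t ≈ t′ → t ⊕ u ≈ t′ ⊕ u
  ⊕-congʳ p = ⊕-cong p ≈-refl

  pullʳ : {t : T m n} {u : T n k} {v : T k l} {w : T n l} →
          u ⨾ v ≈ w → t ⨾ u ⨾ v ≈ t ⨾ w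
  pullʳ p = ≈-trans (⨾-assoc _ _ _) (⨾-congˡ p)

  pushʳ : {t : T m n} {u : T n k} {v : T k l} {w : T n l} →
          w ≈ u ⨾ v → t ⨾ w ≈ t ⨾ u ⨾ v
  pushʳ p = ≈-sym (pullʳ (≈-sym p))

  swapʳ : {t : T m n} {u : T n k} {v : T k l} {u′ : T n k′} {v′ : T k′ l} →
          u ⨾ v ≈ u′ ⨾ v′ → t ⨾ u ⨾ v ≈ t ⨾ u′ ⨾ v′
  swapʳ p = ≈-trans (pullʳ p) (≈-sym (⨾-assoc _ _ _))

  cancelʳ : {t : T m n} {u : T n k} {v : T k n} → u ⨾ v ≈ id n → t ⨾ u ⨾ v ≈ t
  cancelʳ p = ≈-trans (pullʳ p) (⨾-identityʳ _)

  ⊕-assoc≋ : (f : T m m′) (g : T n n′) (h : T k k′) → (f ⊕ g) ⊕ h ≋ f ⊕ (g ⊕ h)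
  ⊕-assoc≋ f g h = het _ _ (⊕-assoc f g h)

  ⊕-identityʳ≋ : (f : T m n) → f ⊕ id 0 ≋ f
  ⊕-identityʳ≋ f = het _ _ (⊕-identityʳ f)

  id≡ : m ≡ n → id m ≋ id n
  id≡ refl = ≋-refl

  id₁≈id : id₁ ≈ id 1
  id₁≈id = ≈-sym (⊕-identityʳ id₁)

  id₁-identityˡ : (t : T 1 n) → id₁ ⨾ t ≈ t
  id₁-identityˡ t = ≈-trans (⨾-congʳ id₁≈id) (⨾-identityˡ t)

  id₁-identityʳ : (t : T m 1) → t ⨾ id₁ ≈ t
  id₁-identityʳ t = ≈-trans (⨾-congˡ id₁≈id) (⨾-identityʳ t)

  whiskerʳ-⨾ : (f : T m n) (g : T n k) → (f ⊕ id l) ⨾ (g ⊕ id l) ≈ (f ⨾ g) ⊕ id l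
  whiskerʳ-⨾ f g = ≈-trans (≈-sym (⊕-⨾ _ _ _ _)) (⊕-congˡ (⨾-identityˡ _))

  whiskerˡ-⨾ : (f : T m n) (g : T n k) → (id l ⊕ f) ⨾ (id l ⊕ g) ≈ id l ⊕ (f ⨾ g)
  whiskerˡ-⨾ f g = ≈-trans (≈-sym (⊕-⨾ _ _ _ _)) (⊕-congʳ (⨾-identityˡ _))

  ⊕-splitˡ : (f : T m n) (g : T k l) → (f ⊕ id k) ⨾ (id n ⊕ g) ≈ f ⊕ g
  ⊕-splitˡ f g =
    ≈-trans (≈-sym (⊕-⨾ _ _ _ _)) (⊕-cong (⨾-identityʳ f) (⨾-identityˡ g))

  ⊕-splitʳ : (f : T m n) (g : T k l) → (id m ⊕ g) ⨾ (f ⊕ id l) ≈ f ⊕ g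
  ⊕-splitʳ f g =
    ≈-trans (≈-sym (⊕-⨾ _ _ _ _)) (⊕-cong (⨾-identityˡ f) (⨾-identityʳ g))

  interchange : (f : T m n) (g : T k l) →
                (f ⊕ id k) ⨾ (id n ⊕ g) ≈ (id m ⊕ g) ⨾ (f ⊕ id l)
  interchange f g = ≈-trans (⊕-splitˡ f g) (≈-sym (⊕-splitʳ f g))

  σ-zeroˡ : ∀ n → σ 0 n ≋ id n
  σ-zeroˡ n = ≋-subst₂ refl (sym (+-identityʳ n)) (id n)

  σ₁-one : σ₁ 1 ≈ σ₁₁
  σ₁-one = begin
    (σ₁₁ ⊕ id 0) ⨾ (id₁ ⊕ id₁)  ≈⟨ ⨾-cong (⊕-identityʳ σ₁₁) (⊕-congˡ id₁≈id) ⟩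
    σ₁₁ ⨾ id 2                  ≈⟨ ⨾-identityʳ σ₁₁ ⟩
    σ₁₁                         ∎

  σ-one : ∀ n → σ 1 n ≈ σ₁ n
  σ-one n = begin
    σ 1 n  ≋⟨ ≋-⨾ (≋-⊕ (≋-refl {t = id₁}) (σ-zeroˡ n))
                 (≋-trans (≋-subst₂ refl (+-assoc n 1 0) (σ₁ n ⊕ id 0)) (⊕-identityʳ≋ (σ₁ n))) ⟩
    id (suc n) ⨾ σ₁ n  ≈⟨ ⨾-identityˡ (σ₁ n) ⟩
    σ₁ n   ∎

  σ-one-one : σ 1 1 ≈ σ₁₁
  σ-one-one = ≈-trans (σ-one 1) σ₁-one

  -- The recursion for `σ` moves one wire by `σ₁ n`, whereas the hexagon law speaks of `σ 1 n`; in
  -- this form the two can be compared in `mid-suc`.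
  σ-suc : ∀ m n → σ (suc m) n
          ≈ (id 1 ⊕ σ m n) ⨾ subst₂ T refl (+-assoc n 1 m) (σ 1 n ⊕ id m)
  σ-suc m n = ⨾-cong (⊕-congʳ id₁≈id) (begin
    subst₂ T refl (+-assoc n 1 m) (σ₁ n ⊕ id m)   ≋⟨ ≋-subst₂ refl (+-assoc n 1 m) _ ⟩
    σ₁ n ⊕ id m                                  ≈⟨ ⊕-congʳ (σ-one n) ⟨
    σ 1 n ⊕ id m                                 ≋⟨ ≋-sym (≋-subst₂ refl (+-assoc n 1 m) _) ⟩
    subst₂ T refl (+-assoc n 1 m) (σ 1 n ⊕ id m)  ∎)

  σ₁₁-involutive : σ₁₁ ⨾ σ₁₁ ≈ id 2
  σ₁₁-involutive =
    ≈-trans (⨾-cong (≈-sym σ-one-one) (≈-sym σ-one-one)) (σ-involutive 1 1)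

  σ₁₁-natural : (f g : T 1 1) → (f ⊕ g) ⨾ σ₁₁ ≈ σ₁₁ ⨾ (g ⊕ f)
  σ₁₁-natural f g =
    ≈-trans (⨾-congˡ (≈-sym σ-one-one)) (≈-trans (σ-natural f g) (⨾-congʳ σ-one-one))

  -- The permutation (x , x′ , y , y′) ↦ (x , y , x′ , y′).
  mid : ∀ m n → T ((m + m) + (n + n)) ((m + n) + (m + n))
  mid m n = subst₂ T
    (trans (cong (m +_) (+-assoc m n n)) (sym (+-assoc m m (n + n))))
    (trans (cong (m +_) (+-assoc n m n)) (sym (+-assoc m n (m + n))))
    (id m ⊕ (σ m n ⊕ id n))

  mid≋ : ∀ m n → mid m n ≋ id m ⊕ (σ m n ⊕ id n)
  mid≋ m n = ≋-subst₂ _ _ _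

  ⊕-regroup : (f : T m m′) (g : T n n′) (h : T k k′) (i : T l l′) →
              (f ⊕ g) ⊕ (h ⊕ i) ≋ f ⊕ ((g ⊕ h) ⊕ i)
  ⊕-regroup f g h i = ≋-trans (⊕-assoc≋ f g (h ⊕ i)) (≋-⊕ ≋-refl (≋-sym (⊕-assoc≋ g h i)))

  mid-natural : (f : T m m′) (g : T m m′) (h : T n n′) (i : T n n′) →
                ((f ⊕ g) ⊕ (h ⊕ i)) ⨾ mid m′ n′ ≈ mid m n ⨾ ((f ⊕ h) ⊕ (g ⊕ i))
  mid-natural {m} {m′} {n} {n′} f g h i = begin
    ((f ⊕ g) ⊕ (h ⊕ i)) ⨾ mid m′ n′
      ≋⟨ ≋-⨾ (⊕-regroup f g h i) (mid≋ m′ n′) ⟩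
    (f ⊕ ((g ⊕ h) ⊕ i)) ⨾ (id m′ ⊕ (σ m′ n′ ⊕ id n′))
      ≈⟨ ⊕-⨾ _ _ _ _ ⟨
    (f ⨾ id m′) ⊕ (((g ⊕ h) ⊕ i) ⨾ (σ m′ n′ ⊕ id n′))
      ≈⟨ ⊕-cong (≈-trans (⨾-identityʳ f) (≈-sym (⨾-identityˡ f)))
           (≈-trans (≈-sym (⊕-⨾ _ _ _ _))
             (≈-trans (⊕-cong (σ-natural g h)
                              (≈-trans (⨾-identityʳ i) (≈-sym (⨾-identityˡ i))))
                      (⊕-⨾ _ _ _ _))) ⟩
    (id m ⨾ f) ⊕ ((σ m n ⊕ id n) ⨾ ((h ⊕ g) ⊕ i))
      ≈⟨ ⊕-⨾ _ _ _ _ ⟩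
    (id m ⊕ (σ m n ⊕ id n)) ⨾ (f ⊕ ((h ⊕ g) ⊕ i))
      ≋⟨ ≋-sym (≋-⨾ (mid≋ m n) (⊕-regroup f h g i)) ⟩
    mid m n ⨾ ((f ⊕ h) ⊕ (g ⊕ i)) ∎

  id-⊕≋ : (f : T k l) → id m ⊕ (id n ⊕ f) ≋ id (m + n) ⊕ f
  id-⊕≋ {m = m} {n} f = ≋-trans (≋-sym (⊕-assoc≋ _ _ f)) (≈⇒≋ (⊕-congʳ (⊕-id m n)))

  ⊕-id≋ : (f : T k l) → (f ⊕ id m) ⊕ id n ≋ f ⊕ id (m + n)
  ⊕-id≋ {m = m} {n} f = ≋-trans (⊕-assoc≋ f _ _) (≈⇒≋ (⊕-congˡ (⊕-id m n)))

  -- The coherence behind the induction step of `copy-+`. The hexagon splits the passage of the new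
  -- wire over `m + n` wires into `A` (over `m`) and `B` (over `n`). The block crossing `S` and `A`
  -- act on disjoint wires and change places; then `S` followed by `B` is the crossing of `suc m`
  -- wires, by `σ-suc`.
  mid-suc : ∀ m n → (id 2 ⊕ mid m n) ⨾ mid 1 (m + n)
                    ≋ (mid 1 m ⊕ id (n + n)) ⨾ mid (suc m) n
  mid-suc m n = 
    (id 2 ⊕ mid m n) ⨾ mid 1 (m + n)
      ≋⟨ ≋-⨾ ≋-refl mid-+ ⟩
    (id 2 ⊕ mid m n) ⨾ (A ⨾ B)
      ≈⟨ ⨾-assoc _ _ _ ⟨
    (id 2 ⊕ mid m n) ⨾ A ⨾ B
      ≋⟨ ≋-⨾ (≋-⨾ id-mid A≋) B≋ ⟩
    (id (2 + m) ⊕ S) ⨾ ((id 1 ⊕ σ 1 m) ⊕ id ((n + m) + n)) ⨾ B′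
      ≈⟨ ⨾-congʳ (≈-sym (interchange (id 1 ⊕ σ 1 m) S)) ⟩
    ((id 1 ⊕ σ 1 m) ⊕ id ((m + n) + n)) ⨾ (id (1 + (m + 1)) ⊕ S) ⨾ B′
      ≈⟨ ⨾-assoc _ _ _ ⟩
    ((id 1 ⊕ σ 1 m) ⊕ id ((m + n) + n)) ⨾ ((id (1 + (m + 1)) ⊕ S) ⨾ B′)
      ≋⟨ ≋-sym (≋-⨾ mid-id mid-suc′) ⟩
    (mid 1 m ⊕ id (n + n)) ⨾ mid (suc m) n ∎
    where
    S : T ((m + n) + n) ((n + m) + n)
    S = σ m n ⊕ id n
    A₀ : T (1 + (m + n)) (m + (1 + n))
    A₀ = subst₂ T (+-assoc 1 m n) (+-assoc m 1 n) (σ 1 m ⊕ id n)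
    B₀ : T (m + (1 + n)) ((m + n) + 1)
    B₀ = subst₂ T refl (sym (+-assoc m n 1)) (id m ⊕ σ 1 n)
    A : T (1 + ((1 + (m + n)) + (m + n))) (1 + ((m + (1 + n)) + (m + n)))
    A = id 1 ⊕ (A₀ ⊕ id (m + n))
    B : T (1 + ((m + (1 + n)) + (m + n))) (1 + (((m + n) + 1) + (m + n)))
    B = id 1 ⊕ (B₀ ⊕ id (m + n))
    mid-+ : mid 1 (m + n) ≋ A ⨾ B
    mid-+ = 
      mid 1 (m + n)                                 ≋⟨ mid≋ 1 (m + n) ⟩
      id 1 ⊕ (σ 1 (m + n) ⊕ id (m + n))             ≈⟨ ⊕-congˡ (⊕-congʳ (≈-sym (σ-hexagon 1 m n))) ⟩
      id 1 ⊕ ((A₀ ⨾ B₀) ⊕ id (m + n))               ≈⟨ ⊕-congˡ (≈-sym (whiskerʳ-⨾ A₀ B₀)) ⟩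
      id 1 ⊕ ((A₀ ⊕ id (m + n)) ⨾ (B₀ ⊕ id (m + n))) ≈⟨ whiskerˡ-⨾ _ _ ⟨
      A ⨾ B ∎
    id-mid : id 2 ⊕ mid m n ≋ id (2 + m) ⊕ S
    id-mid = ≋-trans (≋-⊕ ≋-refl (mid≋ m n)) (id-⊕≋ S)
    A≋ : A ≋ (id 1 ⊕ σ 1 m) ⊕ id ((n + m) + n)
    A≋ = 
      id 1 ⊕ (A₀ ⊕ id (m + n))                 ≋⟨ ≋-⊕ ≋-refl (≋-⊕ (≋-subst₂ _ _ _) ≋-refl) ⟩
      id 1 ⊕ ((σ 1 m ⊕ id n) ⊕ id (m + n))     ≋⟨ ≋-⊕ ≋-refl (⊕-id≋ (σ 1 m)) ⟩
      id 1 ⊕ (σ 1 m ⊕ id (n + (m + n)))        ≋⟨ ≋-sym (⊕-assoc≋ _ _ _) ⟩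
      (id 1 ⊕ σ 1 m) ⊕ id (n + (m + n))        ≋⟨ ≋-⊕ ≋-refl (id≡ (sym (+-assoc n m n))) ⟩
      (id 1 ⊕ σ 1 m) ⊕ id ((n + m) + n) ∎
    -- The bracketing of the middle object is read off from `A≋`, so that the transported `B′`
    -- composes with the rebracketed `A`.
    r : 1 + ((m + (1 + n)) + (m + n)) ≡ (1 + (m + 1)) + ((n + m) + n)
    r = cod≡ A≋
    B′ : T ((1 + (m + 1)) + ((n + m) + n)) (1 + (((m + n) + 1) + (m + n)))
    B′ = subst₂ T r refl B
    B≋ : B ≋ B′
    B≋ = ≋-sym (≋-subst₂ r refl B)
    mid-id : mid 1 m ⊕ id (n + n) ≋ (id 1 ⊕ σ 1 m) ⊕ id ((m + n) + n)
    mid-id =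
      mid 1 m ⊕ id (n + n)                        ≋⟨ ≋-⊕ (mid≋ 1 m) ≋-refl ⟩
      (id 1 ⊕ (σ 1 m ⊕ id m)) ⊕ id (n + n)        ≋⟨ ≋-⊕ (≋-sym (⊕-assoc≋ _ _ _)) ≋-refl ⟩
      ((id 1 ⊕ σ 1 m) ⊕ id m) ⊕ id (n + n)        ≋⟨ ⊕-id≋ _ ⟩
      (id 1 ⊕ σ 1 m) ⊕ id (m + (n + n))           ≋⟨ ≋-⊕ ≋-refl (id≡ (sym (+-assoc m n n))) ⟩
      (id 1 ⊕ σ 1 m) ⊕ id ((m + n) + n) ∎
    C : T (1 + (n + m)) (n + (1 + m))
    C = subst₂ T refl (+-assoc n 1 m) (σ 1 n ⊕ id m)
    C≋B : id (suc m) ⊕ (C ⊕ id n) ≋ B′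
    C≋B =
      id (suc m) ⊕ (C ⊕ id n)
        ≋⟨ ≋-⊕ ≋-refl (≋-⊕ (≋-subst₂ _ _ _) ≋-refl) ⟩
      id (suc m) ⊕ ((σ 1 n ⊕ id m) ⊕ id n)
        ≋⟨ ≋-⊕ (≈⇒≋ (≈-sym (⊕-id 1 m))) (⊕-id≋ (σ 1 n)) ⟩
      (id 1 ⊕ id m) ⊕ (σ 1 n ⊕ id (m + n))
        ≋⟨ ⊕-regroup _ _ _ _ ⟩
      id 1 ⊕ ((id m ⊕ σ 1 n) ⊕ id (m + n))
        ≋⟨ ≋-⊕ ≋-refl (≋-⊕ (≋-sym (≋-subst₂ _ _ _)) ≋-refl) ⟩
      B
        ≋⟨ B≋ ⟩
      B′ ∎
    idσ≋ : id (suc m) ⊕ ((id 1 ⊕ σ m n) ⊕ id n) ≋ id (1 + (m + 1)) ⊕ S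
    idσ≋ =
      id (suc m) ⊕ ((id 1 ⊕ σ m n) ⊕ id n)  ≋⟨ ≋-⊕ ≋-refl (⊕-assoc≋ _ _ _) ⟩
      id (suc m) ⊕ (id 1 ⊕ S)               ≋⟨ id-⊕≋ S ⟩
      id (suc m + 1) ⊕ S                    ∎
    mid-suc′ : mid (suc m) n ≋ (id (1 + (m + 1)) ⊕ S) ⨾ B′
    mid-suc′ =
      mid (suc m) n
        ≋⟨ mid≋ (suc m) n ⟩
      id (suc m) ⊕ (σ (suc m) n ⊕ id n)
        ≈⟨ ⊕-congˡ (≈-trans (⊕-congʳ (σ-suc m n)) (≈-sym (whiskerʳ-⨾ _ _))) ⟩
      id (suc m) ⊕ (((id 1 ⊕ σ m n) ⊕ id n) ⨾ (C ⊕ id n))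
        ≈⟨ whiskerˡ-⨾ _ _ ⟨
      (id (suc m) ⊕ ((id 1 ⊕ σ m n) ⊕ id n)) ⨾ (id (suc m) ⊕ (C ⊕ id n))
        ≋⟨ ≋-⨾ idσ≋ C≋B ⟩
      (id (1 + (m + 1)) ⊕ S) ⨾ B′ ∎

-- Copying and discarding make the monoidal product of HA a categorical product.

module Cartesian {c ℓ : Level} (R : CommutativeRing c ℓ) where

  open Defs using (_⨾_)

  private
    variable
      m n p q r : ℕ
    T : ℕ → ℕ → Set c
    T = Term (HAGen R)

  open HATerms R
  open StrictMonoidal (HAEq R)

  -- Only `σ 0 n` is an identity by definition; `σ n 0` is one because it is inverse to it.
  σ-zeroʳ : ∀ n → σ n 0 ≋ id n
  σ-zeroʳ n =
    σ n 0            ≈⟨ ⨾-identityˡ (σ n 0) ⟨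
    id (n + 0) ⨾ σ n 0
      ≋⟨ ≋-⨾ (≋-trans (id≡ (+-identityʳ n)) (≋-sym (σ-zeroˡ n))) ≋-refl ⟩
    σ 0 n ⨾ σ n 0    ≈⟨ σ-involutive 0 n ⟩
    id n ∎

  counitˡ : Δ ⨾ (ε ⊕ id 1) ≈ id 1
  counitˡ = ≈-trans (⨾-congˡ (⊕-congˡ (≈-sym id₁≈id))) (≈-trans (axiom A4) id₁≈id)

  counitʳ : Δ ⨾ (id 1 ⊕ ε) ≈ id 1
  counitʳ = begin
    Δ ⨾ (id 1 ⊕ ε)          ≈⟨ ⨾-congʳ (axiom A5) ⟨
    Δ ⨾ σ₁₁ ⨾ (id 1 ⊕ ε)    ≈⟨ pullʳ (≈-trans (⨾-congʳ (≈-sym σ-one-one)) (≈-sym (σ-natural ε (id 1)))) ⟩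
    Δ ⨾ ((ε ⊕ id 1) ⨾ σ 0 1) ≈⟨ ⨾-congˡ (⨾-identityʳ _) ⟩
    Δ ⨾ (ε ⊕ id 1)          ≈⟨ counitˡ ⟩
    id 1 ∎

  unitˡ : (η ⊕ id 1) ⨾ μ ≈ id 1
  unitˡ = ≈-trans (⨾-congʳ (⊕-congˡ (≈-sym id₁≈id))) (≈-trans (axiom A1) id₁≈id)

  unitʳ : (id 1 ⊕ η) ⨾ μ ≈ id 1
  unitʳ = begin
    (id 1 ⊕ η) ⨾ μ           ≈⟨ ⨾-congˡ (axiom A2) ⟨
    (id 1 ⊕ η) ⨾ (σ₁₁ ⨾ μ)   ≈⟨ ⨾-assoc _ _ _ ⟨
    (id 1 ⊕ η) ⨾ σ₁₁ ⨾ μ     ≈⟨ ⨾-congʳ (≈-trans (⨾-congˡ (≈-sym σ-one-one)) (σ-natural (id 1) η)) ⟩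
    σ 1 0 ⨾ (η ⊕ id 1) ⨾ μ   ≈⟨ pullʳ unitˡ ⟩
    σ 1 0 ⨾ id 1             ≈⟨ ⨾-congʳ (≈-trans (σ-one 0) id₁≈id) ⟩
    id 1 ⨾ id 1              ≈⟨ ⨾-identityˡ _ ⟩
    id 1 ∎

  coassoc : Δ ⨾ (Δ ⊕ id 1) ≈ Δ ⨾ (id 1 ⊕ Δ)
  coassoc = ≈-trans (⨾-congˡ (⊕-congˡ (≈-sym id₁≈id)))
           (≈-trans (axiom A6) (⨾-congˡ (⊕-congʳ id₁≈id)))

  μ-assoc : (μ ⊕ id 1) ⨾ μ ≈ (id 1 ⊕ μ) ⨾ μ
  μ-assoc = ≈-trans (⨾-congʳ (⊕-congˡ (≈-sym id₁≈id)))
           (≈-trans (axiom A3) (⨾-congʳ (⊕-congʳ id₁≈id)))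

  middle : T 4 4
  middle = id 1 ⊕ (σ₁₁ ⊕ id 1)

  bialgebra : μ ⨾ Δ ≈ (Δ ⊕ Δ) ⨾ middle ⨾ (μ ⊕ μ)
  bialgebra = ≈-trans (axiom A8) (⨾-congʳ (⨾-congˡ (⊕-cong id₁≈id (⊕-congˡ id₁≈id))))

  discard : ∀ n → T n 0
  discard zero    = id₀
  discard (suc n) = ε ⊕ discard n

  discard-+ : ∀ m n → discard (m + n) ≈ discard m ⊕ discard n
  discard-+ zero    n = ≈-sym (⊕-identityˡ _)
  discard-+ (suc m) n =
    ≈-trans (⊕-congˡ (discard-+ m n)) (≈-sym (⊕-assoc ε (discard m) (discard n)))

  discard-1 : discard 1 ≈ ε
  discard-1 = ⊕-identityʳ ε

  discard-2 : discard 2 ≈ ε ⊕ ε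
  discard-2 = ⊕-congˡ (⊕-identityʳ ε)

  Δ-discard : Δ ⨾ (ε ⊕ ε) ≈ ε
  Δ-discard = begin
    Δ ⨾ (ε ⊕ ε)                     ≈⟨ ⨾-congˡ (⊕-splitˡ ε ε) ⟨
    Δ ⨾ ((ε ⊕ id 1) ⨾ (id 0 ⊕ ε))   ≈⟨ ⨾-assoc _ _ _ ⟨
    Δ ⨾ (ε ⊕ id 1) ⨾ (id 0 ⊕ ε)     ≈⟨ ⨾-cong counitˡ (⊕-identityˡ ε) ⟩
    id 1 ⨾ ε                        ≈⟨ ⨾-identityˡ ε ⟩
    ε ∎

  -- Together with `copy-natural` this says that every arrow is a homomorphism of comonoids, which
  -- is what cartesianness amounts to. The generators are covered by the bialgebra laws `A7` to
  -- `A10`, the scalar laws `A15` and `A16`, and the comonoid laws themselves.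
  discard-natural : (t : T m n) → t ⨾ discard n ≈ discard m
  discard-natural (gen Δ•) = ≈-trans (⨾-congˡ discard-2) (≈-trans Δ-discard (≈-sym discard-1))
  discard-natural (gen ε•) = ≈-trans (⨾-identityʳ ε) (≈-sym discard-1)
  discard-natural (gen μ∘) = ≈-trans (⨾-congˡ discard-1) (≈-trans (axiom A7) (≈-sym discard-2))
  discard-natural (gen η∘) = ≈-trans (⨾-congˡ discard-1) (axiom A10)
  discard-natural (gen (s k)) = ≈-trans (⨾-congˡ discard-1) (≈-trans (axiom (A16 k)) (≈-sym discard-1))
  discard-natural id₀ = ⨾-identityˡ _
  discard-natural id₁ = id₁-identityˡ _
  discard-natural σ₁₁ = begin
    σ₁₁ ⨾ discard 2    ≈⟨ ⨾-cong (≈-sym σ-one-one) discard-2 ⟩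
    σ 1 1 ⨾ (ε ⊕ ε)    ≈⟨ σ-natural ε ε ⟨
    (ε ⊕ ε) ⨾ id 0     ≈⟨ ⨾-identityʳ _ ⟩
    ε ⊕ ε              ≈⟨ discard-2 ⟨
    discard 2 ∎
  discard-natural (t ⨾ u) = ≈-trans (pullʳ (discard-natural u)) (discard-natural t)
  discard-natural (_⊕_ {m} {n} {m′} {n′} t u) = begin
    (t ⊕ u) ⨾ discard (n + n′)           ≈⟨ ⨾-congˡ (discard-+ n n′) ⟩
    (t ⊕ u) ⨾ (discard n ⊕ discard n′)   ≈⟨ ⊕-⨾ _ _ _ _ ⟨
    (t ⨾ discard n) ⊕ (u ⨾ discard n′)   ≈⟨ ⊕-cong (discard-natural t) (discard-natural u) ⟩
    discard m ⊕ discard m′               ≈⟨ discard-+ m m′ ⟨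
    discard (m + m′) ∎

  copy : ∀ n → T n (n + n)
  copy zero    = id₀
  copy (suc n) = (Δ ⊕ copy n) ⨾ mid 1 n

  copy-+ : ∀ m n → copy (m + n) ≈ (copy m ⊕ copy n) ⨾ mid m n
  copy-+ zero n = begin
    copy n                        ≈⟨ ≈-trans (⨾-identityʳ _) (⊕-identityˡ _) ⟨
    (id₀ ⊕ copy n) ⨾ id (n + n)   ≋⟨ ≋-⨾ (≋-refl {t = id₀ ⊕ copy n}) (≋-sym mid-zero) ⟩
    (id₀ ⊕ copy n) ⨾ mid 0 n ∎
    where
    mid-zero : mid 0 n ≋ id (n + n)
    mid-zero =
      mid 0 n                 ≋⟨ mid≋ 0 n ⟩
      id 0 ⊕ (σ 0 n ⊕ id n)   ≈⟨ ⊕-identityˡ _ ⟩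
      σ 0 n ⊕ id n            ≋⟨ ≋-⊕ (σ-zeroˡ n) ≋-refl ⟩
      id n ⊕ id n             ≈⟨ ⊕-id n n ⟩
      id (n + n) ∎
  copy-+ (suc m) n = begin
    (Δ ⊕ copy (m + n)) ⨾ mid 1 (m + n)
      ≈⟨ ⨾-congʳ (⊕-congˡ (copy-+ m n)) ⟩
    (Δ ⊕ ((copy m ⊕ copy n) ⨾ mid m n)) ⨾ mid 1 (m + n)
      ≈⟨ ⨾-congʳ (≈-trans (⊕-congʳ (≈-sym (⨾-identityʳ Δ))) (⊕-⨾ _ _ _ _)) ⟩
    (Δ ⊕ (copy m ⊕ copy n)) ⨾ (id 2 ⊕ mid m n) ⨾ mid 1 (m + n)
      ≈⟨ ⨾-assoc _ _ _ ⟩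
    (Δ ⊕ (copy m ⊕ copy n)) ⨾ ((id 2 ⊕ mid m n) ⨾ mid 1 (m + n))
      ≋⟨ ≋-⨾ (≋-sym (⊕-assoc≋ _ _ _)) (mid-suc m n) ⟩
    ((Δ ⊕ copy m) ⊕ copy n) ⨾ ((mid 1 m ⊕ id (n + n)) ⨾ mid (suc m) n)
      ≈⟨ ⨾-assoc _ _ _ ⟨
    ((Δ ⊕ copy m) ⊕ copy n) ⨾ (mid 1 m ⊕ id (n + n)) ⨾ mid (suc m) n
      ≈⟨ ⨾-congʳ (≈-trans (≈-sym (⊕-⨾ _ _ _ _)) (⊕-congˡ (⨾-identityʳ _))) ⟩
    (copy (suc m) ⊕ copy n) ⨾ mid (suc m) n ∎

  copy-1 : copy 1 ≈ Δ
  copy-1 = begin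
    (Δ ⊕ id₀) ⨾ mid 1 0   ≋⟨ ≋-⨾ (⊕-identityʳ≋ Δ) (mid≋ 1 0) ⟩
    Δ ⨾ (id 1 ⊕ (σ 1 0 ⊕ id 0))
      ≈⟨ ⨾-congˡ (≈-trans (⊕-congˡ (≈-trans (⊕-identityʳ (σ 1 0)) (≈-trans (σ-one 0) id₁≈id))) (⊕-id 1 1)) ⟩
    Δ ⨾ id 2              ≈⟨ ⨾-identityʳ Δ ⟩
    Δ ∎

  copy-2 : copy 2 ≈ (Δ ⊕ Δ) ⨾ middle
  copy-2 = begin
    copy 2                          ≈⟨ copy-+ 1 1 ⟩
    (copy 1 ⊕ copy 1) ⨾ mid 1 1     ≈⟨ ⨾-cong (⊕-cong copy-1 copy-1) (≋⇒≈ (mid≋ 1 1)) ⟩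
    (Δ ⊕ Δ) ⨾ (id 1 ⊕ (σ 1 1 ⊕ id 1)) ≈⟨ ⨾-congˡ (⊕-congˡ (⊕-congʳ σ-one-one)) ⟩
    (Δ ⊕ Δ) ⨾ middle ∎

  -- By coassociativity the two inner wires of the four can be made the outputs of one `Δ`
  -- (`fourfold`); cocommutativity then absorbs the crossing.
  copy-Δ : Δ ⨾ ((Δ ⊕ Δ) ⨾ middle) ≈ Δ ⨾ (Δ ⊕ Δ)
  copy-Δ = begin
    Δ ⨾ ((Δ ⊕ Δ) ⨾ middle)                            ≈⟨ ⨾-assoc _ _ _ ⟨
    Δ ⨾ (Δ ⊕ Δ) ⨾ middle                              ≈⟨ ⨾-congʳ fourfold ⟩
    Δ ⨾ (id 1 ⊕ (Δ ⨾ (Δ ⊕ id 1))) ⨾ middle            ≈⟨ pullʳ (whiskerˡ-⨾ _ _) ⟩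
    Δ ⨾ (id 1 ⊕ (Δ ⨾ (Δ ⊕ id 1) ⨾ (σ₁₁ ⊕ id 1)))
      ≈⟨ ⨾-congˡ (⊕-congˡ (pullʳ (≈-trans (whiskerʳ-⨾ Δ σ₁₁) (⊕-congʳ (axiom A5))))) ⟩
    Δ ⨾ (id 1 ⊕ (Δ ⨾ (Δ ⊕ id 1)))                     ≈⟨ fourfold ⟨
    Δ ⨾ (Δ ⊕ Δ) ∎
    where
    fourfold : Δ ⨾ (Δ ⊕ Δ) ≈ Δ ⨾ (id 1 ⊕ (Δ ⨾ (Δ ⊕ id 1)))
    fourfold = begin
      Δ ⨾ (Δ ⊕ Δ)                                 ≈⟨ ⨾-congˡ (⊕-splitˡ Δ Δ) ⟨
      Δ ⨾ ((Δ ⊕ id 1) ⨾ (id 2 ⊕ Δ))               ≈⟨ ⨾-assoc _ _ _ ⟨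
      Δ ⨾ (Δ ⊕ id 1) ⨾ (id 2 ⊕ Δ)                 ≈⟨ ⨾-cong coassoc (≋⇒≈ (≋-sym (id-⊕≋ {m = 1} {1} Δ))) ⟩
      Δ ⨾ (id 1 ⊕ Δ) ⨾ (id 1 ⊕ (id 1 ⊕ Δ))        ≈⟨ pullʳ (whiskerˡ-⨾ _ _) ⟩
      Δ ⨾ (id 1 ⊕ (Δ ⨾ (id 1 ⊕ Δ)))               ≈⟨ ⨾-congˡ (⊕-congˡ coassoc) ⟨
      Δ ⨾ (id 1 ⊕ (Δ ⨾ (Δ ⊕ id 1))) ∎

  -- Naturality turns the single crossing into `σ 2 2`, which decomposes as
  -- `middle ⨾ flank ⨾ middle`; one `middle` cancels, being an involution.
  copy-σ : σ₁₁ ⨾ ((Δ ⊕ Δ) ⨾ middle) ≈ (Δ ⊕ Δ) ⨾ middle ⨾ (σ₁₁ ⊕ σ₁₁)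
  copy-σ = begin
    σ₁₁ ⨾ ((Δ ⊕ Δ) ⨾ middle)             ≈⟨ ⨾-assoc _ _ _ ⟨
    σ₁₁ ⨾ (Δ ⊕ Δ) ⨾ middle               ≈⟨ ⨾-congʳ (⨾-congʳ σ-one-one) ⟨
    σ 1 1 ⨾ (Δ ⊕ Δ) ⨾ middle             ≈⟨ ⨾-congʳ (σ-natural Δ Δ) ⟨
    (Δ ⊕ Δ) ⨾ σ 2 2 ⨾ middle             ≈⟨ swapʳ σ-middle ⟩
    (Δ ⊕ Δ) ⨾ middle ⨾ (σ₁₁ ⊕ σ₁₁) ∎
    where
    σ-1-2 : σ 1 2 ≈ (σ₁₁ ⊕ id 1) ⨾ (id 1 ⊕ σ₁₁)
    σ-1-2 = ≈-trans (σ-one 2) (⨾-congˡ (⊕-cong id₁≈id σ₁-one))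
    flank : T 4 4
    flank = σ₁₁ ⊕ σ₁₁
    σ-2-2 : σ 2 2 ≈ middle ⨾ flank ⨾ middle
    σ-2-2 = begin
      σ 2 2
        ≈⟨ σ-suc 1 2 ⟩
      (id 1 ⊕ σ 1 2) ⨾ (σ 1 2 ⊕ id 1)
        ≈⟨ ⨾-cong (≈-trans (⊕-congˡ σ-1-2) (≈-sym (whiskerˡ-⨾ _ _)))
                  (≈-trans (⊕-congʳ σ-1-2) (≈-sym (whiskerʳ-⨾ _ _))) ⟩
      middle ⨾ (id 1 ⊕ (id 1 ⊕ σ₁₁)) ⨾ (((σ₁₁ ⊕ id 1) ⊕ id 1) ⨾ ((id 1 ⊕ σ₁₁) ⊕ id 1))
        ≋⟨ ≋-⨾ (≋-⨾ ≋-refl (id-⊕≋ {m = 1} {1} σ₁₁)) (≋-⨾ (⊕-id≋ {m = 1} {1} σ₁₁) (⊕-assoc≋ (id 1) σ₁₁ (id 1))) ⟩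
      middle ⨾ (id 2 ⊕ σ₁₁) ⨾ ((σ₁₁ ⊕ id 2) ⨾ middle)
        ≈⟨ ⨾-assoc _ _ _ ⟨
      middle ⨾ (id 2 ⊕ σ₁₁) ⨾ (σ₁₁ ⊕ id 2) ⨾ middle
        ≈⟨ ⨾-congʳ (pullʳ (⊕-splitʳ σ₁₁ σ₁₁)) ⟩
      middle ⨾ flank ⨾ middle ∎
    middle-involutive : middle ⨾ middle ≈ id 4
    middle-involutive = begin
      middle ⨾ middle                       ≈⟨ whiskerˡ-⨾ _ _ ⟩
      id 1 ⊕ ((σ₁₁ ⊕ id 1) ⨾ (σ₁₁ ⊕ id 1))  ≈⟨ ⊕-congˡ (whiskerʳ-⨾ _ _) ⟩
      id 1 ⊕ ((σ₁₁ ⨾ σ₁₁) ⊕ id 1)           ≈⟨ ⊕-congˡ (⊕-congʳ σ₁₁-involutive) ⟩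
      id 1 ⊕ (id 2 ⊕ id 1)                  ≈⟨ ≈-trans (⊕-congˡ (⊕-id 2 1)) (⊕-id 1 3) ⟩
      id 4 ∎
    σ-middle : σ 2 2 ⨾ middle ≈ middle ⨾ (σ₁₁ ⊕ σ₁₁)
    σ-middle = ≈-trans (⨾-congʳ σ-2-2) (cancelʳ middle-involutive)

  copy-natural : (t : T m n) → t ⨾ copy n ≈ copy m ⨾ (t ⊕ t)
  copy-natural (gen Δ•) =
    ≈-trans (⨾-congˡ copy-2) (≈-trans copy-Δ (⨾-congʳ (≈-sym copy-1)))
  copy-natural (gen ε•) =
    ≈-trans (⨾-identityʳ ε) (≈-trans (≈-sym Δ-discard) (⨾-congʳ (≈-sym copy-1)))
  copy-natural (gen μ∘) =
    ≈-trans (⨾-congˡ copy-1) (≈-trans bialgebra (⨾-congʳ (≈-sym copy-2)))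
  copy-natural (gen η∘) =
    ≈-trans (⨾-congˡ copy-1) (≈-trans (axiom A9) (≈-sym (⨾-identityˡ _)))
  copy-natural (gen (s k)) =
    ≈-trans (⨾-congˡ copy-1) (≈-trans (axiom (A15 k)) (⨾-congʳ (≈-sym copy-1)))
  copy-natural id₀ = ⨾-congˡ (≈-sym (⊕-identityˡ id₀))
  copy-natural id₁ =
    ≈-trans (⨾-congʳ id₁≈id)
   (≈-trans (⨾-identityˡ _)
   (≈-trans (≈-sym (⨾-identityʳ _)) (⨾-congˡ (⊕-congˡ (≈-sym id₁≈id)))))
  copy-natural σ₁₁ =
    ≈-trans (⨾-congˡ copy-2) (≈-trans copy-σ (⨾-congʳ (≈-sym copy-2)))
  copy-natural (_⨾_ {m} {n} {k} t u) = begin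
    t ⨾ u ⨾ copy k                   ≈⟨ pullʳ (copy-natural u) ⟩
    t ⨾ (copy n ⨾ (u ⊕ u))           ≈⟨ ⨾-assoc _ _ _ ⟨
    t ⨾ copy n ⨾ (u ⊕ u)             ≈⟨ ⨾-congʳ (copy-natural t) ⟩
    copy m ⨾ (t ⊕ t) ⨾ (u ⊕ u)       ≈⟨ pullʳ (≈-sym (⊕-⨾ _ _ _ _)) ⟩
    copy m ⨾ ((t ⨾ u) ⊕ (t ⨾ u)) ∎
  copy-natural (_⊕_ {m} {n} {m′} {n′} t u) = begin
    (t ⊕ u) ⨾ copy (n + n′)
      ≈⟨ ⨾-congˡ (copy-+ n n′) ⟩
    (t ⊕ u) ⨾ ((copy n ⊕ copy n′) ⨾ mid n n′)
      ≈⟨ ⨾-assoc _ _ _ ⟨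
    (t ⊕ u) ⨾ (copy n ⊕ copy n′) ⨾ mid n n′
      ≈⟨ ⨾-congʳ (≈-trans (≈-sym (⊕-⨾ _ _ _ _))
           (≈-trans (⊕-cong (copy-natural t) (copy-natural u)) (⊕-⨾ _ _ _ _))) ⟩
    (copy m ⊕ copy m′) ⨾ ((t ⊕ t) ⊕ (u ⊕ u)) ⨾ mid n n′
      ≈⟨ swapʳ (mid-natural t t u u) ⟩
    (copy m ⊕ copy m′) ⨾ mid m m′ ⨾ ((t ⊕ u) ⊕ (t ⊕ u))
      ≈⟨ ⨾-congʳ (copy-+ m m′) ⟨
    copy (m + m′) ⨾ ((t ⊕ u) ⊕ (t ⊕ u)) ∎

  -- The crossing inside `mid` exchanges the outputs of `h` with those of `g`. As `h` has none, the
  -- crossing is an identity and the two blocks separate.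
  copy-discard : (f : T m p) (g : T m q) (h : T n 0) (i : T n r) →
                 copy (m + n) ⨾ ((f ⊕ h) ⊕ (g ⊕ i)) ≋ (copy m ⨾ (f ⊕ g)) ⊕ (copy n ⨾ (h ⊕ i))
  copy-discard {m = m} {p} {q} {n = n} {r} f g h i =
    copy (m + n) ⨾ ((f ⊕ h) ⊕ (g ⊕ i))
      ≈⟨ ⨾-congʳ (copy-+ m n) ⟩
    (copy m ⊕ copy n) ⨾ mid m n ⨾ ((f ⊕ h) ⊕ (g ⊕ i))
      ≈⟨ ⨾-assoc _ _ _ ⟩
    (copy m ⊕ copy n) ⨾ (mid m n ⨾ ((f ⊕ h) ⊕ (g ⊕ i)))
      ≋⟨ ≋-⨾ ≋-refl mid-discard ⟩
    (copy m ⊕ copy n) ⨾ ((f ⊕ g) ⊕ (h ⊕ i))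
      ≈⟨ ⊕-⨾ _ _ _ _ ⟨
    (copy m ⨾ (f ⊕ g)) ⊕ (copy n ⨾ (h ⊕ i)) ∎
    where
    σ-discard : σ m n ⨾ (h ⊕ g) ≋ g ⊕ h
    σ-discard =
      σ m n ⨾ (h ⊕ g)     ≈⟨ σ-natural g h ⟨
      (g ⊕ h) ⨾ σ q 0     ≋⟨ ≋-⨾ ≋-refl (≋-trans (σ-zeroʳ q) (id≡ (sym (+-identityʳ q)))) ⟩
      (g ⊕ h) ⨾ id (q + 0) ≈⟨ ⨾-identityʳ _ ⟩
      g ⊕ h ∎
    mid-discard : mid m n ⨾ ((f ⊕ h) ⊕ (g ⊕ i)) ≋ (f ⊕ g) ⊕ (h ⊕ i)
    mid-discard =
      mid m n ⨾ ((f ⊕ h) ⊕ (g ⊕ i))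
        ≋⟨ ≋-⨾ (mid≋ m n) (⊕-regroup f h g i) ⟩
      (id m ⊕ (σ m n ⊕ id n)) ⨾ (f ⊕ ((h ⊕ g) ⊕ i))
        ≈⟨ ⊕-⨾ _ _ _ _ ⟨
      (id m ⨾ f) ⊕ ((σ m n ⊕ id n) ⨾ ((h ⊕ g) ⊕ i))
        ≈⟨ ⊕-cong (⨾-identityˡ f) (≈-sym (⊕-⨾ _ _ _ _)) ⟩
      f ⊕ ((σ m n ⨾ (h ⊕ g)) ⊕ (id n ⨾ i))
        ≋⟨ ≋-⊕ ≋-refl (≋-⊕ σ-discard (≈⇒≋ (⨾-identityˡ i))) ⟩
      f ⊕ ((g ⊕ h) ⊕ i)
        ≋⟨ ≋-sym (⊕-regroup f g h i) ⟩
      (f ⊕ g) ⊕ (h ⊕ i) ∎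

  copy-counitˡ : ∀ n → copy n ⨾ (discard n ⊕ id n) ≈ id n
  copy-counitˡ zero    = ≈-trans (⨾-congˡ (⊕-identityˡ id₀)) (⨾-identityˡ id₀)
  copy-counitˡ (suc n) = begin
    copy (suc n) ⨾ ((ε ⊕ discard n) ⊕ (id₁ ⊕ id n))
      ≋⟨ copy-discard ε id₁ (discard n) (id n) ⟩
    (copy 1 ⨾ (ε ⊕ id₁)) ⊕ (copy n ⨾ (discard n ⊕ id n))
      ≈⟨ ⊕-cong (≈-trans (⨾-congʳ copy-1) (axiom A4)) (copy-counitˡ n) ⟩
    id₁ ⊕ id n ∎

  copy-projections : ∀ n → copy (suc n) ⨾ ((id 1 ⊕ discard n) ⊕ (ε ⊕ id n)) ≈ id (suc n)
  copy-projections n = begin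
    copy (suc n) ⨾ ((id 1 ⊕ discard n) ⊕ (ε ⊕ id n))
      ≋⟨ copy-discard (id 1) ε (discard n) (id n) ⟩
    (copy 1 ⨾ (id 1 ⊕ ε)) ⊕ (copy n ⨾ (discard n ⊕ id n))
      ≈⟨ ⊕-cong (≈-trans (⨾-congʳ copy-1) counitʳ) (copy-counitˡ n) ⟩
    id 1 ⊕ id n
      ≈⟨ ⊕-id 1 n ⟩
    id (suc n) ∎

  -- An arrow into a product is the pair of its projections; this is what splits a matrix into its
  -- first row and the remaining ones.
  pairing : (t : T m (suc n)) → t ≈ copy m ⨾ ((t ⨾ (id 1 ⊕ discard n)) ⊕ (t ⨾ (ε ⊕ id n)))
  pairing {m} {n} t = begin
    t                                                        ≈⟨ ⨾-identityʳ t ⟨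
    t ⨾ id (suc n)                                           ≈⟨ ⨾-congˡ (copy-projections n) ⟨
    t ⨾ (copy (suc n) ⨾ ((id 1 ⊕ discard n) ⊕ (ε ⊕ id n)))   ≈⟨ ⨾-assoc _ _ _ ⟨
    t ⨾ copy (suc n) ⨾ ((id 1 ⊕ discard n) ⊕ (ε ⊕ id n))     ≈⟨ ⨾-congʳ (copy-natural t) ⟩
    copy m ⨾ (t ⊕ t) ⨾ ((id 1 ⊕ discard n) ⊕ (ε ⊕ id n))     ≈⟨ pullʳ (≈-sym (⊕-⨾ _ _ _ _)) ⟩
    copy m ⨾ ((t ⨾ (id 1 ⊕ discard n)) ⊕ (t ⨾ (ε ⊕ id n))) ∎

-- Linear forms, and matrix identities reduced to the ring.

module Matrices {c ℓ : Level} (R : CommutativeRing c ℓ) where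

  open Defs using (_⨾_)

  private
    module R = CommutativeRing R
    variable
      k l m n : ℕ
    T : ℕ → ℕ → Set c
    T = Term (HAGen R)

  open R using (Carrier; 0#; 1#)
  open HATerms R
  open StrictMonoidal (HAEq R)
  open Cartesian R

  row : Vec Carrier n → T n 1
  row []       = η
  row (k ∷ ks) = (S k ⊕ row ks) ⨾ μ

  row-cong : {ks ls : Vec Carrier n} → Pointwise R._≈_ ks ls → row ks ≈ row ls
  row-cong []       = ≈-refl
  row-cong (p ∷ ps) = ⨾-congʳ (⊕-cong (axiom (s-cong p)) (row-cong ps))

  row-singleton : ∀ k → row (k ∷ []) ≈ S k
  row-singleton k = begin
    (S k ⊕ η) ⨾ μ                     ≈⟨ ⨾-congʳ (⊕-splitˡ (S k) η) ⟨
    (S k ⊕ id 0) ⨾ (id 1 ⊕ η) ⨾ μ     ≈⟨ pullʳ unitʳ ⟩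
    (S k ⊕ id 0) ⨾ id 1               ≈⟨ ⨾-identityʳ _ ⟩
    S k ⊕ id 0                        ≈⟨ ⊕-identityʳ (S k) ⟩
    S k ∎

  row-pair : ∀ k l → row (k ∷ l ∷ []) ≈ (S k ⊕ S l) ⨾ μ
  row-pair k l = ⨾-congʳ (⊕-congˡ (row-singleton (l)))

  row-++ : (ks : Vec Carrier m) (ls : Vec Carrier n) → row (ks ++ ls) ≈ (row ks ⊕ row ls) ⨾ μ
  row-++ [] ls = begin
    row ls                            ≈⟨ ⨾-identityʳ _ ⟨
    row ls ⨾ id 1                     ≈⟨ ⨾-cong (≈-sym (⊕-identityˡ _)) (≈-sym unitˡ) ⟩
    (id 0 ⊕ row ls) ⨾ ((η ⊕ id 1) ⨾ μ)  ≈⟨ ⨾-assoc _ _ _ ⟨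
    (id 0 ⊕ row ls) ⨾ (η ⊕ id 1) ⨾ μ  ≈⟨ ⨾-congʳ (⊕-splitʳ η (row ls)) ⟩
    (η ⊕ row ls) ⨾ μ ∎
  row-++ (k ∷ ks) ls = begin
    (S k ⊕ row (ks ++ ls)) ⨾ μ
      ≈⟨ ⨾-congʳ (⊕-congˡ (row-++ ks ls)) ⟩
    (S k ⊕ ((row ks ⊕ row ls) ⨾ μ)) ⨾ μ
      ≈⟨ ⨾-congʳ (≈-trans (⊕-congʳ (≈-sym (⨾-identityʳ (S k)))) (⊕-⨾ _ _ _ _)) ⟩
    (S k ⊕ (row ks ⊕ row ls)) ⨾ (id 1 ⊕ μ) ⨾ μ
      ≈⟨ swapʳ (≈-sym μ-assoc) ⟩
    (S k ⊕ (row ks ⊕ row ls)) ⨾ (μ ⊕ id 1) ⨾ μ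
      ≈⟨ ⨾-congʳ (⨾-congʳ (⊕-assoc (S k) (row ks) (row ls))) ⟨
    ((S k ⊕ row ks) ⊕ row ls) ⨾ (μ ⊕ id 1) ⨾ μ
      ≈⟨ ⨾-congʳ (≈-trans (≈-sym (⊕-⨾ _ _ _ _)) (⊕-congˡ (⨾-identityʳ _))) ⟩
    (row (k ∷ ks) ⊕ row ls) ⨾ μ ∎

  row-zeros : ∀ n → row (replicate n 0#) ≈ discard n ⨾ η
  row-zeros zero    = ≈-sym (⨾-identityˡ η)
  row-zeros (suc n) = begin
    (S 0# ⊕ row (replicate n 0#)) ⨾ μ
      ≈⟨ ⨾-congʳ (⊕-cong (axiom A17) (row-zeros n)) ⟩
    ((ε ⨾ η) ⊕ (discard n ⨾ η)) ⨾ μ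
      ≈⟨ ⨾-congʳ (⊕-⨾ _ _ _ _) ⟩
    discard (suc n) ⨾ (η ⊕ η) ⨾ μ
      ≈⟨ ⨾-congʳ (⨾-congˡ (≈-trans (≈-sym (⊕-splitʳ η η)) (⨾-congʳ (⊕-identityˡ η)))) ⟩
    discard (suc n) ⨾ (η ⨾ (η ⊕ id 1)) ⨾ μ
      ≈⟨ pullʳ (pullʳ unitˡ) ⟩
    discard (suc n) ⨾ (η ⨾ id 1)
      ≈⟨ ⨾-congˡ (⨾-identityʳ η) ⟩
    discard (suc n) ⨾ η ∎

  row-∷-zeros : ∀ g n → row (g ∷ replicate n 0#) ≈ S g ⊕ discard n
  row-∷-zeros g n = begin
    (S g ⊕ row (replicate n 0#)) ⨾ μ
      ≈⟨ ⨾-congʳ (⊕-cong (≈-sym (⨾-identityʳ (S g))) (row-zeros n)) ⟩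
    ((S g ⨾ id 1) ⊕ (discard n ⨾ η)) ⨾ μ
      ≈⟨ ⨾-congʳ (⊕-⨾ _ _ _ _) ⟩
    (S g ⊕ discard n) ⨾ (id 1 ⊕ η) ⨾ μ
      ≈⟨ pullʳ unitʳ ⟩
    (S g ⊕ discard n) ⨾ id 1
      ≈⟨ ⨾-identityʳ _ ⟩
    S g ⊕ discard n ∎

  row-1-zeros : ∀ n → row (1# ∷ replicate n 0#) ≈ id 1 ⊕ discard n
  row-1-zeros n = ≈-trans (row-∷-zeros 1# n) (⊕-congʳ (≈-trans (axiom A11) id₁≈id))

  -- The transposed matrix of `t`, acting on the coefficients of linear forms. It is defined by
  -- recursion on terms, so on a concrete diagram it computes to ring expressions.
  pull : T m n → Vec Carrier n → Vec Carrier m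
  pull (gen Δ•) (k ∷ l ∷ [])      = k R.+ l ∷ []
  pull (gen ε•) []                = 0# ∷ []
  pull (gen μ∘) (k ∷ [])          = k ∷ k ∷ []
  pull (gen η∘) (k ∷ [])          = []
  pull (gen (s j)) (k ∷ [])       = j R.* k ∷ []
  pull id₀ ks                     = ks
  pull id₁ ks                     = ks
  pull σ₁₁ (k ∷ l ∷ [])           = l ∷ k ∷ []
  pull (t ⨾ u) ks                 = pull t (pull u ks)
  pull (_⊕_ {n = n} t u) ks       = pull t (take n ks) ++ pull u (drop n ks)

  row-natural : (t : T m n) (ks : Vec Carrier n) → t ⨾ row ks ≈ row (pull t ks)
  row-natural (gen Δ•) (k ∷ l ∷ []) = begin
    Δ ⨾ row (k ∷ l ∷ [])     ≈⟨ ⨾-congˡ (row-pair k l) ⟩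
    Δ ⨾ ((S k ⊕ S l) ⨾ μ)    ≈⟨ ⨾-assoc _ _ _ ⟨
    Δ ⨾ (S k ⊕ S l) ⨾ μ      ≈⟨ axiom (A18 k l) ⟩
    S (k R.+ l)              ≈⟨ (row-singleton (k R.+ l)) ⟨
    row (k R.+ l ∷ []) ∎
  row-natural (gen ε•) [] = ≈-trans (≈-sym (axiom A17)) (≈-sym (row-singleton (0#)))
  row-natural (gen μ∘) (k ∷ []) =
    ≈-trans (⨾-congˡ (row-singleton (k))) (≈-trans (axiom (A13 k)) (≈-sym (row-pair k k)))
  row-natural (gen η∘) (k ∷ []) = ≈-trans (⨾-congˡ (row-singleton (k))) (axiom (A14 k))
  row-natural (gen (s j)) (k ∷ []) =
    ≈-trans (⨾-congˡ (row-singleton (k))) (≈-trans (axiom (A12 j k)) (≈-sym (row-singleton (j R.* k))))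
  row-natural id₀ ks = ⨾-identityˡ _
  row-natural id₁ ks = id₁-identityˡ _
  row-natural σ₁₁ (k ∷ l ∷ []) = begin
    σ₁₁ ⨾ row (k ∷ l ∷ [])     ≈⟨ ⨾-congˡ (row-pair k l) ⟩
    σ₁₁ ⨾ ((S k ⊕ S l) ⨾ μ)    ≈⟨ ⨾-assoc _ _ _ ⟨
    σ₁₁ ⨾ (S k ⊕ S l) ⨾ μ      ≈⟨ ⨾-congʳ (σ₁₁-natural (S l) (S k)) ⟨
    (S l ⊕ S k) ⨾ σ₁₁ ⨾ μ      ≈⟨ pullʳ (axiom A2) ⟩
    (S l ⊕ S k) ⨾ μ            ≈⟨ (row-pair l k) ⟨
    row (l ∷ k ∷ []) ∎
  row-natural (t ⨾ u) ks = ≈-trans (pullʳ (row-natural u ks)) (row-natural t (pull u ks))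
  row-natural (_⊕_ {n = n} t u) ks = begin
    (t ⊕ u) ⨾ row ks
      ≈⟨ ⨾-congˡ (≈-trans (≡⇒≈ (cong row (sym (take++drop≡id n ks)))) (row-++ (take n ks) (drop n ks))) ⟩
    (t ⊕ u) ⨾ ((row (take n ks) ⊕ row (drop n ks)) ⨾ μ)
      ≈⟨ ⨾-assoc _ _ _ ⟨
    (t ⊕ u) ⨾ (row (take n ks) ⊕ row (drop n ks)) ⨾ μ
      ≈⟨ ⨾-congʳ (≈-sym (⊕-⨾ _ _ _ _)) ⟩
    ((t ⨾ row (take n ks)) ⊕ (u ⨾ row (drop n ks))) ⨾ μ
      ≈⟨ ⨾-congʳ (⊕-cong (row-natural t (take n ks)) (row-natural u (drop n ks))) ⟩
    (row (pull t (take n ks)) ⊕ row (pull u (drop n ks))) ⨾ μ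
      ≈⟨ row-++ (pull t (take n ks)) (pull u (drop n ks)) ⟨
    row (pull t (take n ks) ++ pull u (drop n ks)) ∎

  -- Induction on the codomain: the form with coefficients `1# , 0# , …` is the first projection and
  -- so determines the first row, while forms pulled back along `ε ⊕ id n` test the remaining rows.
  -- Into 0 there is only one arrow, by `discard-natural`.
  faithful : (t u : T m n) → (∀ ks → t ⨾ row ks ≈ u ⨾ row ks) → t ≈ u
  faithful {n = zero} t u eq = begin
    t          ≈⟨ ⨾-identityʳ t ⟨
    t ⨾ id₀    ≈⟨ ≈-trans (discard-natural t) (≈-sym (discard-natural u)) ⟩
    u ⨾ id₀    ≈⟨ ⨾-identityʳ u ⟩
    u ∎
  faithful {m} {suc n} t u eq = begin
    t
      ≈⟨ pairing t ⟩
    copy m ⨾ ((t ⨾ (id 1 ⊕ discard n)) ⊕ (t ⨾ (ε ⊕ id n)))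
      ≈⟨ ⨾-congˡ (⊕-cong
           (≈-trans (⨾-congˡ (≈-sym (row-1-zeros n)))
             (≈-trans (eq (1# ∷ replicate n 0#)) (⨾-congˡ (row-1-zeros n))))
           (faithful _ _ λ ks → ≈-trans (restrict t ks)
             (≈-trans (eq (pull (ε ⊕ id n) ks)) (≈-sym (restrict u ks))))) ⟩
    copy m ⨾ ((u ⨾ (id 1 ⊕ discard n)) ⊕ (u ⨾ (ε ⊕ id n)))
      ≈⟨ pairing u ⟨
    u ∎
    where
    restrict : (t : T m (suc n)) (ks : Vec Carrier n) →
               t ⨾ (ε ⊕ id n) ⨾ row ks ≈ t ⨾ row (pull (ε ⊕ id n) ks)
    restrict t ks = pullʳ (row-natural (ε ⊕ id n) ks)

  faithful₂ : (t u : T m 2) →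
              (∀ k l → Pointwise R._≈_ (pull t (k ∷ l ∷ [])) (pull u (k ∷ l ∷ []))) → t ≈ u
  faithful₂ t u eq = faithful t u λ where
    (k ∷ l ∷ []) → ≈-trans (row-natural t _) (≈-trans (row-cong (eq k l)) (≈-sym (row-natural u _)))

  -- (p , q) ↦ (a p + b q , c p + d q)
  matrix : Carrier → Carrier → Carrier → Carrier → T 2 2
  matrix a b c d = (Δ ⊕ Δ) ⨾ middle ⨾ (((S a ⊕ S b) ⨾ μ) ⊕ ((S c ⊕ S d) ⨾ μ))

  module RingSolver = SemiringSolver R.commutativeSemiring
  open RingSolver using (solve; _:+_; _:*_; _:=_; con)

  matrix-cong : ∀ {a b c d a′ b′ c′ d′} → a R.≈ a′ → b R.≈ b′ → c R.≈ c′ → d R.≈ d′ →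
                matrix a b c d ≈ matrix a′ b′ c′ d′
  matrix-cong p q r w = ⨾-congˡ (⊕-cong
    (⨾-congʳ (⊕-cong (axiom (s-cong p)) (axiom (s-cong q))))
    (⨾-congʳ (⊕-cong (axiom (s-cong r)) (axiom (s-cong w)))))

  -- Composition is diagrammatic, so the matrix of the second arrow is the left factor of the
  -- product.
  matrix-⨾ : ∀ a b c d a′ b′ c′ d′ →
    matrix a b c d ⨾ matrix a′ b′ c′ d′
      ≈ matrix (a′ R.* a R.+ b′ R.* c) (a′ R.* b R.+ b′ R.* d)
               (c′ R.* a R.+ d′ R.* c) (c′ R.* b R.+ d′ R.* d)
  matrix-⨾ a b c d a′ b′ c′ d′ = faithful₂ _ _ λ k l →
    entry a c a′ b′ c′ d′ k l ∷ entry b d a′ b′ c′ d′ k l ∷ []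
    where
    entry : ∀ a c a′ b′ c′ d′ k l →
      a R.* (a′ R.* k R.+ c′ R.* l) R.+ c R.* (b′ R.* k R.+ d′ R.* l)
        R.≈ (a′ R.* a R.+ b′ R.* c) R.* k R.+ (c′ R.* a R.+ d′ R.* c) R.* l
    entry = solve 8 (λ a c a′ b′ c′ d′ k l →
      a :* (a′ :* k :+ c′ :* l) :+ c :* (b′ :* k :+ d′ :* l)
        := (a′ :* a :+ b′ :* c) :* k :+ (c′ :* a :+ d′ :* c) :* l) R.refl

  matrix-1 : matrix 1# 0# 0# 1# ≈ id 2
  matrix-1 = faithful₂ _ _ λ k l → entryˡ k l ∷ entryʳ k l ∷ []
    where
    entryˡ : ∀ k l → 1# R.* k R.+ 0# R.* l R.≈ k
    entryˡ = solve 2 (λ k l → con 1 :* k :+ con 0 :* l := k) R.refl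
    entryʳ : ∀ k l → 0# R.* k R.+ 1# R.* l R.≈ l
    entryʳ = solve 2 (λ k l → con 0 :* k :+ con 1 :* l := l) R.refl

-- Reversal of diagrams as a contravariant symmetry of IH.

IHEq : {c ℓ : Level} (R : CommutativeRing c ℓ) → Equations (IHGen R) (c ⊔ ℓ)
IHEq R = (HAEq R +ᴱ HAEq R ᵒᵖᴱ) ∪ᴱ IEq R

module Duality {c ℓ : Level} (R : CommutativeRing c ℓ) (isPID : IsPrincipalIdealDomain R) where

  open Defs using (_⨾_)

  private
    module R = CommutativeRing R
    variable
      k l m n m′ n′ : ℕ
    T : ℕ → ℕ → Set c
    T = Term (IHGen R)

  open R using (0#; 1#)
  open RingProperties R.ring using (-0#≈0#; -‿involutive; -1*x≈-x)
  open IsPrincipalIdealDomain isPID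
  open IHTerms R
  open StrictMonoidal (IHEq R)
  open PROPMorphism (φ₁ R) public using () renaming (⟦_⟧ to ι; ⟦⟧-cong to ι-cong; ⟦⟧-id to ι-id; ⟦⟧-σ to ι-σ)

  -1≉0 : ¬ (R.- 1# R.≈ 0#)
  -1≉0 p = 1≉0 (R.trans (R.sym (-‿involutive 1#)) (R.trans (R.-‿cong p) -0#≈0#))

  S₋₁-involutive : S (R.- 1#) ⨾ S (R.- 1#) ≈ id₁
  S₋₁-involutive = begin
    S (R.- 1#) ⨾ S (R.- 1#)     ≈⟨ axiom (inj₁ (inˡ (A12 _ _))) ⟩
    S (R.- 1# R.* R.- 1#)
      ≈⟨ axiom (inj₁ (inˡ (s-cong (R.trans (-1*x≈-x _) (-‿involutive 1#))))) ⟩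
    S 1#                        ≈⟨ axiom (inj₁ (inˡ A11)) ⟩
    id₁ ∎

  -- Both are inverse to `S (R.- 1#)`. Reversal turns the antipode of `I5` and `I6` into its
  -- opposite, so these two equations are exchanged only up to this identity.
  S̄₋₁≈S₋₁ : S̄ (R.- 1#) ≈ S (R.- 1#)
  S̄₋₁≈S₋₁ = begin
    S̄ (R.- 1#)                                 ≈⟨ id₁-identityʳ _ ⟨
    S̄ (R.- 1#) ⨾ id₁                           ≈⟨ ⨾-congˡ S₋₁-involutive ⟨
    S̄ (R.- 1#) ⨾ (S (R.- 1#) ⨾ S (R.- 1#))     ≈⟨ ⨾-assoc _ _ _ ⟨
    S̄ (R.- 1#) ⨾ S (R.- 1#) ⨾ S (R.- 1#)       ≈⟨ ⨾-congʳ (axiom (inj₂ (I2 _ -1≉0))) ⟩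
    id₁ ⨾ S (R.- 1#)                           ≈⟨ id₁-identityˡ _ ⟩
    S (R.- 1#) ∎

  dual : T m n → T n m
  dual (gen (inj₁ g)) = gen (inj₂ g)
  dual (gen (inj₂ g)) = gen (inj₁ g)
  dual id₀            = id₀
  dual id₁            = id₁
  dual σ₁₁            = σ₁₁
  dual (t ⨾ u)        = dual u ⨾ dual t
  dual (t ⊕ u)        = dual t ⊕ dual u

  dual-involutive : (t : T m n) → dual (dual t) ≡ t
  dual-involutive (gen (inj₁ g)) = refl
  dual-involutive (gen (inj₂ g)) = refl
  dual-involutive id₀            = refl
  dual-involutive id₁            = refl
  dual-involutive σ₁₁            = refl
  dual-involutive (t ⨾ u)        = cong₂ _⨾_ (dual-involutive t) (dual-involutive u)
  dual-involutive (t ⊕ u)        = cong₂ _⊕_ (dual-involutive t) (dual-involutive u)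

  dual-inj₁ : (t : Term (HAGen R) m n) → dual (mapTerm inj₁ t) ≡ mapTerm inj₂ (opTerm t)
  dual-inj₁ (gen g) = refl
  dual-inj₁ id₀     = refl
  dual-inj₁ id₁     = refl
  dual-inj₁ σ₁₁     = refl
  dual-inj₁ (t ⨾ u) = cong₂ _⨾_ (dual-inj₁ u) (dual-inj₁ t)
  dual-inj₁ (t ⊕ u) = cong₂ _⊕_ (dual-inj₁ t) (dual-inj₁ u)

  dual-inj₂ : (t : Term (HAGen R) m n) → dual (mapTerm inj₂ (opTerm t)) ≡ mapTerm inj₁ t
  dual-inj₂ t = trans (cong dual (sym (dual-inj₁ t))) (dual-involutive _)

  -- Not an instance of `dual-inj₁`: `ι` traverses the term twice, once for the injection and once
  -- for the quotient, and on an open term this is not definitionally `mapTerm inj₁`.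
  dual-ι : (t : Term (HAGen R) m n) → dual (ι t) ≡ PROPMorphism.⟦_⟧ (φ₂ R) (opTerm t)
  dual-ι (gen g) = refl
  dual-ι id₀     = refl
  dual-ι id₁     = refl
  dual-ι σ₁₁     = refl
  dual-ι (t ⨾ u) = cong₂ _⨾_ (dual-ι u) (dual-ι t)
  dual-ι (t ⊕ u) = cong₂ _⊕_ (dual-ι t) (dual-ι u)

  dual-subst₂ : (p : m ≡ m′) (q : n ≡ n′) (t : T m n) →
                dual (subst₂ T p q t) ≡ subst₂ T q p (dual t)
  dual-subst₂ refl refl t = refl

  dual-id : ∀ n → dual (id n) ≡ id n
  dual-id zero    = refl
  dual-id (suc n) = cong (id₁ ⊕_) (dual-id n)

  -- Serves the symmetry laws in `dual-cong`. The reversed hexagon is not literally an instance of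
  -- the hexagon law, but both of its sides are permutations whose reversal is their inverse, and
  -- inverses of equal arrows are equal.
  Unitary : T m n → Set (c ⊔ ℓ)
  Unitary {m} {n} t = t ⨾ dual t ≈ id m × dual t ⨾ t ≈ id n

  unitary-id₁ : Unitary id₁
  unitary-id₁ = p , p
    where
    p : id₁ ⨾ id₁ ≈ id 1
    p = ≈-trans (id₁-identityˡ id₁) id₁≈id

  unitary-id : ∀ n → Unitary (id n)
  unitary-id n = ≈-trans (⨾-identityˡ _) (≡⇒≈ (dual-id n))
               , ≈-trans (⨾-identityʳ _) (≡⇒≈ (dual-id n))

  unitary-⨾ : {t : T m n} {u : T n k} → Unitary t → Unitary u → Unitary (t ⨾ u)
  unitary-⨾ (p , q) (p′ , q′) =
      ≈-trans (≈-sym (⨾-assoc _ _ _)) (≈-trans (⨾-congʳ (cancelʳ p′)) p)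
    , ≈-trans (≈-sym (⨾-assoc _ _ _)) (≈-trans (⨾-congʳ (cancelʳ q)) q′)

  unitary-⊕ : {t : T m n} {u : T m′ n′} → Unitary t → Unitary u → Unitary (t ⊕ u)
  unitary-⊕ (p , q) (p′ , q′) =
      ≈-trans (≈-sym (⊕-⨾ _ _ _ _)) (≈-trans (⊕-cong p p′) (⊕-id _ _))
    , ≈-trans (≈-sym (⊕-⨾ _ _ _ _)) (≈-trans (⊕-cong q q′) (⊕-id _ _))

  unitary-subst₂ : (p : m ≡ m′) (q : n ≡ n′) {t : T m n} → Unitary t → Unitary (subst₂ T p q t)
  unitary-subst₂ refl refl w = w

  unitary-σ₁ : ∀ n → Unitary (σ₁ n)
  unitary-σ₁ zero    = unitary-id₁
  unitary-σ₁ (suc n) =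
    unitary-⨾ (unitary-⊕ (σ₁₁-involutive , σ₁₁-involutive) (unitary-id n))
              (unitary-⊕ unitary-id₁ (unitary-σ₁ n))

  unitary-σ : ∀ m n → Unitary (σ m n)
  unitary-σ zero    n = unitary-subst₂ refl (sym (+-identityʳ n)) (unitary-id n)
  unitary-σ (suc m) n =
    unitary-⨾ (unitary-⊕ unitary-id₁ (unitary-σ m n))
              (unitary-subst₂ refl (+-assoc n 1 m) (unitary-⊕ (unitary-σ₁ n) (unitary-id m)))

  unitary-dual-cong : {t u : T m n} → Unitary t → Unitary u → t ≈ u → dual t ≈ dual u
  unitary-dual-cong {t = t} {u} (_ , p) (q , _) r = begin
    dual t                ≈⟨ cancelʳ q ⟨
    dual t ⨾ u ⨾ dual u   ≈⟨ ⨾-congʳ (≈-trans (⨾-congˡ (≈-sym r)) p) ⟩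
    id _ ⨾ dual u         ≈⟨ ⨾-identityˡ _ ⟩
    dual u ∎

  dual-σ : ∀ m n → dual (σ m n) ≈ σ n m
  dual-σ m n = begin
    dual (σ m n)                       ≈⟨ cancelʳ (σ-involutive m n) ⟨
    dual (σ m n) ⨾ σ m n ⨾ σ n m       ≈⟨ ⨾-congʳ (proj₂ (unitary-σ m n)) ⟩
    id (n + m) ⨾ σ n m                 ≈⟨ ⨾-identityˡ _ ⟩
    σ n m ∎

  dual-axiom : {t u : T m n} → IHEq R t u → dual t ≈ dual u
  dual-axiom (inj₁ (inˡ {t = t} {u} x)) =
    ≈-trans (≡⇒≈ (dual-inj₁ t))
    (≈-trans (axiom (inj₁ (inʳ (op x)))) (≡⇒≈ (sym (dual-inj₁ u))))
  dual-axiom (inj₁ (inʳ (op {t = t} {u} x))) =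
    ≈-trans (≡⇒≈ (dual-inj₂ t))
    (≈-trans (axiom (inj₁ (inˡ x))) (≡⇒≈ (sym (dual-inj₂ u))))
  dual-axiom (inj₂ (I1 l l≉0)) = axiom (inj₂ (I1 l l≉0))
  dual-axiom (inj₂ (I2 l l≉0)) = axiom (inj₂ (I2 l l≉0))
  dual-axiom (inj₂ I3ˡ) = ≈-sym (axiom (inj₂ I3ʳ))
  dual-axiom (inj₂ I3ʳ) = ≈-sym (axiom (inj₂ I3ˡ))
  dual-axiom (inj₂ I4ˡ) = ≈-sym (axiom (inj₂ I4ʳ))
  dual-axiom (inj₂ I4ʳ) = ≈-sym (axiom (inj₂ I4ˡ))
  dual-axiom (inj₂ I5) =
    ≈-trans (axiom (inj₂ I6))
    (≈-trans (⨾-congʳ (⨾-congʳ (⊕-congˡ (≈-sym S̄₋₁≈S₋₁)))) (⨾-assoc _ _ _))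
  dual-axiom (inj₂ I6) =
    ≈-trans (axiom (inj₂ I5))
    (≈-trans (⨾-assoc _ _ _) (⨾-congˡ (⨾-congˡ (⊕-congˡ (≈-sym S̄₋₁≈S₋₁)))))
  dual-axiom (inj₂ I7) = axiom (inj₂ I7)
  dual-axiom (inj₂ I8) = axiom (inj₂ I8)

  dual-cong : {t u : T m n} → t ≈ u → dual t ≈ dual u
  dual-cong (axiom x)       = dual-axiom x
  dual-cong ≈-refl          = ≈-refl
  dual-cong (≈-sym p)       = ≈-sym (dual-cong p)
  dual-cong (≈-trans p q)   = ≈-trans (dual-cong p) (dual-cong q)
  dual-cong (⨾-cong p q)    = ⨾-cong (dual-cong q) (dual-cong p)
  dual-cong (⊕-cong p q)    = ⊕-cong (dual-cong p) (dual-cong q)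
  dual-cong (⨾-assoc t u v) = ≈-sym (⨾-assoc _ _ _)
  dual-cong (⨾-identityˡ {m = m} t) =
    ≈-trans (⨾-congˡ (≡⇒≈ (dual-id m))) (⨾-identityʳ _)
  dual-cong (⨾-identityʳ {n = n} t) =
    ≈-trans (⨾-congʳ (≡⇒≈ (dual-id n))) (⨾-identityˡ _)
  dual-cong (⊕-id m n) =
    ≈-trans (⊕-cong (≡⇒≈ (dual-id m)) (≡⇒≈ (dual-id n)))
    (≈-trans (⊕-id m n) (≡⇒≈ (sym (dual-id (m + n)))))
  dual-cong (⊕-⨾ t u t′ u′) = ⊕-⨾ _ _ _ _
  dual-cong (⊕-assoc t u v) =
    ≈-trans (≡⇒≈ (dual-subst₂ _ _ ((t ⊕ u) ⊕ v))) (⊕-assoc _ _ _)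
  dual-cong (⊕-identityˡ t) = ⊕-identityˡ _
  dual-cong (⊕-identityʳ t) =
    ≈-trans (≡⇒≈ (dual-subst₂ _ _ (t ⊕ id 0))) (⊕-identityʳ _)
  dual-cong (σ-natural {m = m} {m′} {n} {n′} t u) =
    ≈-trans (⨾-congʳ (dual-σ m′ n′))
    (≈-trans (≈-sym (σ-natural (dual u) (dual t))) (⨾-congˡ (≈-sym (dual-σ m n))))
  dual-cong (σ-involutive m n) =
    ≈-trans (⨾-cong (dual-σ n m) (dual-σ m n))
    (≈-trans (σ-involutive m n) (≡⇒≈ (sym (dual-id (m + n)))))
  dual-cong (σ-hexagon m n k) =
    unitary-dual-cong
      (unitary-⨾
        (unitary-subst₂ (+-assoc m n k) (+-assoc n m k) (unitary-⊕ (unitary-σ m n) (unitary-id k)))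
        (unitary-subst₂ refl (sym (+-assoc n k m)) (unitary-⊕ (unitary-id n) (unitary-σ m k))))
      (unitary-σ m (n + k))
      (σ-hexagon m n k)

-- Bending wires, and the derived laws between the two colours.

module Interaction {c ℓ : Level} (R : CommutativeRing c ℓ) (isPID : IsPrincipalIdealDomain R) where

  open Defs using (_⨾_)

  private
    module R = CommutativeRing R
    T : ℕ → ℕ → Set c
    T = Term (IHGen R)

  open R using (0#; 1#)
  open IHTerms R
  open StrictMonoidal (IHEq R)
  open Duality R isPID
  private module HA = Cartesian R

  cup : T 0 2
  cup = ηᵇ ⨾ Δᵇ

  cap : T 2 0
  cap = μᵇ ⨾ εᵇ

  frobeniusʷˡ : (Δʷ ⊕ id 1) ⨾ (id 1 ⊕ μʷ) ≈ μʷ ⨾ Δʷ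
  frobeniusʷˡ =
    ≈-trans (⨾-cong (⊕-congˡ (≈-sym id₁≈id)) (⊕-congʳ (≈-sym id₁≈id))) (axiom (inj₂ I3ˡ))

  frobeniusʷʳ : (id 1 ⊕ Δʷ) ⨾ (μʷ ⊕ id 1) ≈ μʷ ⨾ Δʷ
  frobeniusʷʳ = dual-cong frobeniusʷˡ

  frobeniusᵇˡ : (Δᵇ ⊕ id 1) ⨾ (id 1 ⊕ μᵇ) ≈ μᵇ ⨾ Δᵇ
  frobeniusᵇˡ =
    ≈-trans (⨾-cong (⊕-congˡ (≈-sym id₁≈id)) (⊕-congʳ (≈-sym id₁≈id))) (axiom (inj₂ I4ˡ))

  frobeniusᵇʳ : (id 1 ⊕ Δᵇ) ⨾ (μᵇ ⊕ id 1) ≈ μᵇ ⨾ Δᵇ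
  frobeniusᵇʳ = dual-cong frobeniusᵇˡ

  -- As relations: keep one copy of the first input and test the other for equality with the second.
  -- The derivation is the black Frobenius law followed by the counit law.
  μᵇ-via-cap : μᵇ ≈ (Δᵇ ⊕ id 1) ⨾ (id 1 ⊕ cap)
  μᵇ-via-cap = begin
    μᵇ                                            ≈⟨ cancelʳ (ι-cong HA.counitʳ) ⟨
    μᵇ ⨾ Δᵇ ⨾ (id 1 ⊕ εᵇ)                         ≈⟨ ⨾-congʳ frobeniusᵇˡ ⟨
    (Δᵇ ⊕ id 1) ⨾ (id 1 ⊕ μᵇ) ⨾ (id 1 ⊕ εᵇ)       ≈⟨ pullʳ (whiskerˡ-⨾ _ _) ⟩
    (Δᵇ ⊕ id 1) ⨾ (id 1 ⊕ cap) ∎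

  Δᵇ-via-cup : Δᵇ ≈ (id 1 ⊕ cup) ⨾ (μᵇ ⊕ id 1)
  Δᵇ-via-cup = dual-cong μᵇ-via-cap

  -- The white Frobenius law with a unit inserted; after `white-cup` the right side involves only HA
  -- and `cup`.
  Δʷ-via-cupʳ : Δʷ ≈ (id 1 ⊕ (ηʷ ⨾ Δʷ)) ⨾ (μʷ ⊕ id 1)
  Δʷ-via-cupʳ = begin
    Δʷ                                         ≈⟨ ≈-trans (⨾-congʳ (ι-cong HA.unitʳ)) (⨾-identityˡ Δʷ) ⟨
    (id 1 ⊕ ηʷ) ⨾ μʷ ⨾ Δʷ                      ≈⟨ swapʳ (≈-sym frobeniusʷʳ) ⟩
    (id 1 ⊕ ηʷ) ⨾ (id 1 ⊕ Δʷ) ⨾ (μʷ ⊕ id 1)    ≈⟨ ⨾-congʳ (whiskerˡ-⨾ _ _) ⟩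
    (id 1 ⊕ (ηʷ ⨾ Δʷ)) ⨾ (μʷ ⊕ id 1) ∎

  Δʷ-via-cupˡ : Δʷ ≈ ((ηʷ ⨾ Δʷ) ⊕ id 1) ⨾ (id 1 ⊕ μʷ)
  Δʷ-via-cupˡ = begin
    Δʷ                                         ≈⟨ ≈-trans (⨾-congʳ (ι-cong HA.unitˡ)) (⨾-identityˡ Δʷ) ⟨
    (ηʷ ⊕ id 1) ⨾ μʷ ⨾ Δʷ                      ≈⟨ swapʳ (≈-sym frobeniusʷˡ) ⟩
    (ηʷ ⊕ id 1) ⨾ (Δʷ ⊕ id 1) ⨾ (id 1 ⊕ μʷ)    ≈⟨ ⨾-congʳ (whiskerʳ-⨾ _ _) ⟩
    ((ηʷ ⨾ Δʷ) ⊕ id 1) ⨾ (id 1 ⊕ μʷ) ∎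

  S₋₁ : T 1 1
  S₋₁ = S (R.- 1#)

  S₋₁-S₋₁ : S₋₁ ⨾ S₋₁ ≈ id 1
  S₋₁-S₋₁ = ≈-trans S₋₁-involutive id₁≈id

  white-cup : ηʷ ⨾ Δʷ ≈ cup ⨾ (id 1 ⊕ S₋₁)
  white-cup = ≈-trans (axiom (inj₂ I5)) (⨾-congˡ (⊕-congʳ id₁≈id))

  cap-via-white : cap ≈ (id 1 ⊕ S₋₁) ⨾ (μʷ ⨾ εʷ)
  cap-via-white = begin
    cap                                             ≈⟨ ≈-trans (⨾-congʳ (≈-trans (whiskerˡ-⨾ _ _)
                                                         (≈-trans (⊕-congˡ S₋₁-S₋₁) (⊕-id 1 1)))) (⨾-identityˡ cap) ⟨
    (id 1 ⊕ S₋₁) ⨾ (id 1 ⊕ S₋₁) ⨾ cap               ≈⟨ pullʳ (≈-sym (⨾-assoc _ _ _)) ⟩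
    (id 1 ⊕ S₋₁) ⨾ ((id 1 ⊕ S₋₁) ⨾ μᵇ ⨾ εᵇ)         ≈⟨ ⨾-congˡ (⨾-congʳ (⨾-congʳ (⊕-congʳ id₁≈id))) ⟨
    (id 1 ⊕ S₋₁) ⨾ ((id₁ ⊕ S₋₁) ⨾ μᵇ ⨾ εᵇ)          ≈⟨ ⨾-congˡ (axiom (inj₂ I6)) ⟨
    (id 1 ⊕ S₋₁) ⨾ (μʷ ⨾ εʷ) ∎

  snake : (cup ⊕ id 1) ⨾ (id 1 ⊕ cap) ≈ id 1
  snake = begin
    (cup ⊕ id 1) ⨾ (id 1 ⊕ cap)                     ≈⟨ ⨾-congʳ (whiskerʳ-⨾ _ _) ⟨
    (ηᵇ ⊕ id 1) ⨾ (Δᵇ ⊕ id 1) ⨾ (id 1 ⊕ cap)        ≈⟨ pullʳ (≈-sym μᵇ-via-cap) ⟩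
    (ηᵇ ⊕ id 1) ⨾ μᵇ                                ≈⟨ dual-cong (ι-cong HA.counitˡ) ⟩
    id 1 ∎

  S̄-εʷ : ∀ k → S̄ k ⨾ εʷ ≈ εʷ
  S̄-εʷ k = dual-cong (ι-cong (axiom (A14 k)))

  ηᵇ-S̄ : ∀ k → ηᵇ ⨾ S̄ k ≈ ηᵇ
  ηᵇ-S̄ k = dual-cong (ι-cong (axiom (A16 k)))

  -- As relations, `k x` is zero only if `x` is. The opposite scalar can always be created in front
  -- of `εʷ`, and `I1` cancels it against `S k`.
  S-εʷ : ∀ {k} → ¬ (k R.≈ 0#) → S k ⨾ εʷ ≈ εʷ
  S-εʷ {k} k≉0 = begin
    S k ⨾ εʷ             ≈⟨ ⨾-congˡ (S̄-εʷ k) ⟨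
    S k ⨾ (S̄ k ⨾ εʷ)     ≈⟨ ⨾-assoc _ _ _ ⟨
    S k ⨾ S̄ k ⨾ εʷ       ≈⟨ ⨾-congʳ (axiom (inj₂ (I1 k k≉0))) ⟩
    id₁ ⨾ εʷ             ≈⟨ id₁-identityˡ εʷ ⟩
    εʷ ∎

  -- The zero test absorbs the sign by which the black and the white cup differ, so a white counit
  -- may be bent around the black cup as well.
  cup-εʷʳ : cup ⨾ (id 1 ⊕ εʷ) ≈ ηʷ
  cup-εʷʳ = begin
    cup ⨾ (id 1 ⊕ εʷ)                     ≈⟨ ⨾-congˡ (⊕-congˡ (S-εʷ -1≉0)) ⟨
    cup ⨾ (id 1 ⊕ (S₋₁ ⨾ εʷ))             ≈⟨ pushʳ (≈-sym (whiskerˡ-⨾ _ _)) ⟩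
    cup ⨾ (id 1 ⊕ S₋₁) ⨾ (id 1 ⊕ εʷ)      ≈⟨ ⨾-congʳ white-cup ⟨
    ηʷ ⨾ Δʷ ⨾ (id 1 ⊕ εʷ)                 ≈⟨ cancelʳ (dual-cong (ι-cong HA.unitʳ)) ⟩
    ηʷ ∎

  cup-εʷˡ : cup ⨾ (εʷ ⊕ id 1) ≈ ηʷ
  cup-εʷˡ = begin
    cup ⨾ (εʷ ⊕ id 1)            ≈⟨ ⨾-congʳ (pullʳ (ι-cong (axiom A5))) ⟨
    cup ⨾ σ₁₁ ⨾ (εʷ ⊕ id 1)      ≈⟨ pullʳ (≈-trans (⨾-congʳ (≈-sym σ-one-one)) (≈-sym (σ-natural (id 1) εʷ))) ⟩
    cup ⨾ ((id 1 ⊕ εʷ) ⨾ σ 1 0)  ≈⟨ ⨾-congˡ (≈-trans (⨾-congˡ (≈-trans (σ-one 0) id₁≈id)) (⨾-identityʳ _)) ⟩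
    cup ⨾ (id 1 ⊕ εʷ)            ≈⟨ cup-εʷʳ ⟩
    ηʷ ∎

  Δᵇ-εʷ-εʷ : Δᵇ ⨾ (εʷ ⊕ εʷ) ≈ εʷ
  Δᵇ-εʷ-εʷ = begin
    Δᵇ ⨾ (εʷ ⊕ εʷ)     ≈⟨ ⨾-congˡ (dual-cong (ι-cong (axiom A9))) ⟨
    Δᵇ ⨾ (μᵇ ⨾ εʷ)     ≈⟨ ⨾-assoc _ _ _ ⟨
    Δᵇ ⨾ μᵇ ⨾ εʷ       ≈⟨ ⨾-congʳ (axiom (inj₂ I8)) ⟩
    id₁ ⨾ εʷ           ≈⟨ id₁-identityˡ εʷ ⟩
    εʷ ∎

  -- Testing zero for being zero always succeeds. Bending `ηʷ` into a second zero test on a copy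
  -- merges the two tests into one on an unconstrained wire, where the reversed `A10` applies.
  ηʷ-εʷ : ηʷ ⨾ εʷ ≈ id₀
  ηʷ-εʷ = begin
    ηʷ ⨾ εʷ                              ≈⟨ ⨾-cong cup-εʷʳ (⊕-identityʳ εʷ) ⟨
    cup ⨾ (id 1 ⊕ εʷ) ⨾ (εʷ ⊕ id 0)      ≈⟨ pullʳ (⊕-splitʳ εʷ εʷ) ⟩
    cup ⨾ (εʷ ⊕ εʷ)                      ≈⟨ pullʳ Δᵇ-εʷ-εʷ ⟩
    ηᵇ ⨾ εʷ                              ≈⟨ dual-cong (ι-cong (axiom A10)) ⟩
    id₀ ∎

  -- If one copy is zero, so is the other, and the wire is cut. Writing `Δᵇ` through `cup` lets the
  -- reversed `A9` split the test into one on the input and one on the bent wire.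
  Δᵇ-εʷ : Δᵇ ⨾ (εʷ ⊕ id 1) ≈ εʷ ⨾ ηʷ
  Δᵇ-εʷ = begin
    Δᵇ ⨾ (εʷ ⊕ id 1)
      ≈⟨ ⨾-congʳ Δᵇ-via-cup ⟩
    (id 1 ⊕ cup) ⨾ (μᵇ ⊕ id 1) ⨾ (εʷ ⊕ id 1)
      ≈⟨ pullʳ (≈-trans (whiskerʳ-⨾ _ _) (⊕-congʳ (dual-cong (ι-cong (axiom A9))))) ⟩
    (id 1 ⊕ cup) ⨾ ((εʷ ⊕ εʷ) ⊕ id 1)
      ≈⟨ ⨾-congˡ (⊕-assoc εʷ εʷ (id 1)) ⟩
    (id 1 ⊕ cup) ⨾ (εʷ ⊕ (εʷ ⊕ id 1))
      ≈⟨ ≈-trans (≈-sym (⊕-⨾ _ _ _ _)) (⊕-cong (⨾-identityˡ εʷ) cup-εʷˡ) ⟩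
    εʷ ⊕ ηʷ
      ≈⟨ ⊕-splitˡ εʷ ηʷ ⟨
    (εʷ ⊕ id 0) ⨾ (id 0 ⊕ ηʷ)
      ≈⟨ ⨾-cong (⊕-identityʳ εʷ) (⊕-identityˡ ηʷ) ⟩
    εʷ ⨾ ηʷ ∎

  -- Inserting `S̄ k ⨾ S k` before the copy and distributing `S k` over it puts one factor against
  -- `S̄ k`, which cancels it, and leaves the other on the second wire.
  S̄-Δᵇ-S : ∀ {k} → ¬ (k R.≈ 0#) → S̄ k ⨾ Δᵇ ⨾ (id 1 ⊕ S k) ≈ Δᵇ ⨾ (S̄ k ⊕ id 1)
  S̄-Δᵇ-S {k} k≉0 = ≈-sym (begin
    Δᵇ ⨾ (S̄ k ⊕ id 1)
      ≈⟨ ⨾-congʳ (≈-trans (⨾-congʳ (axiom (inj₂ (I2 k k≉0)))) (id₁-identityˡ Δᵇ)) ⟨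
    S̄ k ⨾ S k ⨾ Δᵇ ⨾ (S̄ k ⊕ id 1)
      ≈⟨ ⨾-congʳ (≈-trans (pullʳ (ι-cong (axiom (A15 k)))) (≈-sym (⨾-assoc _ _ _))) ⟩
    S̄ k ⨾ Δᵇ ⨾ (S k ⊕ S k) ⨾ (S̄ k ⊕ id 1)
      ≈⟨ pullʳ (≈-sym (⊕-⨾ _ _ _ _)) ⟩
    S̄ k ⨾ Δᵇ ⨾ ((S k ⨾ S̄ k) ⊕ (S k ⨾ id 1))
      ≈⟨ ⨾-congˡ (⊕-cong (≈-trans (axiom (inj₂ (I1 k k≉0))) id₁≈id) (⨾-identityʳ _)) ⟩
    S̄ k ⨾ Δᵇ ⨾ (id 1 ⊕ S k) ∎)

  -- Sliding `S k` around `cup` turns it into its opposite, and `snake` straightens the wire. This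
  -- removes the opposite scalars from the generators that need separate treatment.
  S̄-bent : ∀ {k} → ¬ (k R.≈ 0#) →
           S̄ k ≈ (cup ⊕ id 1) ⨾ (id 1 ⊕ (S k ⊕ id 1)) ⨾ (id 1 ⊕ cap)
  S̄-bent {k} k≉0 = ≈-sym (begin
    (cup ⊕ id 1) ⨾ (id 1 ⊕ (S k ⊕ id 1)) ⨾ (id 1 ⊕ cap)
      ≈⟨ ⨾-congʳ (⨾-congˡ (⊕-assoc (id 1) (S k) (id 1))) ⟨
    (cup ⊕ id 1) ⨾ ((id 1 ⊕ S k) ⊕ id 1) ⨾ (id 1 ⊕ cap)
      ≈⟨ ⨾-congʳ (≈-trans (whiskerʳ-⨾ _ _) (≈-trans (⊕-congʳ cup-S) (≈-sym (whiskerʳ-⨾ _ _)))) ⟩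
    (cup ⊕ id 1) ⨾ ((S̄ k ⊕ id 1) ⊕ id 1) ⨾ (id 1 ⊕ cap)
      ≈⟨ ⨾-congʳ (⨾-congˡ (≋⇒≈ (⊕-id≋ {m = 1} {1} (S̄ k)))) ⟩
    (cup ⊕ id 1) ⨾ (S̄ k ⊕ id 2) ⨾ (id 1 ⊕ cap)
      ≈⟨ swapʳ (interchange (S̄ k) cap) ⟩
    (cup ⊕ id 1) ⨾ (id 1 ⊕ cap) ⨾ (S̄ k ⊕ id 0)
      ≈⟨ ⨾-cong snake (⊕-identityʳ (S̄ k)) ⟩
    id 1 ⨾ S̄ k
      ≈⟨ ⨾-identityˡ _ ⟩
    S̄ k ∎)
    where
    cup-S : cup ⨾ (id 1 ⊕ S k) ≈ cup ⨾ (S̄ k ⊕ id 1)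
    cup-S = begin
      ηᵇ ⨾ Δᵇ ⨾ (id 1 ⊕ S k)             ≈⟨ ⨾-congʳ (⨾-congʳ (ηᵇ-S̄ k)) ⟨
      ηᵇ ⨾ S̄ k ⨾ Δᵇ ⨾ (id 1 ⊕ S k)       ≈⟨ ≈-trans (⨾-congʳ (⨾-assoc _ _ _)) (pullʳ (S̄-Δᵇ-S k≉0)) ⟩
      ηᵇ ⨾ (Δᵇ ⨾ (S̄ k ⊕ id 1))           ≈⟨ ⨾-assoc _ _ _ ⟨
      cup ⨾ (S̄ k ⊕ id 1) ∎

  Δᵇ-S₋₁-μʷ : Δᵇ ⨾ (id 1 ⊕ S₋₁) ⨾ μʷ ≈ εᵇ ⨾ ηʷ
  Δᵇ-S₋₁-μʷ = begin
    Δᵇ ⨾ (id 1 ⊕ S₋₁) ⨾ μʷ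
      ≈⟨ ⨾-congʳ (⨾-congˡ (⊕-congʳ (≈-trans (axiom (inj₁ (inˡ A11))) id₁≈id))) ⟨
    Δᵇ ⨾ (S 1# ⊕ S₋₁) ⨾ μʷ       ≈⟨ ι-cong (axiom (A18 _ _)) ⟩
    S (1# R.+ R.- 1#)            ≈⟨ ι-cong (axiom (s-cong (R.-‿inverseʳ 1#))) ⟩
    S 0#                         ≈⟨ ι-cong (axiom A17) ⟩
    εᵇ ⨾ ηʷ ∎

  -- As relations: y is split as w + z, and w is copied and added back to z.
  Δʷ-Δᵇ-μʷ : Δʷ ⨾ (Δᵇ ⊕ id 1) ⨾ (id 1 ⊕ μʷ) ≈ ηᵇ ⊕ id 1
  Δʷ-Δᵇ-μʷ = begin
    Δʷ ⨾ (Δᵇ ⊕ id 1) ⨾ (id 1 ⊕ μʷ)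
      -- The splitting of `y` becomes a free `w` paired with `-w + y`. Associativity then lets the
      -- copy of `w` meet `-w` before `y` is added, and `zero-branch` cancels them.
      ≈⟨ ⨾-congʳ (⨾-congʳ (≈-trans Δʷ-via-cupˡ (⨾-congʳ (⊕-congʳ white-cup)))) ⟩
    ((cup ⨾ (id 1 ⊕ S₋₁)) ⊕ id 1) ⨾ (id 1 ⊕ μʷ) ⨾ (Δᵇ ⊕ id 1) ⨾ (id 1 ⊕ μʷ)
      ≈⟨ ⨾-congʳ (swapʳ (≈-sym (interchange Δᵇ μʷ))) ⟩
    ((cup ⨾ (id 1 ⊕ S₋₁)) ⊕ id 1) ⨾ (Δᵇ ⊕ id 2) ⨾ (id 2 ⊕ μʷ) ⨾ (id 1 ⊕ μʷ)
      ≈⟨ ⨾-cong (⨾-cong (⨾-congˡ (≋⇒≈ (≋-sym (⊕-id≋ {m = 1} {1} Δᵇ)))) (≋⇒≈ (≋-sym (id-⊕≋ {m = 1} {1} μʷ)))) ≈-refl ⟩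
    ((cup ⨾ (id 1 ⊕ S₋₁)) ⊕ id 1) ⨾ ((Δᵇ ⊕ id 1) ⊕ id 1) ⨾ (id 1 ⊕ (id 1 ⊕ μʷ)) ⨾ (id 1 ⊕ μʷ)
      ≈⟨ ⨾-congʳ (⨾-congʳ (whiskerʳ-⨾ _ _)) ⟩
    ((cup ⨾ (id 1 ⊕ S₋₁) ⨾ (Δᵇ ⊕ id 1)) ⊕ id 1) ⨾ (id 1 ⊕ (id 1 ⊕ μʷ)) ⨾ (id 1 ⊕ μʷ)
      ≈⟨ pullʳ (≈-trans (whiskerˡ-⨾ _ _)
           (≈-trans (⊕-congˡ (≈-sym (ι-cong HA.μ-assoc))) (≈-sym (whiskerˡ-⨾ _ _)))) ⟩
    ((cup ⨾ (id 1 ⊕ S₋₁) ⨾ (Δᵇ ⊕ id 1)) ⊕ id 1) ⨾ ((id 1 ⊕ (μʷ ⊕ id 1)) ⨾ (id 1 ⊕ μʷ))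
      ≈⟨ ⨾-assoc _ _ _ ⟨
    ((cup ⨾ (id 1 ⊕ S₋₁) ⨾ (Δᵇ ⊕ id 1)) ⊕ id 1) ⨾ (id 1 ⊕ (μʷ ⊕ id 1)) ⨾ (id 1 ⊕ μʷ)
      ≈⟨ ⨾-congʳ (≈-trans (⨾-congˡ (≈-sym (⊕-assoc (id 1) μʷ (id 1)))) (whiskerʳ-⨾ _ _)) ⟩
    ((cup ⨾ (id 1 ⊕ S₋₁) ⨾ (Δᵇ ⊕ id 1) ⨾ (id 1 ⊕ μʷ)) ⊕ id 1) ⨾ (id 1 ⊕ μʷ)
      ≈⟨ ⨾-congʳ (⊕-congʳ zero-branch) ⟩
    ((ηᵇ ⊕ ηʷ) ⊕ id 1) ⨾ (id 1 ⊕ μʷ)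
      ≈⟨ ⨾-congʳ (⊕-assoc ηᵇ ηʷ (id 1)) ⟩
    (ηᵇ ⊕ (ηʷ ⊕ id 1)) ⨾ (id 1 ⊕ μʷ)
      ≈⟨ ≈-trans (≈-sym (⊕-⨾ _ _ _ _)) (⊕-cong (⨾-identityʳ ηᵇ) (ι-cong HA.unitˡ)) ⟩
    ηᵇ ⊕ id 1 ∎
    where
    zero-branch : cup ⨾ (id 1 ⊕ S₋₁) ⨾ (Δᵇ ⊕ id 1) ⨾ (id 1 ⊕ μʷ) ≈ ηᵇ ⊕ ηʷ
    zero-branch = begin
      cup ⨾ (id 1 ⊕ S₋₁) ⨾ (Δᵇ ⊕ id 1) ⨾ (id 1 ⊕ μʷ)
        ≈⟨ ⨾-congʳ (swapʳ (≈-sym (interchange Δᵇ S₋₁))) ⟩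
      cup ⨾ (Δᵇ ⊕ id 1) ⨾ (id 2 ⊕ S₋₁) ⨾ (id 1 ⊕ μʷ)
        ≈⟨ ⨾-congʳ (⨾-cong (≈-trans (pullʳ (ι-cong HA.coassoc)) (≈-sym (⨾-assoc _ _ _)))
                            (≋⇒≈ (≋-sym (id-⊕≋ {m = 1} {1} S₋₁)))) ⟩
      cup ⨾ (id 1 ⊕ Δᵇ) ⨾ (id 1 ⊕ (id 1 ⊕ S₋₁)) ⨾ (id 1 ⊕ μʷ)
        ≈⟨ ≈-trans (⨾-congʳ (pullʳ (whiskerˡ-⨾ _ _))) (pullʳ (whiskerˡ-⨾ _ _)) ⟩
      cup ⨾ (id 1 ⊕ (Δᵇ ⨾ (id 1 ⊕ S₋₁) ⨾ μʷ))
        ≈⟨ ⨾-congˡ (⊕-congˡ Δᵇ-S₋₁-μʷ) ⟩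
      cup ⨾ (id 1 ⊕ (εᵇ ⨾ ηʷ))
        ≈⟨ pushʳ (≈-sym (whiskerˡ-⨾ _ _)) ⟩
      cup ⨾ (id 1 ⊕ εᵇ) ⨾ (id 1 ⊕ ηʷ)
        ≈⟨ ⨾-congʳ (cancelʳ (ι-cong HA.counitʳ)) ⟩
      ηᵇ ⨾ (id 1 ⊕ ηʷ)
        ≈⟨ ⨾-congʳ (⊕-identityʳ ηᵇ) ⟨
      (ηᵇ ⊕ id 0) ⨾ (id 1 ⊕ ηʷ)
        ≈⟨ ⊕-splitˡ ηᵇ ηʷ ⟩
      ηᵇ ⊕ ηʷ ∎

-- Deciding whether a scalar is zero, and Bézout coefficients.

module PrincipalIdeals {c ℓ : Level} (R : CommutativeRing c ℓ) (isPID : IsPrincipalIdealDomain R) where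

  private module R = CommutativeRing R
  open R using (Carrier; 0#; 1#; _≈_; _*_) renaming (_+_ to _⊹_)
  open IsPrincipalIdealDomain isPID
  open RingProperties R.ring using ([y-z]x≈yx-zx)
  open Matrices R using (module RingSolver)
  open RingSolver using (solve; _:+_; _:*_; _:=_; con)

  -- The zero ideal or the whole ring, according to whether `k` vanishes. Membership of its
  -- generator is itself a disjunction, and this yields the case split.
  zeroIdealUnlessZero : Carrier → Ideal R
  zeroIdealUnlessZero k = record
    { _∈I      = λ x → Lift (c ⊔ ℓ) (x ≈ 0# ⊎ k ≈ 0#)
    ; resp     = λ { p (lift (inj₁ q)) → lift (inj₁ (R.trans (R.sym p) q))
                   ; p (lift (inj₂ q)) → lift (inj₂ q) }
    ; 0-closed = lift (inj₁ R.refl)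
    ; +-closed = λ { (lift (inj₁ p)) (lift (inj₁ q)) → lift (inj₁ (R.trans (R.+-cong p q) (R.+-identityˡ 0#)))
                   ; (lift (inj₁ p)) (lift (inj₂ q)) → lift (inj₂ q)
                   ; (lift (inj₂ p)) _ → lift (inj₂ p) }
    ; *-closed = λ { r (lift (inj₁ p)) → lift (inj₁ (R.trans (R.*-congˡ p) (R.zeroʳ r)))
                   ; r (lift (inj₂ p)) → lift (inj₂ p) }
    }

  -- If the generator of the ideal vanishes, then 1 is not in it, so k ≉ 0.
  ≈0-or-≉0 : ∀ k → k ≈ 0# ⊎ ¬ (k ≈ 0#)
  ≈0-or-≉0 k with principal (zeroIdealUnlessZero k)
  ... | g , ∈⇔ with lower (Equivalence.from (∈⇔ g) (1# , R.sym (R.*-identityˡ g)))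
  ...   | inj₂ k≈0 = inj₁ k≈0
  ...   | inj₁ g≈0 = inj₂ λ k≈0 →
    let r , 1≈rg = Equivalence.to (∈⇔ 1#) (lift (inj₂ k≈0))
    in 1≉0 (R.trans 1≈rg (R.trans (R.*-congˡ g≈0) (R.zeroʳ r)))

  idealOf : Carrier → Carrier → Ideal R
  idealOf j k = record
    { _∈I      = λ x → ∃₂ λ u v → x ≈ u * j ⊹ v * k
    ; resp     = λ { p (u , v , q) → u , v , R.trans (R.sym p) q }
    ; 0-closed = 0# , 0# , R.sym (solve 2 (λ j k → con 0 :* j :+ con 0 :* k := con 0) R.refl j k)
    ; +-closed = λ { (u , v , p) (u′ , v′ , q) → u ⊹ u′ , v ⊹ v′ , R.trans (R.+-cong p q)
        (solve 6 (λ u v u′ v′ j k → (u :* j :+ v :* k) :+ (u′ :* j :+ v′ :* k)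
                                      := (u :+ u′) :* j :+ (v :+ v′) :* k)
               R.refl u v u′ v′ j k) }
    ; *-closed = λ { r (u , v , p) → r * u , r * v , R.trans (R.*-congˡ p)
        (solve 5 (λ r u v j k → r :* (u :* j :+ v :* k) := (r :* u) :* j :+ (r :* v) :* k)
               R.refl r u v j k) }
    }

  record Bézout (j k : Carrier) : Set (c ⊔ ℓ) where
    field
      g a b u v : Carrier
      j≈ag      : j ≈ a * g
      k≈bg      : k ≈ b * g
      g≈uj+vk   : g ≈ u * j ⊹ v * k

    -- Substituting `j = a g` and `k = b g` into `g = u j + v k` shows that `(u a + v b - 1) g`
    -- vanishes, and a non-zero `g` can be cancelled in a domain.
    coprime : ¬ (g ≈ 0#) → u * a ⊹ v * b ≈ 1#
    coprime g≉0 with noZeroDivisors (u * a ⊹ v * b R.- 1#) g product≈0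
      where
      product≈0 : (u * a ⊹ v * b R.- 1#) * g ≈ 0#
      product≈0 = R.trans ([y-z]x≈yx-zx g (u * a ⊹ v * b) 1#)
        (R.trans (R.+-cong
          (R.trans (solve 5 (λ u v a b g → (u :* a :+ v :* b) :* g := u :* (a :* g) :+ v :* (b :* g))
                          R.refl u v a b g)
            (R.trans (R.sym (R.+-cong (R.*-congˡ j≈ag) (R.*-congˡ k≈bg))) (R.sym g≈uj+vk)))
          (R.-‿cong (R.*-identityˡ g)))
        (R.-‿inverseʳ g))
    ... | inj₂ g≈0 = contradiction g≈0 g≉0
    ... | inj₁ p = R.trans
      (R.trans (R.sym (R.+-identityʳ _)) (R.trans (R.+-congˡ (R.sym (R.-‿inverseˡ 1#))) (R.sym (R.+-assoc _ _ _))))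
      (R.trans (R.+-congʳ p) (R.+-identityˡ 1#))

  bézout : ∀ j k → Bézout j k
  bézout j k with principal (idealOf j k)
  ... | g , ∈⇔ =
    let a , j≈ag        = Equivalence.to (∈⇔ j) (1# , 0# ,
                            R.sym (solve 2 (λ j k → con 1 :* j :+ con 0 :* k := j) R.refl j k))
        b , k≈bg        = Equivalence.to (∈⇔ k) (0# , 1# ,
                            R.sym (solve 2 (λ j k → con 0 :* j :+ con 1 :* k := k) R.refl j k))
        u , v , g≈uj+vk = Equivalence.from (∈⇔ g) (1# , R.sym (R.*-identityˡ g))
    in record { g = g ; a = a ; b = b ; u = u ; v = v
              ; j≈ag = j≈ag ; k≈bg = k≈bg ; g≈uj+vk = g≈uj+vk }

-- Surjective matrices, and invertible changes of variables that clear a row.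

module Reductions {c ℓ : Level} (R : CommutativeRing c ℓ) (isPID : IsPrincipalIdealDomain R) where

  open Defs using (_⨾_)

  private
    module R = CommutativeRing R
    variable
      k l m n : ℕ

  open R using (Carrier; 0#; 1#)
  open RingProperties R.ring using (-‿distribˡ-*; -‿distribʳ-*; -‿involutive)
  open IsPrincipalIdealDomain isPID using (1≉0)
  open PrincipalIdeals R isPID
  open Duality R isPID
  open Interaction R isPID
  open Cartesian R
  open Matrices R
  open RingSolver using (solve; _:+_; _:*_; _:=_; con)
  open HATerms R
  open StrictMonoidal (IHEq R)
  private module HA = StrictMonoidal (HAEq R)

  -- As a relation, `dual (ι t) ⨾ ι t` is the identity restricted to the image of `t`.
  Surjective : Term (HAGen R) m n → Set (c ⊔ ℓ)
  Surjective {n = n} t = dual (ι t) ⨾ ι t ≈ id n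

  surjective-resp : {t u : Term (HAGen R) m n} → t HA.≈ u → Surjective t → Surjective u
  surjective-resp p =
    ≈-trans (⨾-cong (dual-cong (ι-cong (≈-sym p))) (ι-cong (≈-sym p)))

  surjective-⨾ : {t : Term (HAGen R) m n} {u : Term (HAGen R) n k} →
                 Surjective t → Surjective u → Surjective (t ⨾ u)
  surjective-⨾ p q = ≈-trans (≈-sym (⨾-assoc _ _ _)) (≈-trans (⨾-congʳ (cancelʳ p)) q)

  -- A surjective `t` may be inserted, together with its converse, in front of `u`. This undoes the
  -- scaling of an input made in `surjective-matrix`.
  surjective-cancelˡ : (t : Term (HAGen R) m n) {u : Term (HAGen R) n k} →
                       Surjective t → Surjective (t ⨾ u) → Surjective u
  surjective-cancelˡ t p q = ≈-trans (⨾-congʳ (≈-sym (cancelʳ p))) (≈-trans (⨾-assoc _ _ _) q)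

  surjective-⊕ : {t : Term (HAGen R) m n} {u : Term (HAGen R) k l} →
                 Surjective t → Surjective u → Surjective (t ⊕ u)
  surjective-⊕ p q = ≈-trans (≈-sym (⊕-⨾ _ _ _ _)) (≈-trans (⊕-cong p q) (⊕-id _ _))

  dual-ι-id : ∀ n → dual (ι (id n)) ≈ id n
  dual-ι-id n = ≈-trans (dual-cong (ι-id n)) (≡⇒≈ (dual-id n))

  surjective-id : ∀ n → Surjective (id n)
  surjective-id n = ≈-trans (⨾-cong (dual-ι-id n) (ι-id n)) (⨾-identityˡ _)

  surjective-S : ∀ {k} → ¬ (k R.≈ 0#) → Surjective (S k)
  surjective-S k≉0 = ≈-trans (axiom (inj₂ (I2 _ k≉0))) id₁≈id

  surjective-σ₁₁ : Surjective σ₁₁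
  surjective-σ₁₁ = σ₁₁-involutive

  -- (p , q) ↦ (p , k p + q)
  shear : Carrier → Term (HAGen R) 2 2
  shear k = (Δ ⊕ id 1) ⨾ (id 1 ⊕ ((S k ⊕ id 1) ⨾ μ))

  shear-0 : shear 0# HA.≈ id 2
  shear-0 = faithful₂ _ _ λ k l →
    solve 2 (λ k l → k :+ con 0 :* l := k) R.refl k l ∷ R.refl ∷ []

  -- The case of zero is apart because `S̄-Δᵇ-S` needs a non-zero scalar. Otherwise black Frobenius
  -- brings the converse and the shear together so that on the second wire a multiple of some `p` is
  -- split off and added back; `Δʷ-Δᵇ-μʷ` cancels this and leaves that `p` unconstrained.
  surjective-shear : ∀ k → Surjective (shear k)
  surjective-shear k with ≈0-or-≉0 k
  ... | inj₁ k≈0 = surjective-resp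
    (HA.⨾-congˡ (HA.⊕-congˡ (HA.⨾-congʳ (HA.⊕-congʳ (axiom (s-cong (R.sym k≈0)))))))
    (surjective-resp (≈-sym shear-0) (surjective-id 2))
  ... | inj₂ k≉0 = begin
    (id 1 ⊕ X) ⨾ (μᵇ ⊕ id 1) ⨾ ((Δᵇ ⊕ id 1) ⨾ (id 1 ⊕ Y))
      ≈⟨ ⨾-assoc _ _ _ ⟨
    (id 1 ⊕ X) ⨾ (μᵇ ⊕ id 1) ⨾ (Δᵇ ⊕ id 1) ⨾ (id 1 ⊕ Y)
      ≈⟨ ⨾-congʳ (swapʳ (≈-trans (whiskerʳ-⨾ _ _)
           (≈-trans (⊕-congʳ (≈-sym frobeniusᵇʳ)) (≈-sym (whiskerʳ-⨾ _ _))))) ⟩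
    (id 1 ⊕ X) ⨾ ((id 1 ⊕ Δᵇ) ⊕ id 1) ⨾ ((μᵇ ⊕ id 1) ⊕ id 1) ⨾ (id 1 ⊕ Y)
      ≈⟨ ⨾-congʳ (⨾-cong (⨾-congˡ (⊕-assoc (id 1) Δᵇ (id 1))) (≋⇒≈ (⊕-id≋ {m = 1} {1} μᵇ))) ⟩
    (id 1 ⊕ X) ⨾ (id 1 ⊕ (Δᵇ ⊕ id 1)) ⨾ (μᵇ ⊕ id 2) ⨾ (id 1 ⊕ Y)
      ≈⟨ ⨾-cong (⨾-congʳ (whiskerˡ-⨾ _ _)) ≈-refl ⟩
    (id 1 ⊕ (X ⨾ (Δᵇ ⊕ id 1))) ⨾ (μᵇ ⊕ id 2) ⨾ (id 1 ⊕ Y)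
      ≈⟨ swapʳ (interchange μᵇ Y) ⟩
    (id 1 ⊕ (X ⨾ (Δᵇ ⊕ id 1))) ⨾ (id 2 ⊕ Y) ⨾ (μᵇ ⊕ id 1)
      ≈⟨ ⨾-congʳ (≈-trans (⨾-congˡ (≋⇒≈ (≋-sym (id-⊕≋ {m = 1} {1} Y)))) (whiskerˡ-⨾ _ _)) ⟩
    (id 1 ⊕ (X ⨾ (Δᵇ ⊕ id 1) ⨾ (id 1 ⊕ Y))) ⨾ (μᵇ ⊕ id 1)
      ≈⟨ ⨾-congʳ (⊕-congˡ inner) ⟩
    (id 1 ⊕ (ηᵇ ⊕ id 1)) ⨾ (μᵇ ⊕ id 1)
      ≈⟨ ⨾-congʳ (⊕-assoc (id 1) ηᵇ (id 1)) ⟨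
    ((id 1 ⊕ ηᵇ) ⊕ id 1) ⨾ (μᵇ ⊕ id 1)
      ≈⟨ ≈-trans (whiskerʳ-⨾ _ _) (⊕-congʳ (dual-cong (ι-cong counitʳ))) ⟩
    id 1 ⊕ id 1
      ≈⟨ ⊕-id 1 1 ⟩
    id 2 ∎
    where
    open IHTerms R using (Δᵇ; μᵇ; ηᵇ; Δʷ; μʷ; S̄) renaming (S to Sᴵ)
    X : Term (IHGen R) 1 2
    X = Δʷ ⨾ (S̄ k ⊕ id 1)
    Y : Term (IHGen R) 2 1
    Y = (Sᴵ k ⊕ id 1) ⨾ μʷ
    inner : X ⨾ (Δᵇ ⊕ id 1) ⨾ (id 1 ⊕ Y) ≈ ηᵇ ⊕ id 1
    inner = begin
      Δʷ ⨾ (S̄ k ⊕ id 1) ⨾ (Δᵇ ⊕ id 1) ⨾ (id 1 ⊕ Y)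
        ≈⟨ ⨾-cong (pullʳ (whiskerʳ-⨾ _ _)) (≈-sym (whiskerˡ-⨾ _ _)) ⟩
      Δʷ ⨾ ((S̄ k ⨾ Δᵇ) ⊕ id 1) ⨾ ((id 1 ⊕ (Sᴵ k ⊕ id 1)) ⨾ (id 1 ⊕ μʷ))
        ≈⟨ ⨾-assoc _ _ _ ⟨
      Δʷ ⨾ ((S̄ k ⨾ Δᵇ) ⊕ id 1) ⨾ (id 1 ⊕ (Sᴵ k ⊕ id 1)) ⨾ (id 1 ⊕ μʷ)
        ≈⟨ ⨾-congʳ (⨾-congˡ (⊕-assoc (id 1) (Sᴵ k) (id 1))) ⟨
      Δʷ ⨾ ((S̄ k ⨾ Δᵇ) ⊕ id 1) ⨾ ((id 1 ⊕ Sᴵ k) ⊕ id 1) ⨾ (id 1 ⊕ μʷ)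
        ≈⟨ ⨾-congʳ (swapʳ (≈-trans (whiskerʳ-⨾ _ _)
             (≈-trans (⊕-congʳ (S̄-Δᵇ-S k≉0)) (≈-sym (whiskerʳ-⨾ _ _))))) ⟩
      Δʷ ⨾ (Δᵇ ⊕ id 1) ⨾ ((S̄ k ⊕ id 1) ⊕ id 1) ⨾ (id 1 ⊕ μʷ)
        ≈⟨ ⨾-congʳ (⨾-congˡ (≋⇒≈ (⊕-id≋ {m = 1} {1} (S̄ k)))) ⟩
      Δʷ ⨾ (Δᵇ ⊕ id 1) ⨾ (S̄ k ⊕ id 2) ⨾ (id 1 ⊕ μʷ)
        ≈⟨ swapʳ (interchange (S̄ k) μʷ) ⟩
      Δʷ ⨾ (Δᵇ ⊕ id 1) ⨾ (id 1 ⊕ μʷ) ⨾ (S̄ k ⊕ id 1)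
        ≈⟨ ⨾-congʳ Δʷ-Δᵇ-μʷ ⟩
      (ηᵇ ⊕ id 1) ⨾ (S̄ k ⊕ id 1)
        ≈⟨ ≈-trans (whiskerʳ-⨾ _ _) (⊕-congʳ (ηᵇ-S̄ k)) ⟩
      ηᵇ ⊕ id 1 ∎

  -- Up to scaling the first input by a, the matrix is a product of shears and
  -- scalings by the determinant d and by a.
  surjective-matrix : ∀ u b v a d → ¬ (a R.≈ 0#) → ¬ (d R.≈ 0#) →
                      u R.* a R.≈ d R.+ b R.* v → Surjective (matrix u b v a)
  surjective-matrix u b v a d a≉0 d≉0 det =
    -- Elimination with pivot `a` would divide by `a`. Scaling the first input by `a` keeps it
    -- within the ring: the top left entry becomes `u a`, which is `d + b v`.
    surjective-cancelˡ (S a ⊕ id 1) (surjective-⊕ (surjective-S a≉0) (surjective-id 1))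
      (surjective-resp (≈-sym factorisation)
        (surjective-⨾ (surjective-⨾ (surjective-⨾
          (surjective-shear v)
          (surjective-⊕ (surjective-S d≉0) (surjective-id 1)))
          (surjective-⨾ (surjective-⨾ surjective-σ₁₁ (surjective-shear b)) surjective-σ₁₁))
          (surjective-⊕ (surjective-id 1) (surjective-S a≉0))))
    where
    factorisation : (S a ⊕ id 1) ⨾ matrix u b v a HA.≈
                    shear v ⨾ (S d ⊕ id 1) ⨾ (σ₁₁ ⨾ shear b ⨾ σ₁₁) ⨾ (id 1 ⊕ S a)
    factorisation = faithful₂ _ _ λ k l → R.trans
      (solve 5 (λ a u v k l → a :* (u :* k :+ v :* l) := (u :* a) :* k :+ v :* (a :* l)) R.refl a u v k l)
      (R.trans (R.+-congʳ (R.*-congʳ det))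
      (solve 6 (λ a b v d k l → (d :+ b :* v) :* k :+ v :* (a :* l)
                  := d :* k :+ v :* (a :* l :+ b :* k)) R.refl a b v d k l))
      ∷ R.+-comm _ _ ∷ []

  -- A change of variables that turns `ks` into a multiple of the first variable. `U⨾V` allows it to
  -- be applied to the remaining rows too, and `adjoint` makes `ι U` a converse, which can join the
  -- left leg of a span.
  record Reduction {n : ℕ} (ks : Vec Carrier (suc n)) : Set (c ⊔ ℓ) where
    field
      g       : Carrier
      U V     : Term (HAGen R) (suc n) (suc n)
      U⨾V     : U ⨾ V HA.≈ id (suc n)
      adjoint : ι U ≈ dual (ι V)
      row-g   : U ⨾ row (g ∷ replicate n 0#) HA.≈ row ks


  adjoint-of-inverse : {U : Term (HAGen R) m n} {V : Term (HAGen R) n m} →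
                       V ⨾ U HA.≈ id n → Surjective V → ι U ≈ dual (ι V)
  adjoint-of-inverse {U = U} {V} V⨾U surj = begin
    ι U                          ≈⟨ ⨾-identityˡ _ ⟨
    id _ ⨾ ι U                   ≈⟨ ⨾-congʳ surj ⟨
    dual (ι V) ⨾ ι V ⨾ ι U       ≈⟨ cancelʳ (≈-trans (ι-cong V⨾U) (ι-id _)) ⟩
    dual (ι V) ∎

  matrix-σ₁₁ : ∀ a b c d → matrix a b c d ⨾ σ₁₁ HA.≈ matrix c d a b
  matrix-σ₁₁ a b c d = faithful₂ _ _ λ k l → R.+-comm _ _ ∷ R.+-comm _ _ ∷ []

  module _ {a b u v : Carrier} (det : u R.* a R.+ v R.* b R.≈ 1#) where

    private
      neg-neg : ∀ x y → R.- x R.* R.- y R.≈ x R.* y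
      neg-neg x y = R.trans (R.sym (-‿distribˡ-* x (R.- y)))
        (R.trans (R.-‿cong (R.sym (-‿distribʳ-* x y))) (-‿involutive _))

      vanish : ∀ x y → x R.* y R.+ R.- x R.* y R.≈ 0#
      vanish x y = R.trans (R.+-congˡ (R.sym (-‿distribˡ-* x y))) (R.-‿inverseʳ _)

      vanish′ : ∀ x y → R.- x R.* y R.+ y R.* x R.≈ 0#
      vanish′ x y = R.trans (R.+-comm _ _) (R.trans (R.+-congʳ (R.*-comm y x)) (vanish x y))

    -- The first row of `U₂` holds the cofactors, so that `g` times it is the given pair. The Bézout
    -- coefficients complete it to determinant 1, and `V₂` is the adjugate.
    U₂ V₂ : Term (HAGen R) 2 2
    U₂ = matrix a b (R.- v) u
    V₂ = matrix u (R.- b) v a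

    U₂⨾V₂ : U₂ ⨾ V₂ HA.≈ id 2
    U₂⨾V₂ = ≈-trans (matrix-⨾ _ _ _ _ _ _ _ _) (≈-trans (matrix-cong
      (R.trans (R.+-congˡ (R.trans (neg-neg b v) (R.*-comm b v))) det)
      (R.trans (R.+-congʳ (R.*-comm u b)) (vanish b u))
      (R.trans (R.+-congˡ (R.*-comm a (R.- v))) (vanish v a))
      (R.trans (R.+-comm _ _) (R.trans (R.+-congʳ (R.*-comm a u)) det)))
      matrix-1)

    V₂⨾U₂ : V₂ ⨾ U₂ HA.≈ id 2
    V₂⨾U₂ = ≈-trans (matrix-⨾ _ _ _ _ _ _ _ _) (≈-trans (matrix-cong
      (R.trans (R.+-cong (R.*-comm a u) (R.*-comm b v)) det)
      (R.trans (R.+-congʳ (R.*-comm a (R.- b))) (R.trans (R.+-congˡ (R.*-comm b a)) (vanish′ b a)))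
      (vanish′ v u)
      (R.trans (R.+-comm _ _) (R.trans (R.+-congˡ (neg-neg v b)) det)))
      matrix-1)

    surjective-V₂ : Surjective V₂
    surjective-V₂ with ≈0-or-≉0 a
    ... | inj₂ a≉0 = surjective-matrix u (R.- b) v a 1# a≉0 1≉0 (R.sym
      (R.trans (R.+-congʳ (R.sym det)) (R.trans (R.+-assoc _ _ _)
      (R.trans (R.+-congˡ (R.trans (R.+-congʳ (R.*-comm v b)) (vanish b v))) (R.+-identityʳ _)))))
    -- The pivot fails, but then `v b = 1`, so `b` is non-zero. Exchanging the outputs puts `- b` in
    -- the pivot position and makes the determinant `- 1`.
    ... | inj₁ a≈0 =
      surjective-resp (HA.cancelʳ HA.σ₁₁-involutive)
        (surjective-⨾
          (surjective-resp (≈-sym (matrix-σ₁₁ u (R.- b) v a))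
            (surjective-matrix v a u (R.- b) (R.- 1#) -b≉0 -1≉0
              (R.trans v-b (R.trans (R.sym (R.+-identityʳ _)) (R.+-congˡ (R.sym au≈0))))))
          surjective-σ₁₁)
      where
      au≈0 : a R.* u R.≈ 0#
      au≈0 = R.trans (R.*-congʳ a≈0) (R.zeroˡ u)
      v-b : v R.* R.- b R.≈ R.- 1#
      v-b = R.trans (R.sym (-‿distribʳ-* v b)) (R.-‿cong
        (R.trans (R.sym (R.+-identityˡ _))
        (R.trans (R.+-congʳ (R.sym (R.trans (R.*-comm u a) au≈0))) det)))
      -b≉0 : ¬ (R.- b R.≈ 0#)
      -b≉0 p = -1≉0 (R.trans (R.sym v-b) (R.trans (R.*-congˡ p) (R.zeroʳ v)))

  reduction-pair : ∀ j k → Reduction (j ∷ k ∷ [])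
  reduction-pair j k with ≈0-or-≉0 (Bézout.g (bézout j k))
  -- The cofactors of a zero `g` need not be coprime, but `j` and `k` are then both zero and the row
  -- is reduced already.
  ... | inj₁ g≈0 = record
    { g       = g
    ; U       = id 2
    ; V       = id 2
    ; U⨾V     = ⨾-identityˡ _
    ; adjoint = ≈-trans (ι-id 2) (≈-sym (dual-ι-id 2))
    ; row-g   = ≈-trans (⨾-identityˡ _) (row-cong (vanishing j≈ag g≈0 ∷ vanishing k≈bg R.refl ∷ []))
    }
    where
    open Bézout (bézout j k)
    vanishing : ∀ {x y z} → x R.≈ y R.* g → z R.≈ 0# → z R.≈ x
    vanishing {y = y} p q =
      R.trans q (R.sym (R.trans p (R.trans (R.*-congˡ g≈0) (R.zeroʳ y))))
  ... | inj₂ g≉0 = record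
    { g       = g
    ; U       = U₂ det
    ; V       = V₂ det
    ; U⨾V     = U₂⨾V₂ det
    ; adjoint = adjoint-of-inverse (V₂⨾U₂ det) (surjective-V₂ det)
    ; row-g   = ≈-trans (row-natural (U₂ det) (g ∷ 0# ∷ []))
                  (row-cong (entry j≈ag ∷ entry k≈bg ∷ []))
    }
    where
    open Bézout (bézout j k)
    det = coprime g≉0
    entry : ∀ {x y z} → x R.≈ y R.* g → y R.* g R.+ z R.* 0# R.≈ x
    entry {z = z} p = R.trans (R.+-congˡ (R.zeroʳ z)) (R.trans (R.+-identityʳ _) (R.sym p))

  reduction : (ks : Vec Carrier (suc n)) → Reduction ks
  reduction (k ∷ []) = record
    { g       = k
    ; U       = id 1
    ; V       = id 1
    ; U⨾V     = ⨾-identityˡ _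
    ; adjoint = ≈-refl
    ; row-g   = ⨾-identityˡ _
    }
  reduction {suc n} (k ∷ ks@(_ ∷ _)) = record
    { g       = p.g
    -- The tail is cleared to `r.g` by `r.U`, after which `p.U` merges `k` with `r.g`. Rows are
    -- pulled back along `U`, so the verification in `rows` meets `p.U` first.
    ; U       = (id 1 ⊕ r.U) ⨾ (p.U ⊕ id n)
    ; V       = (p.V ⊕ id n) ⨾ (id 1 ⊕ r.V)
    ; U⨾V     = ≈-trans (≈-sym (⨾-assoc _ _ _)) (≈-trans
        (HA.⨾-congʳ (HA.cancelʳ (≈-trans (HA.whiskerʳ-⨾ _ _) (≈-trans (HA.⊕-congʳ p.U⨾V) (⊕-id 2 n)))))
        (≈-trans (HA.whiskerˡ-⨾ _ _) (≈-trans (HA.⊕-congˡ r.U⨾V) (⊕-id 1 _))))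
    ; adjoint = ⨾-cong (⊕-congˡ r.adjoint)
                       (⊕-cong p.adjoint (≈-trans (ι-id n) (≈-sym (dual-ι-id n))))
    ; row-g   = rows
    }
    where
    module r = Reduction (reduction ks)
    module p = Reduction (reduction-pair k r.g)
    zeros = replicate n 0#
    rows : (id 1 ⊕ r.U) ⨾ (p.U ⊕ id n) ⨾ row (p.g ∷ 0# ∷ zeros) HA.≈ row (k ∷ ks)
    rows = HA.begin
      (id 1 ⊕ r.U) ⨾ (p.U ⊕ id n) ⨾ row (p.g ∷ 0# ∷ zeros)
        HA.≈⟨ HA.⨾-congˡ (row-++ (p.g ∷ 0# ∷ []) zeros) ⟩
      (id 1 ⊕ r.U) ⨾ (p.U ⊕ id n) ⨾ ((row (p.g ∷ 0# ∷ []) ⊕ row zeros) ⨾ μ)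
        HA.≈⟨ HA.pullʳ (≈-trans (≈-sym (⨾-assoc _ _ _)) (HA.⨾-congʳ
                (≈-trans (≈-sym (⊕-⨾ _ _ _ _)) (⊕-cong p.row-g (⨾-identityˡ _))))) ⟩
      (id 1 ⊕ r.U) ⨾ ((row (k ∷ r.g ∷ []) ⊕ row zeros) ⨾ μ)
        HA.≈⟨ HA.⨾-congˡ (≈-sym (row-++ (k ∷ r.g ∷ []) zeros)) ⟩
      (id 1 ⊕ r.U) ⨾ ((S k ⊕ row (r.g ∷ zeros)) ⨾ μ)
        HA.≈⟨ ⨾-assoc _ _ _ ⟨
      (id 1 ⊕ r.U) ⨾ (S k ⊕ row (r.g ∷ zeros)) ⨾ μ
        HA.≈⟨ HA.⨾-congʳ (≈-trans (≈-sym (⊕-⨾ _ _ _ _))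
                (⊕-cong (⨾-identityˡ _) r.row-g)) ⟩
      row (k ∷ ks) HA.∎

-- Exchange of the two colours as a covariant symmetry of IH.

module ColourSwap {c ℓ : Level} (R : CommutativeRing c ℓ) (isPID : IsPrincipalIdealDomain R) where

  open Defs using (_⨾_)

  private
    module R = CommutativeRing R
    variable
      m n : ℕ
    T : ℕ → ℕ → Set c
    T = Term (IHGen R)

  open IHTerms R
  open StrictMonoidal (IHEq R)
  open Duality R isPID
  open Interaction R isPID

  -- Copying is the transpose of addition and discarding that of zero, so this induces matrix
  -- transposition. Followed by the passage to opposites, it exchanges the colours and keeps the
  -- direction of arrows.
  transposeGen : HAGen R m n → HAGen R n m
  transposeGen Δ•    = μ∘
  transposeGen ε•    = η∘
  transposeGen μ∘    = Δ•
  transposeGen η∘    = ε•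
  transposeGen (s k) = s k

  transpose : Term (HAGen R) m n → Term (HAGen R) n m
  transpose (gen g) = gen (transposeGen g)
  transpose id₀     = id₀
  transpose id₁     = id₁
  transpose σ₁₁     = σ₁₁
  transpose (t ⨾ u) = transpose u ⨾ transpose t
  transpose (t ⊕ u) = transpose t ⊕ transpose u

  swapGen : IHGen R m n → IHGen R m n
  swapGen (inj₁ g) = inj₂ (transposeGen g)
  swapGen (inj₂ g) = inj₁ (transposeGen g)

  -- dual maps spans to spans, whereas swap maps spans to cospans.
  swap : T m n → T m n
  swap = mapTerm swapGen

  swap-involutive : (t : T m n) → swap (swap t) ≡ t
  swap-involutive (gen (inj₁ Δ•))    = refl
  swap-involutive (gen (inj₁ ε•))    = refl
  swap-involutive (gen (inj₁ μ∘))    = refl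
  swap-involutive (gen (inj₁ η∘))    = refl
  swap-involutive (gen (inj₁ (s k))) = refl
  swap-involutive (gen (inj₂ Δ•))    = refl
  swap-involutive (gen (inj₂ ε•))    = refl
  swap-involutive (gen (inj₂ μ∘))    = refl
  swap-involutive (gen (inj₂ η∘))    = refl
  swap-involutive (gen (inj₂ (s k))) = refl
  swap-involutive id₀     = refl
  swap-involutive id₁     = refl
  swap-involutive σ₁₁     = refl
  swap-involutive (t ⨾ u) = cong₂ _⨾_ (swap-involutive t) (swap-involutive u)
  swap-involutive (t ⊕ u) = cong₂ _⊕_ (swap-involutive t) (swap-involutive u)

  swap-dual : (t : T m n) → swap (dual t) ≡ dual (swap t)
  swap-dual (gen (inj₁ g)) = refl
  swap-dual (gen (inj₂ g)) = refl
  swap-dual id₀     = refl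
  swap-dual id₁     = refl
  swap-dual σ₁₁     = refl
  swap-dual (t ⨾ u) = cong₂ _⨾_ (swap-dual u) (swap-dual t)
  swap-dual (t ⊕ u) = cong₂ _⊕_ (swap-dual t) (swap-dual u)

  swap-dual-ι : (t : Term (HAGen R) m n) → swap (dual (ι t)) ≡ ι (transpose t)
  swap-dual-ι (gen g) = refl
  swap-dual-ι id₀     = refl
  swap-dual-ι id₁     = refl
  swap-dual-ι σ₁₁     = refl
  swap-dual-ι (t ⨾ u) = cong₂ _⨾_ (swap-dual-ι u) (swap-dual-ι t)
  swap-dual-ι (t ⊕ u) = cong₂ _⊕_ (swap-dual-ι t) (swap-dual-ι u)

  swap-ι : (t : Term (HAGen R) m n) → swap (ι t) ≡ dual (ι (transpose t))
  swap-ι (gen g) = refl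
  swap-ι id₀     = refl
  swap-ι id₁     = refl
  swap-ι σ₁₁     = refl
  swap-ι (t ⨾ u) = cong₂ _⨾_ (swap-ι t) (swap-ι u)
  swap-ι (t ⊕ u) = cong₂ _⊕_ (swap-ι t) (swap-ι u)

  -- Transposition permutes the equations of HA, up to bracketing in `A8` and `A18`. It reverses the
  -- product in `A12`, which is where commutativity of the ring enters.
  swap-axiomʰ : {t u : Term (HAGen R) m n} → HAEq R t u →
                swap (mapTerm inj₁ t) ≈ swap (mapTerm inj₁ u)
  swap-axiomʰ (s-cong p) = axiom (inj₁ (inʳ (op (s-cong p))))
  swap-axiomʰ A1         = axiom (inj₁ (inʳ (op A4)))
  swap-axiomʰ A2         = axiom (inj₁ (inʳ (op A5)))
  swap-axiomʰ A3         = axiom (inj₁ (inʳ (op A6)))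
  swap-axiomʰ A4         = axiom (inj₁ (inʳ (op A1)))
  swap-axiomʰ A5         = axiom (inj₁ (inʳ (op A2)))
  swap-axiomʰ A6         = axiom (inj₁ (inʳ (op A3)))
  swap-axiomʰ A7         = axiom (inj₁ (inʳ (op A9)))
  swap-axiomʰ A8         = ≈-trans (axiom (inj₁ (inʳ (op A8)))) (≈-sym (⨾-assoc _ _ _))
  swap-axiomʰ A9         = axiom (inj₁ (inʳ (op A7)))
  swap-axiomʰ A10        = axiom (inj₁ (inʳ (op A10)))
  swap-axiomʰ A11        = axiom (inj₁ (inʳ (op A11)))
  swap-axiomʰ (A12 k l)  =
    ≈-trans (axiom (inj₁ (inʳ (op (A12 l k))))) (axiom (inj₁ (inʳ (op (s-cong (R.*-comm l k))))))
  swap-axiomʰ (A13 k)    = axiom (inj₁ (inʳ (op (A15 k))))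
  swap-axiomʰ (A14 k)    = axiom (inj₁ (inʳ (op (A16 k))))
  swap-axiomʰ (A15 k)    = axiom (inj₁ (inʳ (op (A13 k))))
  swap-axiomʰ (A16 k)    = axiom (inj₁ (inʳ (op (A14 k))))
  swap-axiomʰ A17        = axiom (inj₁ (inʳ (op A17)))
  swap-axiomʰ (A18 k l)  = ≈-trans (⨾-assoc _ _ _) (axiom (inj₁ (inʳ (op (A18 k l)))))

  swap-axiom : {t u : T m n} → IHEq R t u → swap t ≈ swap u
  swap-axiom (inj₁ (inˡ x)) = swap-axiomʰ x
  swap-axiom (inj₁ (inʳ (op {t = t} {u} x))) =
    ≈-trans (≡⇒≈ (side t)) (≈-trans (dual-cong (swap-axiomʰ x)) (≡⇒≈ (sym (side u))))
    where
    side : ∀ {m n} (t : Term (HAGen R) m n) →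
           swap (mapTerm inj₂ (opTerm t)) ≡ dual (swap (mapTerm inj₁ t))
    side t = trans (cong swap (sym (dual-inj₁ t))) (swap-dual (mapTerm inj₁ t))
  swap-axiom (inj₂ (I1 l l≉0)) = axiom (inj₂ (I2 l l≉0))
  swap-axiom (inj₂ (I2 l l≉0)) = axiom (inj₂ (I1 l l≉0))
  swap-axiom (inj₂ I3ˡ) = axiom (inj₂ I4ˡ)
  swap-axiom (inj₂ I3ʳ) = axiom (inj₂ I4ʳ)
  swap-axiom (inj₂ I4ˡ) = axiom (inj₂ I3ˡ)
  swap-axiom (inj₂ I4ʳ) = axiom (inj₂ I3ʳ)
  -- The exchanged equation expresses the black cup by the white one: it is `white-cup` solved for
  -- `cup`, the antipode being an involution.
  swap-axiom (inj₂ I5) = begin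
    cup                                      ≈⟨ cancelʳ (≈-trans (whiskerˡ-⨾ _ _)
                                                  (≈-trans (⊕-congˡ S₋₁-S₋₁) (⊕-id 1 1))) ⟨
    cup ⨾ (id 1 ⊕ S₋₁) ⨾ (id 1 ⊕ S₋₁)        ≈⟨ ⨾-cong (≈-sym white-cup)
                                                  (⊕-cong (≈-sym id₁≈id) (≈-sym S̄₋₁≈S₋₁)) ⟩
    ηʷ ⨾ Δʷ ⨾ (id₁ ⊕ S̄ (R.- R.1#)) ∎
  swap-axiom (inj₂ I6) = begin
    cap                                      ≈⟨ cap-via-white ⟩
    (id 1 ⊕ S₋₁) ⨾ (μʷ ⨾ εʷ)                 ≈⟨ ⨾-assoc _ _ _ ⟨
    (id 1 ⊕ S₋₁) ⨾ μʷ ⨾ εʷ                   ≈⟨ ⨾-congʳ (⨾-congʳ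
                                                  (⊕-cong (≈-sym id₁≈id) (≈-sym S̄₋₁≈S₋₁))) ⟩
    (id₁ ⊕ S̄ (R.- R.1#)) ⨾ μʷ ⨾ εʷ ∎
  swap-axiom (inj₂ I7) = axiom (inj₂ I8)
  swap-axiom (inj₂ I8) = axiom (inj₂ I7)

  swap-cong : {t u : T m n} → t ≈ u → swap t ≈ swap u
  swap-cong = mapTerm-resp swapGen swap-axiom

-- Spans of matrices, their closure under all generators, and the factorisations.

module Factorisation {c ℓ : Level} (R : CommutativeRing c ℓ) (isPID : IsPrincipalIdealDomain R) where

  open Defs using (_⨾_)

  private
    module R = CommutativeRing R
    variable
      k l m n m′ n′ : ℕ
    T : ℕ → ℕ → Set c
    T = Term (IHGen R)
    H : ℕ → ℕ → Set c
    H = Term (HAGen R)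

  open R using (Carrier; 0#; 1#)
  open IHTerms R
  open StrictMonoidal (IHEq R)
  open Duality R isPID
  open Interaction R isPID
  open PrincipalIdeals R isPID using (≈0-or-≉0)
  open Reductions R isPID
  open Cartesian R
  open Matrices R
  private
    module HA = StrictMonoidal (HAEq R)
    module H = HATerms R

  Span : T m n → Set (c ⊔ ℓ)
  Span {m} {n} t = ∃[ z ] Σ[ f ∈ H z m ] Σ[ g ∈ H z n ] t ≈ dual (ι f) ⨾ ι g

  span-resp : {t u : T m n} → t ≈ u → Span t → Span u
  span-resp p (z , f , g , q) = z , f , g , ≈-trans (≈-sym p) q

  span-resp≋ : {t : T m n} {u : T m′ n′} → t ≋ u → Span t → Span u
  span-resp≋ (het refl refl p) = span-resp p

  span-ι : (f : H m n) → Span (ι f)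
  span-ι f = _ , id _ , f , ≈-sym (≈-trans (⨾-congʳ (dual-ι-id _)) (⨾-identityˡ _))

  span-⨾ι : {t : T m n} → Span t → (h : H n k) → Span (t ⨾ ι h)
  span-⨾ι (z , f , g , p) h = z , f , g ⨾ h , ≈-trans (⨾-congʳ p) (⨾-assoc _ _ _)

  span-dual⨾ : (h : H m k) {t : T m n} → Span t → Span (dual (ι h) ⨾ t)
  span-dual⨾ h (z , f , g , p) = z , f ⨾ h , g , ≈-trans (⨾-congˡ p) (≈-sym (⨾-assoc _ _ _))

  span-⊕id : {t : T m n} → Span t → ∀ l → Span (t ⊕ id l)
  span-⊕id (z , f , g , p) l = z + l , f ⊕ id l , g ⊕ id l , ≈-trans (⊕-congʳ p)
    (≈-trans (≈-sym (whiskerʳ-⨾ _ _))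
      (⨾-cong (⊕-congˡ (≈-sym (dual-ι-id l))) (⊕-congˡ (≈-sym (ι-id l)))))

  -- Arrows whose precomposition with matrices yields spans, also when they
  -- are placed next to idle wires.
  Good : T m n → Set (c ⊔ ℓ)
  Good {m} t = ∀ {k l} (A : H k (m + l)) → Span (ι A ⨾ (t ⊕ id l))

  good-resp : {t u : T m n} → t ≈ u → Good t → Good u
  good-resp p good A = span-resp (⨾-congˡ (⊕-congʳ p)) (good A)

  -- The right leg of the span obtained for `t` is again a matrix, so it can be fed to `u`; the left
  -- leg is put back at the end. No pullback of two matrices is formed.
  good-⨾ : {t : T m n} {u : T n k} → Good t → Good u → Good (t ⨾ u)
  good-⨾ good-t good-u A with good-t A
  ... | z , f , g , p = span-resp
    (≈-trans (≈-sym (⨾-assoc _ _ _)) (≈-trans (⨾-congʳ (≈-sym p)) (pullʳ (whiskerʳ-⨾ _ _))))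
    (span-dual⨾ f (good-u g))

  good-ι : (h : H m n) → Good (ι h)
  good-ι h {l = l} A =
    span-resp (⨾-congˡ (⊕-congˡ (ι-id l))) (span-ι (A ⨾ (h ⊕ id l)))

  good-σ : ∀ m n → Good (σ m n)
  good-σ m n = good-resp (ι-σ m n) (good-ι (σ m n))

  good-⊕id : {t : T m n} → Good t → ∀ k → Good (t ⊕ id k)
  good-⊕id {m} {n} {t} good k {l = l} A =
    span-resp≋ (≋-⨾ (ι-subst₂ (+-assoc m k l) A) (≋-sym (⊕-id≋ t)))
      (good (subst₂ H refl (+-assoc m k l) A))
    where
    ι-subst₂ : ∀ {j p q} (r : p ≡ q) (A : H j p) → ι (subst₂ H refl r A) ≋ ι A
    ι-subst₂ refl A = ≋-refl

  -- `Good` allows idle wires on one side only; those on the other side are brought across by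
  -- conjugation with symmetries.
  good-id⊕ : {t : T m n} → Good t → ∀ k → Good (id k ⊕ t)
  good-id⊕ {m} {n} {t} good k = good-resp
    (≈-trans (⨾-congʳ (≈-sym (σ-natural (id k) t))) (cancelʳ (σ-involutive k n)))
    (good-⨾ (good-⨾ (good-σ k m) (good-⊕id good k)) (good-σ n k))

  good-⊕ : {t : T m n} {u : T m′ n′} → Good t → Good u → Good (t ⊕ u)
  good-⊕ {t = t} {u} good-t good-u =
    good-resp (⊕-splitˡ t u) (good-⨾ (good-⊕id good-t _) (good-id⊕ good-u _))

  good-ηᵇ : Good ηᵇ
  -- The apex gains a free variable, which the left leg discards and the right leg outputs.
  good-ηᵇ {k} {l} A = _ , H.ε ⊕ id k , id 1 ⊕ A , (begin
    ι A ⨾ (ηᵇ ⊕ id l)                ≈⟨ ⨾-congʳ (⊕-identityˡ (ι A)) ⟨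
    (id 0 ⊕ ι A) ⨾ (ηᵇ ⊕ id l)       ≈⟨ interchange ηᵇ (ι A) ⟨
    (ηᵇ ⊕ id k) ⨾ (id 1 ⊕ ι A)       ≈⟨ ⨾-congʳ (⊕-congˡ (dual-ι-id k)) ⟨
    (ηᵇ ⊕ dual (ι (id k))) ⨾ (id 1 ⊕ ι A) ∎)

  -- As a relation, the identity restricted to those `x` with `g x = 0`. In a domain this is either
  -- no condition at all or `x = 0`, and the latter is a span with apex 0.
  span-constraint : ∀ g → Span (Δᵇ ⨾ (S g ⊕ id 1) ⨾ (εʷ ⊕ id 1))
  span-constraint g with ≈0-or-≉0 g
  ... | inj₂ g≉0 = _ , H.η , H.η , (begin
    Δᵇ ⨾ (S g ⊕ id 1) ⨾ (εʷ ⊕ id 1)   ≈⟨ pullʳ (≈-trans (whiskerʳ-⨾ _ _) (⊕-congʳ (S-εʷ g≉0))) ⟩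
    Δᵇ ⨾ (εʷ ⊕ id 1)                  ≈⟨ Δᵇ-εʷ ⟩
    εʷ ⨾ ηʷ ∎)
  ... | inj₁ g≈0 = span-resp (≈-sym (begin
    Δᵇ ⨾ (S g ⊕ id 1) ⨾ (εʷ ⊕ id 1)   ≈⟨ pullʳ (≈-trans (whiskerʳ-⨾ _ _) (⊕-congʳ (begin
        S g ⨾ εʷ        ≈⟨ ⨾-congʳ (ι-cong (≈-trans (axiom (s-cong g≈0)) (axiom A17))) ⟩
        εᵇ ⨾ ηʷ ⨾ εʷ    ≈⟨ cancelʳ ηʷ-εʷ ⟩
        εᵇ ∎))) ⟩
    Δᵇ ⨾ (εᵇ ⊕ id 1)                  ≈⟨ ι-cong counitˡ ⟩
    id 1 ∎)) (span-ι (id 1))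

  split-row : (A : H k (suc l)) →
              A HA.≈ copy k ⨾ (row (pull A (1# ∷ replicate l 0#)) ⊕ (A ⨾ (H.ε ⊕ id l)))
  split-row {l = l} A = ≈-trans (pairing A) (HA.⨾-congˡ (HA.⊕-congʳ
    (≈-trans (HA.⨾-congˡ (≈-sym (row-1-zeros l))) (row-natural A _))))

  -- The reduced row discards every variable but the first, so only the first one really has to be
  -- copied.
  copy-row : ∀ g k → copy (suc k) ⨾ (row (g ∷ replicate k 0#) ⊕ id (suc k))
                     HA.≈ (H.Δ ⨾ (H.S g ⊕ id 1)) ⊕ id k
  copy-row g k = HA.begin
    copy (suc k) ⨾ (row (g ∷ replicate k 0#) ⊕ id (suc k))
      HA.≈⟨ HA.⨾-congˡ (⊕-cong (row-∷-zeros g k) (≈-sym (⊕-id 1 k))) ⟩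
    copy (suc k) ⨾ ((H.S g ⊕ discard k) ⊕ (id 1 ⊕ id k))
      HA.≋⟨ copy-discard (H.S g) (id 1) (discard k) (id k) ⟩
    (copy 1 ⨾ (H.S g ⊕ id 1)) ⊕ (copy k ⨾ (discard k ⊕ id k))
      HA.≈⟨ ⊕-cong (HA.⨾-congʳ copy-1) (copy-counitˡ k) ⟩
    (H.Δ ⨾ (H.S g ⊕ id 1)) ⊕ id k HA.∎

  -- Writing `B` as `U ⨾ (V ⨾ B)` makes `U` a common factor of both components; naturality of
  -- copying moves it to the front.
  reduce-row : {ks : Vec Carrier (suc k)} (r : Reduction ks) (B : H (suc k) l) →
               let open Reduction r in
               copy (suc k) ⨾ (row ks ⊕ B)
                 HA.≈ U ⨾ ((H.Δ ⨾ (H.S g ⊕ id 1)) ⊕ id k) ⨾ (id 1 ⊕ (V ⨾ B))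
  reduce-row {k = k} {ks = ks} r B = HA.begin
    copy (suc k) ⨾ (row ks ⊕ B)
      HA.≈⟨ HA.⨾-congˡ (⊕-cong (≈-sym row-g)
              (≈-trans (≈-sym (⨾-identityˡ B))
                (≈-trans (HA.⨾-congʳ (≈-sym U⨾V)) (⨾-assoc U V B)))) ⟩
    copy (suc k) ⨾ ((U ⨾ row gs) ⊕ (U ⨾ (V ⨾ B)))
      HA.≈⟨ HA.pushʳ (⊕-⨾ U (row gs) U (V ⨾ B)) ⟩
    copy (suc k) ⨾ (U ⊕ U) ⨾ (row gs ⊕ (V ⨾ B))
      HA.≈⟨ ⨾-cong (≈-sym (copy-natural U)) (≈-sym (HA.⊕-splitˡ (row gs) (V ⨾ B))) ⟩
    U ⨾ copy (suc k) ⨾ ((row gs ⊕ id (suc k)) ⨾ (id 1 ⊕ (V ⨾ B)))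
      HA.≈⟨ ⨾-assoc _ _ _ ⟨
    U ⨾ copy (suc k) ⨾ (row gs ⊕ id (suc k)) ⨾ (id 1 ⊕ (V ⨾ B))
      HA.≈⟨ HA.⨾-congʳ (HA.pullʳ (copy-row g k)) ⟩
    U ⨾ ((H.Δ ⨾ (H.S g ⊕ id 1)) ⊕ id k) ⨾ (id 1 ⊕ (V ⨾ B)) HA.∎
    where
    open Reduction r
    gs : Vec Carrier (suc k)
    gs = g ∷ replicate k 0#

  span-row : (ks : Vec Carrier k) (B : H k l) →
             Span (ι (copy k ⨾ (row ks ⊕ B)) ⨾ (εʷ ⊕ id l))
  -- Without variables the equation reads `0 = 0`, which `ηʷ-εʷ` removes.
  span-row {l = l} [] B = span-resp (≈-sym (begin
    id 0 ⨾ (ηʷ ⊕ ι B) ⨾ (εʷ ⊕ id l)   ≈⟨ ⨾-congʳ (⨾-identityˡ _) ⟩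
    (ηʷ ⊕ ι B) ⨾ (εʷ ⊕ id l)          ≈⟨ ≈-trans (≈-sym (⊕-⨾ _ _ _ _)) (⊕-cong ηʷ-εʷ (⨾-identityʳ _)) ⟩
    id 0 ⊕ ι B                        ≈⟨ ⊕-identityˡ _ ⟩
    ι B ∎)) (span-ι B)
  span-row {suc k} {l} ks@(_ ∷ _) B =
    span-resp (≈-sym (≈-trans (⨾-congʳ (ι-cong (reduce-row r B))) reduced))
      (span-⨾ι (span-dual⨾ V (span-⊕id (span-constraint g) k)) (V ⨾ B))
    where
    r : Reduction ks
    r = reduction ks
    open Reduction r
    C : T 1 2
    C = Δᵇ ⨾ (S g ⊕ id 1)
    reduced : ι U ⨾ (C ⊕ ι (id k)) ⨾ (id 1 ⊕ ι (V ⨾ B)) ⨾ (εʷ ⊕ id l)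
              ≈ dual (ι V) ⨾ ((C ⨾ (εʷ ⊕ id 1)) ⊕ id k) ⨾ ι (V ⨾ B)
    reduced = begin
      ι U ⨾ (C ⊕ ι (id k)) ⨾ (id 1 ⊕ ι (V ⨾ B)) ⨾ (εʷ ⊕ id l)
        ≈⟨ ⨾-congʳ (⨾-congʳ (⨾-cong adjoint (⊕-congˡ (ι-id k)))) ⟩
      dual (ι V) ⨾ (C ⊕ id k) ⨾ (id 1 ⊕ ι (V ⨾ B)) ⨾ (εʷ ⊕ id l)
        -- The zero test touches the first wire only, so it can be made before the remaining rows
        -- are evaluated; there it meets `C` and forms the constraint.
        ≈⟨ swapʳ (≈-sym (interchange εʷ (ι (V ⨾ B)))) ⟩
      dual (ι V) ⨾ (C ⊕ id k) ⨾ (εʷ ⊕ id (suc k)) ⨾ (id 0 ⊕ ι (V ⨾ B))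
        ≈⟨ ⨾-cong (⨾-congˡ (≈-trans (⊕-congˡ (≈-sym (⊕-id 1 k)))
             (≈-sym (⊕-assoc εʷ (id 1) (id k))))) (⊕-identityˡ _) ⟩
      dual (ι V) ⨾ (C ⊕ id k) ⨾ ((εʷ ⊕ id 1) ⊕ id k) ⨾ ι (V ⨾ B)
        ≈⟨ ⨾-congʳ (pullʳ (whiskerʳ-⨾ C (εʷ ⊕ id 1))) ⟩
      dual (ι V) ⨾ ((C ⨾ (εʷ ⊕ id 1)) ⊕ id k) ⨾ ι (V ⨾ B) ∎

  good-εʷ : Good εʷ
  good-εʷ {l = l} A =
    span-resp (⨾-congʳ (ι-cong (≈-sym (split-row A)))) (span-row _ (A ⨾ (H.ε ⊕ id l)))

  good-cup : Good cup
  good-cup = good-⨾ good-ηᵇ (good-ι H.Δ)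

  good-cap : Good cap
  good-cap = good-resp (≈-sym cap-via-white)
    (good-⨾ (good-ι (id 1 ⊕ H.S (R.- 1#))) (good-⨾ (good-ι H.μ) good-εʷ))

  good : (t : T m n) → Good t
  good (gen (inj₁ g))  = good-ι (gen g)
  good (gen (inj₂ Δ•)) = good-resp (≈-sym μᵇ-via-cap)
    (good-⨾ (good-ι (H.Δ ⊕ id 1)) (good-id⊕ good-cap 1))
  good (gen (inj₂ ε•)) = good-ηᵇ
  good (gen (inj₂ μ∘)) = good-resp (≈-sym Δʷ-via-cupʳ)
    (good-⨾ (good-id⊕ (good-resp (≈-sym white-cup)
              (good-⨾ good-cup (good-ι (id 1 ⊕ H.S (R.- 1#))))) 1)
            (good-ι (H.μ ⊕ id 1)))
  good (gen (inj₂ η∘)) = good-εʷ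
  good (gen (inj₂ (s k))) with ≈0-or-≉0 k
  -- By the reversed `A17`, the converse of the zero map tests its input for zero and leaves its
  -- output free.
  ... | inj₁ k≈0 = good-resp
    (dual-cong (ι-cong (≈-sym (≈-trans (axiom (s-cong k≈0)) (axiom A17)))))
    (good-⨾ good-εʷ good-ηᵇ)
  ... | inj₂ k≉0 = good-resp (≈-sym (S̄-bent k≉0))
    (good-⨾ (good-⨾ (good-⊕id good-cup 1) (good-ι (id 1 ⊕ (H.S k ⊕ id 1))))
            (good-id⊕ good-cap 1))
  good id₀     = good-ι id₀
  good id₁     = good-ι id₁
  good σ₁₁     = good-ι σ₁₁
  good (t ⨾ u) = good-⨾ (good t) (good u)
  good (t ⊕ u) = good-⊕ (good t) (good u)

  span : (t : T m n) → Span t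
  span {m} t = span-resp≋
    (≋-trans (≈⇒≋ (≈-trans (⨾-congʳ (ι-id (m + 0))) (⨾-identityˡ _))) (⊕-identityʳ≋ t))
    -- The identity matrix with no idle wires; the `m + 0` comes from the idle wires in `Good`.
    (good t (id (m + 0)))

  open ColourSwap R isPID

  cospan : (t : T m n) → ∃[ z ] Σ[ f ∈ H m z ] Σ[ g ∈ H n z ] t ≈ ι f ⨾ dual (ι g)
  cospan t with span (swap t)
  ... | z , f , g , p = z , transpose f , transpose g , (begin
    t                                         ≈⟨ ≡⇒≈ (swap-involutive t) ⟨
    swap (swap t)                             ≈⟨ swap-cong p ⟩
    swap (dual (ι f)) ⨾ swap (ι g)            ≈⟨ ≡⇒≈ (cong₂ _⨾_ (swap-dual-ι f) (swap-ι g)) ⟩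
    ι (transpose f) ⨾ dual (ι (transpose g)) ∎)

theorem6p2 :
    ∀ {r ℓ} (R : CommutativeRing r ℓ) → IsPrincipalIdealDomain R →
    let open PROP (IH R)
        open PROPMorphism (φ₁ R) using () renaming (⟦_⟧ to Φ₁)
        open PROPMorphism (φ₂ R) using () renaming (⟦_⟧ to Φ₂)
    in ∀ (n m : ℕ) (c : Hom n m) →
       (∃[ z ] Σ[ c₁ ∈ PROP.Hom (HAᵒᵖ R) n z ] Σ[ c₂ ∈ PROP.Hom (HA R) z m ]
          (c ≈ Φ₂ c₁ ⨾ Φ₁ c₂))
       × (∃[ z ] Σ[ c₃ ∈ PROP.Hom (HA R) n z ] Σ[ c₄ ∈ PROP.Hom (HAᵒᵖ R) z m ]
          (c ≈ Φ₁ c₃ ⨾ Φ₂ c₄))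
theorem6p2 R isPID n m c
  with Factorisation.span R isPID c | Factorisation.cospan R isPID c
... | z , f , g , p | z′ , f′ , g′ , q =
    (z , opTerm f , g , ≈-trans p (⨾-congʳ (≡⇒≈ (dual-ι f))))
  , (z′ , f′ , opTerm g′ , ≈-trans q (⨾-congˡ (≡⇒≈ (dual-ι g′))))
  where
  open StrictMonoidal (IHEq R)
  open Duality R isPID
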